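{- Let $v$ be a positive integer such that every maximal prime-power factor of $v$ (i.e. every $p^{a}$ with $p$ prime, $p^a\mid v$, $p^{a+1}\nmid v$, $a\ge1$) is a prime power congruent to $1 \pmod 6$ and different from $13$. Then there exists a regular Fano Kaleidoscope FK$(v)$.
   Context: A Fano Kaleidoscope of order $v$, FK$(v)$, is a set $\mathcal F$ of Fano planes (2-$(7,3,1)$ designs) whose points lie in a $v$-set $\mathcal V$, the seven lines of each plane colored with seven distinct colors $c_0,\dots,c_6$, such that for any two distinct points $x,y\in\mathcal V$ and any color $c_i$ there is exactly one plane of $\mathcal F$ whose $c_i$-colored line contains $x$ and $y$. It is regular if there is a group $G$ of order $v$ acting sharply transitively on $\mathcal V$ (so $\mathcal V$ is identified with $G$) such that the collection of colored planes is invariant under translations by $G$. -}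

module Defs where

open import Data.Nat using (ℕ; suc; _^_; _%_; _≤_; _+_)
open import Data.Nat.Divisibility using (_∣_)
open import Data.Nat.Primality using (Prime)
open import Data.Fin using (Fin)
open import Data.Fin.Subset using (Subset; _∈_; ∣_∣; ⋃)
open import Data.Vec using (tabulate; lookup)
import Data.List as List
open import Data.Product using (Σ; _×_; ∃; ∃-syntax; _,_)
open import Relation.Binary.PropositionalEquality using (_≡_; _≢_)
open import Relation.Nullary using (¬_)
open import Function.Definitions using (Injective)
open import Algebra.Core using (Op₂; Op₁)
open import Algebra.Structures using (IsGroup)

-- A colored Fano plane with points in V = Fin v: its seven lines, the line
-- of color c_i being  line i  (a subset of V), forming a 2-(7,3,1) design
-- on the point set (union of the lines): 7 points, every line has 3 points,
-- any two distinct points lie on exactly one line.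
pointsOf : ∀ {v} → (Fin 7 → Subset v) → Subset v
pointsOf line = ⋃ (List.tabulate line)

record ColoredFano (v : ℕ) : Set where
  field
    line        : Fin 7 → Subset v
    lineSize    : ∀ i → ∣ line i ∣ ≡ 3
    pointCount  : ∣ pointsOf line ∣ ≡ 7
    pairUnique  : ∀ x y → x ∈ pointsOf line → y ∈ pointsOf line → x ≢ y →
                  Σ (Fin 7) λ i → (x ∈ line i × y ∈ line i) ×
                    (∀ j → x ∈ line j → y ∈ line j → j ≡ i)
open ColoredFano public

IsFK : ∀ {v n} → (Fin n → ColoredFano v) → Set
IsFK {v} {n} F =
  ∀ (x y : Fin v) → x ≢ y → ∀ (i : Fin 7) →
    Σ (Fin n) λ k → (x ∈ line (F k) i × y ∈ line (F k) i) ×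
      (∀ k′ → x ∈ line (F k′) i → y ∈ line (F k′) i → k′ ≡ k)

translate : ∀ {v} → Op₂ (Fin v) → Op₁ (Fin v) → Fin v → Subset v → Subset v
translate _∙_ _⁻¹ g S = tabulate λ y → lookup S ((g ⁻¹) ∙ y)

-- A regular FK(v): a group structure on the v-set V = Fin v (so the group
-- acts sharply transitively on V by left translation) and a set (injectively
-- indexed family) of colored Fano planes forming an FK(v), invariant under
-- all translations (colors preserved).
RegularFK : ℕ → Set
RegularFK v =
  Σ (Op₂ (Fin v)) λ _∙_ → Σ (Fin v) λ ε → Σ (Op₁ (Fin v)) λ _⁻¹ →
  IsGroup (_≡_ {A = Fin v}) _∙_ ε _⁻¹ ×
  Σ ℕ λ n → Σ (Fin n → ColoredFano v) λ F →
    Injective _≡_ _≡_ F × IsFK F ×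
    (∀ (k : Fin n) (g : Fin v) → Σ (Fin n) λ k′ →
       ∀ i → line (F k′) i ≡ translate _∙_ _⁻¹ g (line (F k) i))

GoodOrder : ℕ → Set
GoodOrder v =
  ∀ p a → Prime p → 1 ≤ a → (p ^ a) ∣ v → ¬ ((p ^ (a + 1)) ∣ v) →
    (p ^ a) % 6 ≡ 1 × p ^ a ≢ 13

{-# OPTIONS --safe #-}
-- Let F be a field with q = 6n + 1 elements and e = 2n, so that x ↦ x^e splits the nonzero elements into three
-- classes (the cosets of the cubes). A Fano plane in F is rainbow if the differences of the points of each line
-- lie in the three different classes; its multiples by representatives of the cubes modulo ±1 then form a family
-- of base planes for the additive group, every nonzero element being a difference exactly once in each color.
-- Such families can be multiplied by means of difference matrices, so it suffices to find rainbow planes in the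
-- fields of order p ≡ 1 (mod 6), p ≠ 13, and p², p ≡ 5 (mod 6), and in those of order 13² and 13³.
--
-- For q ≥ 100000 this needs only the variance of the numbers N_i(z) of points x of a set X such that x - z lies
-- in class i: summing (N_0 - N_1)² + (N_1 - N_2)² + (N_2 - N_0)² over z gives at most 2|X|q, because
-- (x - z)/(y - z) is an e-th root of unity for at most e - 1 values of z when x ≠ y. Fix a, b, c. At least q/5
-- points complete b, c to a rainbow triangle, and likewise c, a and a, b. For at least q/5 points d, the class of
-- d - a is not the one containing most of the x - a, x in the first of these sets, and similarly for b and c; for
-- a suitable one of these d, at least q/36 of the points x completing b, c also complete a, d, and similarly for
-- the points y completing c, a and b, d, and the points z completing a, b and c, d. The variance, used twice more,
-- yields a rainbow triangle x, y, z among them, and a, b, c, d, x, y, z is the required plane.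
-- For q < 100000 the planes are listed or found by a search.
module Submission where

open import Defs
open import Level using (0ℓ)
open import Data.Bool as Bool using (Bool; true; false; if_then_else_; not; _∧_; _∨_)
import Data.Empty as Empty
open import Data.Unit using (⊤; tt)
open import Data.Nat as ℕ using (ℕ; zero; suc; NonZero; s≤s; z≤n; _≤_; _<_; _%_; _/_; _≡ᵇ_; _<ᵇ_; ∣_-_∣)
open import Data.Nat using () renaming (_+_ to _⊕_; _*_ to _⊛_)
import Data.Nat.Properties as ℕ
open import Data.Nat.DivMod using (_mod_; m%n<n; n%n≡0; m<n⇒m%n≡m; m≡m%n+[m/n]*n; %-distribˡ-+; %-distribˡ-*)
open import Data.Nat.Divisibility using (_∣_; divides; _∣?_; _∣0; 1∣_; m%n≡0⇒n∣m; n∣m⇒m%n≡0; ∣m+n∣m⇒∣n; ∣m∣n⇒∣m+n; ∣m⇒∣m*n; ∣n⇒∣m*n; m∣m*n; ∣1⇒≡1; ∣-trans; *-monoʳ-∣; *-cancelˡ-∣)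
open import Data.Nat.Induction using (<-wellFounded; Acc; acc)
open import Data.Nat.Primality using (Prime; prime?; Composite; composite-≢; euclidsLemma; prime⇒nonZero; prime⇒nonTrivial; prime⇒¬composite; prime⇒irreducible)
open import Data.Nat.Primality.Factorisation using (factorise)
open import Data.Nat.Tactic.RingSolver using (solve-∀)
open import Data.Fin as Fin using (Fin; zero; suc; toℕ; fromℕ<; punchIn)
open import Data.Fin.Patterns
open import Data.Fin.Properties as Fin using (any?; all?; _≟_; pigeonhole; suc-injective; punchInᵢ≢i; toℕ<n; toℕ-fromℕ<; fromℕ<-toℕ; +↔⊎; *↔×; 0↔⊥; 1↔⊤)
open import Data.Fin.Permutation using (Permutation′; permutation)
open import Data.Fin.Subset using (Subset; _∈_; _∉_; ∣_∣; ⁅_⁆; _∪_; ⋃; ⊥; inside; outside)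
open import Data.Fin.Subset.Properties using (⊆-antisym; x∈⁅x⁆; x∈⁅y⁆⇒x≡y; x∈p∪q⁺; x∈p∪q⁻; ∉⊥; ∣⊥∣≡0; ∪-identityˡ)
open import Data.Vec as Vec using (Vec; []; _∷_; here; there)
open import Data.Vec.Properties using (lookup∘tabulate; lookup⇒[]=; []=⇒lookup)
open import Data.List as List using (List; []; _∷_)
open import Data.List.Relation.Unary.All using (_∷_)
open import Data.Product using (Σ; ∃; _×_; _,_; proj₁; proj₂)
open import Data.Product.Properties using (,-injectiveˡ; ,-injectiveʳ)
open import Data.Product.Function.NonDependent.Propositional using (_×-↔_)
open import Data.Sum as ⊎ using (_⊎_; inj₁; inj₂; [_,_]′)
open import Data.Sum.Function.Propositional using (_⊎-↔_)
open import Function using (_∘_; _↔_; Inverse; mk↔ₛ′)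
open import Function.Definitions using (Injective)
open import Function.Construct.Identity using (↔-id)
open import Function.Construct.Symmetry using (↔-sym)
open import Function.Construct.Composition using (_↔-∘_)
open import Algebra.Bundles using (AbelianGroup; CommutativeMonoid; CommutativeRing)
open import Algebra.Construct.DirectProduct using () renaming (abelianGroup to productGroup)
open import Algebra.Core using (Op₁; Op₂)
open import Algebra.Structures using (IsGroup; IsAbelianGroup; IsCommutativeRing)
open import Algebra.Properties.CommutativeSemigroup ℕ.*-commutativeSemigroup using () renaming (interchange to *-interchange)
import Algebra.Properties.Group as GroupProperties
import Algebra.Properties.Ring as RingProperties
import Algebra.Properties.CommutativeSemiring.Exp as Exp
import Algebra.Properties.Monoid.Mult as Mult
import Algebra.Properties.CommutativeMonoid.Sum as Sum
open import Relation.Nullary using (¬_; Dec; yes; no; contradiction; does; recompute)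
open import Relation.Nullary.Decidable using (True; toWitness; from-yes; _×-dec_; _⊎-dec_; _→-dec_; ¬?; map′)
open import Relation.Binary.Definitions using (tri<; tri≈; tri>; DecidableEquality)
open import Relation.Binary.PropositionalEquality hiding ([_])

-- Base families of Fano planes

-- In the large case a, b, c, d is a quadrangle of the plane and x, y, z are its diagonal points.
-- Six of the lines contain one side of the quadrangle and one diagonal point, so each of x, y, z
-- obeys only two conditions, given by a pair of opposite sides; only the seventh line ties the
-- three together. Second moments suffice for this, and their only algebraic input is the number of
-- roots of `X^e - a`; no estimate of Weil's kind for character sums enters.
--
-- The obstacle is the choice of d: the points completing b, c might nearly all see a in one class,
-- and if d - a had that class as well, no triangle on a, d would be left. Hence the dominant class
-- is avoided at each of a, b, c.
--
-- The bound 100000 comes from the seventh line, whose estimate ends with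
-- `q ≤ 95904 = 4 · 9 · 72 · 37` as the contradiction.
--
-- Products yield elementary abelian groups, so fields of order p^a are required only for small a.
-- If p ≡ 5 (mod 6), an admissible exponent is even and p² suffices; for p = 13 the exponents 2 and
-- 3 generate all exponents above 1.

image : ∀ {m v} → (Fin m → Fin v) → Subset v
image {zero}  f = ⊥
image {suc m} f = ⁅ f zero ⁆ ∪ image (f ∘ suc)

∈-image⁺ : ∀ {m v} (f : Fin m → Fin v) j → f j ∈ image f
∈-image⁺ f zero    = x∈p∪q⁺ (inj₁ (x∈⁅x⁆ (f zero)))
∈-image⁺ f (suc j) = x∈p∪q⁺ (inj₂ (∈-image⁺ (f ∘ suc) j))

∈-image⁻ : ∀ {m v} (f : Fin m → Fin v) {x} → x ∈ image f → ∃ λ j → f j ≡ x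
∈-image⁻ {zero}  f x∈ = contradiction x∈ ∉⊥
∈-image⁻ {suc m} f x∈ with x∈p∪q⁻ ⁅ f zero ⁆ _ x∈
... | inj₁ x∈₁ = zero , sym (x∈⁅y⁆⇒x≡y _ x∈₁)
... | inj₂ x∈₂ = let j , eq = ∈-image⁻ (f ∘ suc) x∈₂ in suc j , eq

∣⁅x⁆∪p∣≡1+∣p∣ : ∀ {v} {x : Fin v} {p : Subset v} → x ∉ p → ∣ ⁅ x ⁆ ∪ p ∣ ≡ suc ∣ p ∣
∣⁅x⁆∪p∣≡1+∣p∣ {x = zero}  {inside  ∷ p} x∉p = contradiction here x∉p
∣⁅x⁆∪p∣≡1+∣p∣ {x = zero}  {outside ∷ p} x∉p = cong (suc ∘ ∣_∣) (∪-identityˡ p)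
∣⁅x⁆∪p∣≡1+∣p∣ {x = suc x} {inside  ∷ p} x∉p = cong suc (∣⁅x⁆∪p∣≡1+∣p∣ (x∉p ∘ there))
∣⁅x⁆∪p∣≡1+∣p∣ {x = suc x} {outside ∷ p} x∉p = ∣⁅x⁆∪p∣≡1+∣p∣ (x∉p ∘ there)

∣image∣ : ∀ {m v} {f : Fin m → Fin v} → Injective _≡_ _≡_ f → ∣ image f ∣ ≡ m
∣image∣ {zero}  {v} inj = ∣⊥∣≡0 v
∣image∣ {suc m} {f = f} inj = trans (∣⁅x⁆∪p∣≡1+∣p∣ f0∉) (cong suc (∣image∣ λ eq → suc-injective (inj eq)))
  where
  open import Data.Fin.Properties using (suc-injective)
  f0∉ : f zero ∉ image (f ∘ suc)
  f0∉ f0∈ with ∈-image⁻ (f ∘ suc) f0∈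
  ... | j , eq with inj eq
  ... | ()

∈-⋃⁺ : ∀ {m v} (p : Fin m → Subset v) i {x} → x ∈ p i → x ∈ ⋃ (List.tabulate p)
∈-⋃⁺ p zero    x∈ = x∈p∪q⁺ (inj₁ x∈)
∈-⋃⁺ p (suc i) x∈ = x∈p∪q⁺ (inj₂ (∈-⋃⁺ (p ∘ suc) i x∈))

∈-⋃⁻ : ∀ {m v} (p : Fin m → Subset v) {x} → x ∈ ⋃ (List.tabulate p) → ∃ λ i → x ∈ p i
∈-⋃⁻ {zero}  p x∈ = contradiction x∈ ∉⊥
∈-⋃⁻ {suc m} p x∈ with x∈p∪q⁻ (p zero) _ x∈
... | inj₁ x∈₁ = zero , x∈₁
... | inj₂ x∈₂ = let i , x∈i = ∈-⋃⁻ (p ∘ suc) x∈₂ in suc i , x∈i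

translate-image : ∀ {m v} (_∙_ : Op₂ (Fin v)) (_⁻¹ : Op₁ (Fin v)) g →
                  (∀ x → (g ⁻¹) ∙ (g ∙ x) ≡ x) → (∀ x → g ∙ ((g ⁻¹) ∙ x) ≡ x) →
                  (f : Fin m → Fin v) → translate _∙_ _⁻¹ g (image f) ≡ image (λ j → g ∙ f j)
translate-image _∙_ _⁻¹ g cancelˡ cancelʳ f = ⊆-antisym to from
  where
  to : ∀ {x} → x ∈ translate _∙_ _⁻¹ g (image f) → x ∈ image (λ j → g ∙ f j)
  to {x} x∈ with ∈-image⁻ f (lookup⇒[]= _ (image f) (trans (sym (lookup∘tabulate _ x)) ([]=⇒lookup x∈)))
  ... | j , eq = subst (_∈ image (λ j → g ∙ f j)) (trans (cong (g ∙_) eq) (cancelʳ x)) (∈-image⁺ (λ j → g ∙ f j) j)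
  from : ∀ {x} → x ∈ image (λ j → g ∙ f j) → x ∈ translate _∙_ _⁻¹ g (image f)
  from {x} x∈ with ∈-image⁻ (λ j → g ∙ f j) x∈
  ... | j , refl = lookup⇒[]= x _ (trans (lookup∘tabulate _ x)
                     (trans (cong (Vec.lookup (image f)) (cancelˡ (f j))) ([]=⇒lookup (∈-image⁺ f j))))

-- Line c of the abstract Fano plane on Fin 7 is the translate {c, c+1, c+3} of a perfect difference set.
onLine : Fin 7 → Fin 3 → Fin 7
onLine c s = (toℕ c ℕ.+ offset s) mod 7
  where
  offset : Fin 3 → ℕ
  offset zero             = 0
  offset (suc zero)       = 1
  offset (suc (suc zero)) = 3

onLine-injective : ∀ c {s t} → onLine c s ≡ onLine c t → s ≡ t
onLine-injective c {s} {t} = from-yes (all? λ c → all? λ s → all? λ t →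
  (onLine c s ≟ onLine c t) →-dec (s ≟ t)) c s t

abstract
  -- Decided by inspecting all cases. The case `i ≡ j` is included on purpose: it supplies some line
  -- through a given point.
  joinLine : ∀ i j → ∃ λ c → (∃ λ s → onLine c s ≡ i) × (∃ λ t → onLine c t ≡ j)
  joinLine = from-yes (all? λ i → all? λ j → any? λ c →
    any? (λ s → onLine c s ≟ i) ×-dec any? (λ t → onLine c t ≟ j))

  joinLine-unique : ∀ c s t → s ≢ t → proj₁ (joinLine (onLine c s) (onLine c t)) ≡ c
  joinLine-unique = from-yes (all? λ c → all? λ s → all? λ t →
    ¬? (s ≟ t) →-dec (proj₁ (joinLine (onLine c s) (onLine c t)) ≟ c))

coloredFano : ∀ {v} (p : Fin 7 → Fin v) → Injective _≡_ _≡_ p → ColoredFano v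
coloredFano p p-inj = record
  { line       = L
  ; lineSize   = λ c → ∣image∣ {f = p ∘ onLine c} (onLine-injective c ∘ p-inj)
  ; pointCount = trans (cong ∣_∣ (⊆-antisym points⊆ ⊆points)) (∣image∣ p-inj)
  ; pairUnique = pair
  }
  where
  L : Fin 7 → Subset _
  L c = image (p ∘ onLine c)
  points⊆ : ∀ {x} → x ∈ pointsOf L → x ∈ image p
  points⊆ x∈ with ∈-⋃⁻ L x∈
  ... | c , x∈c with ∈-image⁻ (p ∘ onLine c) x∈c
  ... | s , refl = ∈-image⁺ p (onLine c s)
  ⊆points : ∀ {x} → x ∈ image p → x ∈ pointsOf L
  ⊆points x∈ with ∈-image⁻ p x∈
  -- The diagonal case of `joinLine`: any line through the point will do.
  ... | i , refl with joinLine i i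
  ... | c , (s , refl) , _ = ∈-⋃⁺ L c (∈-image⁺ (p ∘ onLine c) s)
  pair : ∀ x y → x ∈ pointsOf L → y ∈ pointsOf L → x ≢ y →
         Σ (Fin 7) λ i → (x ∈ L i × y ∈ L i) × (∀ j → x ∈ L j → y ∈ L j → j ≡ i)
  pair x y x∈ y∈ x≢y with ∈-image⁻ p (points⊆ x∈) | ∈-image⁻ p (points⊆ y∈)
  ... | i , refl | j , refl = c , (on s i s≡ , on t j t≡) , unique
    where
    c  = proj₁ (joinLine i j)
    s  = proj₁ (proj₁ (proj₂ (joinLine i j)))
    s≡ = proj₂ (proj₁ (proj₂ (joinLine i j)))
    t  = proj₁ (proj₂ (proj₂ (joinLine i j)))
    t≡ = proj₂ (proj₂ (proj₂ (joinLine i j)))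
    on : ∀ r k → onLine c r ≡ k → p k ∈ L c
    on r _ refl = ∈-image⁺ (p ∘ onLine c) r
    unique : ∀ c′ → p i ∈ L c′ → p j ∈ L c′ → c′ ≡ c
    unique c′ s∈ t∈ with ∈-image⁻ (p ∘ onLine c′) s∈ | ∈-image⁻ (p ∘ onLine c′) t∈
    ... | s′ , eqs | t′ , eqt = sym (subst₂ (λ i′ j′ → proj₁ (joinLine i′ j′) ≡ c′) (p-inj eqs) (p-inj eqt)
      (joinLine-unique c′ s′ t′ λ { refl → x≢y (trans (sym eqs) eqt) }))

-- The rows form a difference matrix, which is what makes the notion multiplicative.
record BaseFamily (v : ℕ) : Set₁ where
  infixl 6 _+_
  field
    Point          : Set
    enumPoint      : Point ↔ Fin v
    _+_            : Op₂ Point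
    0#             : Point
    -_             : Op₁ Point
    isAbelianGroup : IsAbelianGroup _≡_ _+_ 0# -_
    Plane          : Set
    size           : ℕ
    enumPlane      : Plane ↔ Fin size
    pt             : Plane → Fin 7 → Point
    pt-injective   : ∀ k → Injective _≡_ _≡_ (pt k)
    represent      : ∀ c g → g ≢ 0# → ∃ λ k → ∃ λ s → ∃ λ t → pt k (onLine c s) ≡ g + pt k (onLine c t)
    represent-unique : ∀ c {g} → g ≢ 0# → ∀ {k s t k′ s′ t′} →
      pt k  (onLine c s)  ≡ g + pt k  (onLine c t)  →
      pt k′ (onLine c s′) ≡ g + pt k′ (onLine c t′) → k′ ≡ k × s′ ≡ s × t′ ≡ t
    row            : Fin 7 → Point → Point
    row-solve      : ∀ {i j} → i ≢ j → ∀ g → ∃ λ t → row i t ≡ g + row j t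
    row-unique     : ∀ {i j} → i ≢ j → ∀ {g t t′} → row i t ≡ g + row j t → row i t′ ≡ g + row j t′ → t′ ≡ t

  abelianGroup : AbelianGroup 0ℓ 0ℓ
  abelianGroup = record { isAbelianGroup = isAbelianGroup }

-- The planes are all translates `h + pt k`. A translate has x and y on its line of color c exactly
-- when `x - y` is represented there by `(k , s , t)`, and then `h` is forced to be
-- `x - pt k (onLine c s)`; so existence and uniqueness of the plane are those of the
-- representation.
baseFamily⇒regularFK : ∀ {v} → BaseFamily v → RegularFK v
baseFamily⇒regularFK {v} B =
  _∙_ , to 0# , _⁻¹ , isGroup′ , size ℕ.* v , F , F-injective , isFK , invariant
  where
  open BaseFamily B
  open AbelianGroup abelianGroup using (group; isGroup; assoc; comm; identityˡ; identityʳ; inverseˡ; inverseʳ)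
  open GroupProperties group
  open Inverse enumPoint using (to; from; strictlyInverseˡ; strictlyInverseʳ)

  to-injective : Injective _≡_ _≡_ to
  to-injective {x} {y} eq = trans (sym (strictlyInverseʳ x)) (trans (cong from eq) (strictlyInverseʳ y))

  _∙_ : Op₂ (Fin v)
  x ∙ y = to (from x + from y)
  _⁻¹ : Op₁ (Fin v)
  x ⁻¹ = to (- from x)

  from-∙ : ∀ x y → from (x ∙ y) ≡ from x + from y
  from-∙ x y = strictlyInverseʳ _

  from-⁻¹ : ∀ x → from (x ⁻¹) ≡ - from x
  from-⁻¹ x = strictlyInverseʳ _

  from-injective : Injective _≡_ _≡_ from
  from-injective {x} {y} eq = trans (sym (strictlyInverseˡ x)) (trans (cong to eq) (strictlyInverseˡ y))

  isGroup′ : IsGroup _≡_ _∙_ (to 0#) _⁻¹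
  isGroup′ = record
    { isMonoid = record
      { isSemigroup = record
        { isMagma = record { isEquivalence = isEquivalence ; ∙-cong = cong₂ _∙_ }
        ; assoc   = λ x y z → cong to (trans (cong (_+ from z) (from-∙ x y))
                      (trans (assoc (from x) (from y) (from z)) (cong (from x +_) (sym (from-∙ y z)))))
        }
      ; identity = (λ x → trans (cong to (trans (cong (_+ from x) (strictlyInverseʳ 0#)) (identityˡ _))) (strictlyInverseˡ x))
                 , (λ x → trans (cong to (trans (cong (from x +_) (strictlyInverseʳ 0#)) (identityʳ _))) (strictlyInverseˡ x))
      }
    ; inverse = (λ x → cong to (trans (cong (_+ from x) (from-⁻¹ x)) (inverseˡ _)))
              , (λ x → cong to (trans (cong (from x +_) (from-⁻¹ x)) (inverseʳ _)))
    ; ⁻¹-cong = cong _⁻¹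
    }

  points : Plane × Point → Fin 7 → Fin v
  points (k , h) i = to (h + pt k i)

  points-injective : ∀ kh → Injective _≡_ _≡_ (points kh)
  points-injective (k , h) eq = pt-injective k (∙-cancelˡ h _ _ (to-injective eq))

  enum : (Plane × Point) ↔ Fin (size ℕ.* v)
  enum = ↔-sym *↔× ↔-∘ (enumPlane ×-↔ enumPoint)
  module E = Inverse enum

  F : Fin (size ℕ.* v) → ColoredFano v
  F n = coloredFano (points (E.from n)) (points-injective (E.from n))

  x≢y⇒x-y≢0 : ∀ {x y} → x ≢ y → x + - y ≢ 0#
  x≢y⇒x-y≢0 x≢y eq = x≢y (x∙y⁻¹≈ε⇒x≈y _ _ eq)

  isFK : IsFK F
  isFK x y x≢y c with represent c (from x + - from y) (x≢y⇒x-y≢0 (x≢y ∘ from-injective))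
  ... | k , s , t , eq = E.to (k , h) , (x∈ , y∈) , unique
    where
    g = from x + - from y
    h = from x + - pt k (onLine c s)
    g+y≡x : g + from y ≡ from x
    g+y≡x = //-rightDividesˡ (from y) (from x)
    hs : h + pt k (onLine c s) ≡ from x
    hs = //-rightDividesˡ _ (from x)
    swap : ∀ a u v → a + (u + v) ≡ u + (a + v)
    swap a u v = trans (sym (assoc a u v)) (trans (cong (_+ v) (comm a u)) (assoc u a v))
    ht : h + pt k (onLine c t) ≡ from y
    ht = ∙-cancelˡ g _ _ (trans (swap g h _) (trans (cong (h +_) (sym eq)) (trans hs (sym g+y≡x))))
    mem : ∀ r z → h + pt k (onLine c r) ≡ from z → z ∈ line (F (E.to (k , h))) c
    mem r z e = subst (λ kh → z ∈ image (points kh ∘ onLine c)) (sym (E.strictlyInverseʳ (k , h)))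
      (subst (_∈ image (points (k , h) ∘ onLine c)) (trans (cong to e) (strictlyInverseˡ z))
        (∈-image⁺ (points (k , h) ∘ onLine c) r))
    x∈ = mem s x hs
    y∈ = mem t y ht
    unique-plane : ∀ kh → x ∈ image (points kh ∘ onLine c) → y ∈ image (points kh ∘ onLine c) → kh ≡ (k , h)
    unique-plane (k′ , h′) x∈′ y∈′ with ∈-image⁻ (points (k′ , h′) ∘ onLine c) x∈′ | ∈-image⁻ (points (k′ , h′) ∘ onLine c) y∈′
    ... | s′ , eqx | t′ , eqy = eq-kh
      where
      xs : h′ + pt k′ (onLine c s′) ≡ from x
      xs = trans (sym (strictlyInverseʳ _)) (cong from eqx)
      yt : h′ + pt k′ (onLine c t′) ≡ from y
      yt = trans (sym (strictlyInverseʳ _)) (cong from eqy)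
      eq′ : pt k′ (onLine c s′) ≡ g + pt k′ (onLine c t′)
      eq′ = ∙-cancelˡ h′ _ _ (trans xs (trans (sym g+y≡x) (trans (cong (g +_) (sym yt)) (swap g h′ _))))
      same = represent-unique c (x≢y⇒x-y≢0 (x≢y ∘ from-injective)) eq eq′
      eq-kh : (k′ , h′) ≡ (k , h)
      eq-kh with same
      ... | refl , refl , refl = cong (k ,_) (∙-cancelʳ _ _ _ (trans xs (sym hs)))
    unique : ∀ n → x ∈ line (F n) c → y ∈ line (F n) c → n ≡ E.to (k , h)
    unique n x∈n y∈n = trans (sym (E.strictlyInverseˡ n)) (cong E.to (unique-plane (E.from n) x∈n y∈n))

  -- Equal planes share a pair of points on a line of the same color, and `isFK` gives such a pair
  -- only one index.
  F-injective : Injective _≡_ _≡_ F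
  F-injective {m} {n} eq = trans (unique m x∈m y∈m) (sym (unique n x∈n y∈n))
    where
    p = points (E.from m)
    c₀ = zero
    x = p (onLine c₀ zero)
    y = p (onLine c₀ (suc zero))
    x≢y : x ≢ y
    x≢y e with points-injective (E.from m) e
    ... | ()
    x∈m = ∈-image⁺ (p ∘ onLine c₀) zero
    y∈m = ∈-image⁺ (p ∘ onLine c₀) (suc zero)
    x∈n = subst (λ P → x ∈ line P c₀) eq x∈m
    y∈n = subst (λ P → y ∈ line P c₀) eq y∈m
    unique = proj₂ (proj₂ (isFK x y x≢y c₀))

  invariant : ∀ n g → Σ (Fin (size ℕ.* v)) λ n′ → ∀ i → line (F n′) i ≡ translate _∙_ _⁻¹ g (line (F n) i)
  invariant n g = E.to (k , from g + h) , eq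
    where
    k = proj₁ (E.from n)
    h = proj₂ (E.from n)
    module G = IsGroup isGroup′
    translated : ∀ j → points (k , from g + h) j ≡ g ∙ points (k , h) j
    translated j = cong to (trans (assoc (from g) h _) (cong (from g +_) (sym (strictlyInverseʳ _))))
    cancelˡ : ∀ x → (g ⁻¹) ∙ (g ∙ x) ≡ x
    cancelˡ x = trans (sym (G.assoc (g ⁻¹) g x)) (trans (cong (_∙ x) (G.inverseˡ g)) (G.identityˡ x))
    cancelʳ : ∀ x → g ∙ ((g ⁻¹) ∙ x) ≡ x
    cancelʳ x = trans (sym (G.assoc g (g ⁻¹) x)) (trans (cong (_∙ x) (G.inverseʳ g)) (G.identityˡ x))
    image-cong : ∀ {m} {f f′ : Fin m → Fin v} → (∀ j → f j ≡ f′ j) → image f ≡ image f′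
    image-cong {zero}  eqs = refl
    image-cong {suc m} eqs = cong₂ (λ a → ⁅ a ⁆ ∪_) (eqs zero) (image-cong (eqs ∘ suc))
    eq : ∀ i → line (F (E.to (k , from g + h))) i ≡ translate _∙_ _⁻¹ g (image (points (k , h) ∘ onLine i))
    eq i = trans (cong (λ kh → image (points kh ∘ onLine i)) (E.strictlyInverseʳ (k , from g + h)))
      (trans (image-cong (translated ∘ onLine i)) (sym (translate-image _∙_ _⁻¹ g cancelˡ cancelʳ (points (k , h) ∘ onLine i))))

-- The trivial base family and products

trivialBaseFamily : BaseFamily 1
trivialBaseFamily = record
  { Point            = ⊤
  ; enumPoint        = ↔-sym 1↔⊤
  ; _+_              = λ _ _ → tt
  ; 0#               = tt
  ; -_               = λ _ → tt
  ; isAbelianGroup   = record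
    { isGroup = record
      { isMonoid = record
        { isSemigroup = record
          { isMagma = record { isEquivalence = isEquivalence ; ∙-cong = λ _ _ → refl }
          ; assoc = λ _ _ _ → refl }
        ; identity = (λ _ → refl) , (λ _ → refl) }
      ; inverse = (λ _ → refl) , (λ _ → refl)
      ; ⁻¹-cong = λ _ → refl }
    ; comm = λ _ _ → refl }
  ; Plane            = Empty.⊥
  ; size             = 0
  ; enumPlane        = ↔-sym 0↔⊥
  ; pt               = λ ()
  ; pt-injective     = λ ()
  ; represent        = λ _ _ g≢0 → contradiction refl g≢0
  ; represent-unique = λ _ g≢0 → contradiction refl g≢0
  ; row              = λ _ _ → tt
  ; row-solve        = λ _ _ → tt , refl
  ; row-unique       = λ _ _ _ → refl
  }

-- The planes {(b_i , m_i(t))} represent the pairs whose first component is nonzero, the planes {(0 , c_i)} the other ones.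
productBaseFamily : ∀ {v w} → BaseFamily v → BaseFamily w → BaseFamily (v ℕ.* w)
productBaseFamily {v} {w} B C = record
  { Point            = B.Point × C.Point
  ; enumPoint        = ↔-sym *↔× ↔-∘ (B.enumPoint ×-↔ C.enumPoint)
  ; _+_              = G._∙_
  ; 0#               = G.ε
  ; -_               = G._⁻¹
  ; isAbelianGroup   = isAbelianGroup′
  ; Plane            = Plane′
  ; size             = B.size ℕ.* w ℕ.+ C.size
  ; enumPlane        = ↔-sym +↔⊎ ↔-∘ ((↔-sym *↔× ↔-∘ (B.enumPlane ×-↔ C.enumPoint)) ⊎-↔ C.enumPlane)
  ; pt               = pt′
  ; pt-injective     = pt′-injective
  ; represent        = represent′
  ; represent-unique = represent′-unique
  ; row              = λ { i (t , u) → B.row i t , C.row i u }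
  ; row-solve        = λ { i≢j (g , h) → let t , eq = B.row-solve i≢j g ; u , eq′ = C.row-solve i≢j h
                                          in (t , u) , cong₂ _,_ eq eq′ }
  ; row-unique       = λ i≢j eq eq′ → cong₂ _,_
                         (B.row-unique i≢j (,-injectiveˡ eq) (,-injectiveˡ eq′))
                         (C.row-unique i≢j (,-injectiveʳ eq) (,-injectiveʳ eq′))
  }
  where
  module B = BaseFamily B
  module C = BaseFamily C
  module G = AbelianGroup (productGroup B.abelianGroup C.abelianGroup)
  module BP = GroupProperties (AbelianGroup.group B.abelianGroup)
  module CP = GroupProperties (AbelianGroup.group C.abelianGroup)
  module BG = AbelianGroup B.abelianGroup
  module CG = AbelianGroup C.abelianGroup

  isAbelianGroup′ : IsAbelianGroup _≡_ G._∙_ G.ε G._⁻¹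
  isAbelianGroup′ = record
    { isGroup = record
      { isMonoid = record
        { isSemigroup = record
          { isMagma = record { isEquivalence = isEquivalence ; ∙-cong = cong₂ G._∙_ }
          ; assoc   = λ x y z → cong₂ _,_ (BG.assoc _ _ _) (CG.assoc _ _ _) }
        ; identity = (λ _ → cong₂ _,_ (BG.identityˡ _) (CG.identityˡ _))
                   , (λ _ → cong₂ _,_ (BG.identityʳ _) (CG.identityʳ _)) }
      ; inverse = (λ _ → cong₂ _,_ (BG.inverseˡ _) (CG.inverseˡ _))
                , (λ _ → cong₂ _,_ (BG.inverseʳ _) (CG.inverseʳ _))
      ; ⁻¹-cong = cong G._⁻¹ }
    ; comm = λ _ _ → cong₂ _,_ (BG.comm _ _) (CG.comm _ _) }

  Plane′ = (B.Plane × C.Point) ⊎ C.Plane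

  pt′ : Plane′ → Fin 7 → B.Point × C.Point
  pt′ (inj₁ (k , t)) i = B.pt k i , C.row i t
  pt′ (inj₂ k)       i = B.0# , C.pt k i

  pt′-injective : ∀ k → Injective _≡_ _≡_ (pt′ k)
  pt′-injective (inj₁ (k , t)) eq = B.pt-injective k (,-injectiveˡ eq)
  pt′-injective (inj₂ k)       eq = C.pt-injective k (,-injectiveʳ eq)

  module enumB = Inverse B.enumPoint

  ≡0? : ∀ g → Dec (g ≡ B.0#)
  ≡0? g with enumB.to g ≟ enumB.to B.0#
  ... | yes eq = yes (trans (sym (enumB.strictlyInverseʳ g)) (trans (cong enumB.from eq) (enumB.strictlyInverseʳ B.0#)))
  ... | no neq = no (neq ∘ cong enumB.to)

  distinct : ∀ {c g k s t} → g ≢ B.0# → B.pt k (onLine c s) ≡ g B.+ B.pt k (onLine c t) → onLine c s ≢ onLine c t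
  distinct {g = g} g≢0 eq s≡t rewrite s≡t = g≢0 (BP.identityˡ-unique g _ (sym eq))

  represent′ : ∀ c g → g ≢ G.ε → ∃ λ k → ∃ λ s → ∃ λ t → pt′ k (onLine c s) ≡ g G.∙ pt′ k (onLine c t)
  represent′ c (g , h) gh≢0 with ≡0? g
  ... | yes refl = let k , s , t , eq = C.represent c h (λ { refl → gh≢0 refl })
                   in inj₂ k , s , t , cong₂ _,_ (sym (BG.identityˡ _)) eq
  ... | no g≢0   = let k , s , t , eq = B.represent c g g≢0
                       u , eq′ = C.row-solve (distinct {c} g≢0 eq) h
                   in inj₁ (k , u) , s , t , cong₂ _,_ eq eq′

  -- Planes of the first kind never represent an element `(0 , h)`: the first components would
  -- coincide, hence also the two labels, and the same row would then force `h` to vanish.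
  nonzero : ∀ c {g h k u s t} → (g , h) ≢ G.ε →
            pt′ (inj₁ (k , u)) (onLine c s) ≡ (g , h) G.∙ pt′ (inj₁ (k , u)) (onLine c t) → g ≢ B.0#
  nonzero c {h = h} {k} {u} {s} {t} gh≢0 eq refl = gh≢0 (cong (B.0# ,_) (CP.identityˡ-unique h _ (sym (trans (cong (λ i → C.row i u) (sym s≡t)) (,-injectiveʳ eq)))))
    where
    s≡t : onLine c s ≡ onLine c t
    s≡t = B.pt-injective k (trans (,-injectiveˡ eq) (BG.identityˡ _))

  zero′ : ∀ {g} → B.0# ≡ g B.+ B.0# → g ≡ B.0#
  zero′ eq = trans (sym (BG.identityʳ _)) (sym eq)

  represent′-unique : ∀ c {g} → g ≢ G.ε → ∀ {k s t k′ s′ t′} →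
    pt′ k  (onLine c s)  ≡ g G.∙ pt′ k  (onLine c t)  →
    pt′ k′ (onLine c s′) ≡ g G.∙ pt′ k′ (onLine c t′) → k′ ≡ k × s′ ≡ s × t′ ≡ t
  represent′-unique c {g , h} gh≢0 {inj₁ (k , u)} {k′ = inj₁ (k′ , u′)} eq eq′
    with B.represent-unique c (nonzero c gh≢0 eq) (,-injectiveˡ eq) (,-injectiveˡ eq′)
  ... | refl , refl , refl
    with C.row-unique (distinct {c} (nonzero c gh≢0 eq) (,-injectiveˡ eq)) (,-injectiveʳ eq) (,-injectiveʳ eq′)
  ... | refl = refl , refl , refl
  represent′-unique c gh≢0 {inj₁ _} {k′ = inj₂ _} eq eq′ =
    contradiction (zero′ (,-injectiveˡ eq′)) (nonzero c gh≢0 eq)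
  represent′-unique c gh≢0 {inj₂ _} {k′ = inj₁ _} eq eq′ =
    contradiction (zero′ (,-injectiveˡ eq)) (nonzero c gh≢0 eq′)
  represent′-unique c {g , h} gh≢0 {inj₂ k} {k′ = inj₂ k′} eq eq′
    with C.represent-unique c (λ { refl → gh≢0 (cong (_, C.0#) (zero′ (,-injectiveˡ eq))) }) (,-injectiveʳ eq) (,-injectiveʳ eq′)
  ... | refl , refl , refl = refl , refl , refl

-- Finite domains

𝟙 : ∀ {p} {P : Set p} → Dec P → ℕ
𝟙 d = if does d then 1 else 0

module ℕSum = Sum ℕ.+-0-commutativeMonoid

record Enumeration {q} (P : Fin q → Set) (k : ℕ) : Set where
  field
    elt          : Fin k → Fin q
    elt-injective : Injective _≡_ _≡_ elt
    sound        : ∀ j → P (elt j)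
    complete     : ∀ i → P i → ∃ λ j → elt j ≡ i

enumerate : ∀ {q} {P : Fin q → Set} (P? : ∀ i → Dec (P i)) → Enumeration P (ℕSum.sum (𝟙 ∘ P?))
enumerate {zero}  P? = record { elt = λ () ; elt-injective = λ { {()} } ; sound = λ () ; complete = λ () }
enumerate {suc q} {P} P? with P? zero | enumerate (P? ∘ suc)
... | no ¬p | E = record
  { elt = suc ∘ elt
  ; elt-injective = elt-injective ∘ suc-injective
  ; sound = sound
  ; complete = λ { zero p → contradiction p ¬p
                 ; (suc i) p → let j , eq = complete i p in j , cong suc eq } }
  where open Enumeration E
... | yes p | E = record
  { elt = elt′
  ; elt-injective = injective _ _
  ; sound = λ { zero → p ; (suc j) → sound j }
  ; complete = λ { zero _ → zero , refl
                 ; (suc i) p → let j , eq = complete i p in suc j , cong suc eq } }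
  where
  open Enumeration E
  elt′ : Fin (suc _) → Fin (suc q)
  elt′ zero    = zero
  elt′ (suc j) = suc (elt j)
  injective : ∀ i j → elt′ i ≡ elt′ j → i ≡ j
  injective zero    zero    eq = refl
  injective zero    (suc j) ()
  injective (suc i) zero    ()
  injective (suc i) (suc j) eq = cong suc (elt-injective (suc-injective eq))

-- A finite integral domain is a field. Absence of zero divisors is what the constructions of the
-- fields verify; `inverse` recovers the inverses.
record FiniteDomain (q : ℕ) : Set₁ where
  infixl 7 _*_
  infixl 6 _+_
  field
    Carrier           : Set
    enum              : Carrier ↔ Fin q
    _+_ _*_           : Op₂ Carrier
    -_                : Op₁ Carrier
    0# 1#             : Carrier
    isCommutativeRing : IsCommutativeRing _≡_ _+_ _*_ -_ 0# 1#
    0≢1               : 0# ≢ 1#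
    integral          : ∀ x y → x * y ≡ 0# → x ≡ 0# ⊎ y ≡ 0#

  commutativeRing : CommutativeRing 0ℓ 0ℓ
  commutativeRing = record { isCommutativeRing = isCommutativeRing }

module DomainProperties {q m : ℕ} (D : FiniteDomain q) (q≡1+m : q ≡ suc m) where
  open FiniteDomain D public using (Carrier; 0#; 1#; 0≢1; integral; enum; commutativeRing)
  open CommutativeRing commutativeRing public using (_+_; _*_; -_; _-_; +-assoc; +-comm; +-identityˡ; +-identityʳ; -‿inverseˡ; -‿inverseʳ; *-assoc; *-comm; *-identityˡ; *-identityʳ; zeroˡ; zeroʳ; distribˡ; distribʳ; *-commutativeMonoid; +-commutativeMonoid; +-monoid)
  open CommutativeRing commutativeRing using (commutativeSemiring; +-group; ring)
  open GroupProperties +-group public using (x∙y⁻¹≈ε⇒x≈y) renaming (∙-cancelˡ to +-cancelˡ; ∙-cancelʳ to +-cancelʳ; ⁻¹-involutive to -‿involutive; //-rightDividesˡ to x-y+y≡x; ⁻¹-anti-homo-// to -[x-y]≡y-x; ε⁻¹≈ε to -0≡0)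
  open RingProperties ring public using (-‿distribˡ-*; -‿distribʳ-*; x[y-z]≈xy-xz; [y-z]x≈yx-zx)
  open Exp commutativeSemiring public using (_^_; ^-homo-*; ^-assocʳ; ^-distrib-*)
  open Inverse enum public using (to; from) renaming (strictlyInverseˡ to to∘from; strictlyInverseʳ to from∘to)

  infix 4 _≟ᶜ_
  _≟ᶜ_ : DecidableEquality Carrier
  x ≟ᶜ y = map′ (λ eq → trans (sym (from∘to x)) (trans (cong from eq) (from∘to y))) (cong to) (to x ≟ to y)

  from-injective : Injective _≡_ _≡_ from
  from-injective {x} {y} eq = trans (sym (to∘from x)) (trans (cong to eq) (to∘from y))

  x-x≡0 : ∀ x → x - x ≡ 0#
  x-x≡0 = -‿inverseʳ

  x≢y⇒x-y≢0 : ∀ {x y} → x ≢ y → x - y ≢ 0#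
  x≢y⇒x-y≢0 x≢y eq = x≢y (x∙y⁻¹≈ε⇒x≈y _ _ eq)

  *-nonzero : ∀ {x y} → x ≢ 0# → y ≢ 0# → x * y ≢ 0#
  *-nonzero x≢0 y≢0 eq = [ x≢0 , y≢0 ]′ (integral _ _ eq)

  *-cancelˡ : ∀ {x y z} → x ≢ 0# → x * y ≡ x * z → y ≡ z
  *-cancelˡ {x} {y} {z} x≢0 eq with integral x (y - z) (trans (x[y-z]≈xy-xz x y z) (trans (cong (_- x * z) eq) (x-x≡0 _)))
  ... | inj₁ x≡0 = contradiction x≡0 x≢0
  ... | inj₂ y-z≡0 = x∙y⁻¹≈ε⇒x≈y _ _ y-z≡0

  *-cancelʳ : ∀ {x y z} → x ≢ 0# → y * x ≡ z * x → y ≡ z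
  *-cancelʳ x≢0 eq = *-cancelˡ x≢0 (trans (*-comm _ _) (trans eq (*-comm _ _)))

  ^-nonzero : ∀ {x} k → x ≢ 0# → x ^ k ≢ 0#
  ^-nonzero zero    x≢0 eq = 0≢1 (sym eq)
  ^-nonzero (suc k) x≢0    = *-nonzero x≢0 (^-nonzero k x≢0)

  1^k≡1 : ∀ k → 1# ^ k ≡ 1#
  1^k≡1 zero    = refl
  1^k≡1 (suc k) = trans (*-identityˡ _) (1^k≡1 k)

  -- Two of the `q + 1` powers `x^0, ..., x^q` coincide; cancelling the lower one leaves a positive
  -- power of x equal to 1.
  inverse : ∀ {x} → x ≢ 0# → ∃ λ y → x * y ≡ 1#
  inverse {x} x≢0 with pigeonhole (ℕ.n<1+n q) (λ i → to (x ^ toℕ i))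
  ... | i , j , i<j , eq = x ^ k , sym (*-cancelˡ (^-nonzero (toℕ i) x≢0) (begin
    x ^ toℕ i * 1#            ≡⟨ *-identityʳ _ ⟩
    x ^ toℕ i                 ≡⟨ trans (sym (from∘to _)) (trans (cong from eq) (from∘to _)) ⟩
    x ^ toℕ j                 ≡⟨ cong (x ^_) (ℕ.m+[n∸m]≡n i<j) ⟨
    x ^ (suc (toℕ i) ℕ.+ k)   ≡⟨ cong (x ^_) (ℕ.+-suc (toℕ i) k) ⟨
    x ^ (toℕ i ℕ.+ suc k)     ≡⟨ ^-homo-* x (toℕ i) (suc k) ⟩
    x ^ toℕ i * x ^ suc k     ∎))
    where
    open ≡-Reasoning
    k = toℕ j ℕ.∸ suc (toℕ i)

  *-inverse-cancel : ∀ {x} (x≢0 : x ≢ 0#) y → x * (proj₁ (inverse x≢0) * y) ≡ y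
  *-inverse-cancel x≢0 y = trans (sym (*-assoc _ _ y)) (trans (cong (_* y) (proj₂ (inverse x≢0))) (*-identityˡ y))

  inverse-*-cancel : ∀ {x} (x≢0 : x ≢ 0#) y → proj₁ (inverse x≢0) * (x * y) ≡ y
  inverse-*-cancel x≢0 y = trans (sym (*-assoc _ _ y))
    (trans (cong (_* y) (trans (*-comm _ _) (proj₂ (inverse x≢0)))) (*-identityˡ y))

  module _ (M : CommutativeMonoid 0ℓ 0ℓ) where
    private module M = CommutativeMonoid M
    sumOver : (Carrier → M.Carrier) → M.Carrier
    sumOver f = Sum.sum M (f ∘ from)

    sumOver-reindex : (f : Carrier → M.Carrier) (φ ψ : Carrier → Carrier) →
                      (∀ x → φ (ψ x) ≡ x) → (∀ x → ψ (φ x) ≡ x) → sumOver f M.≈ sumOver (f ∘ φ)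
    sumOver-reindex f φ ψ φψ ψφ = M.trans (Sum.sum-permute M (f ∘ from) π)
      (M.reflexive (Sum.sum-cong-≗ M (λ i → cong f (from∘to (φ (from i))))))
      where
      π : Permutation′ q
      π = permutation (to ∘ φ ∘ from) (to ∘ ψ ∘ from)
            (λ i → trans (cong (to ∘ φ) (from∘to _)) (trans (cong to (φψ _)) (to∘from i)))
            (λ i → trans (cong (to ∘ ψ) (from∘to _)) (trans (cong to (ψφ _)) (to∘from i)))

  product-nonzero : ∀ {m} (f : Fin m → Carrier) → (∀ i → f i ≢ 0#) → Sum.sum *-commutativeMonoid f ≢ 0#
  product-nonzero {zero}  f f≢0 eq = 0≢1 (sym eq)
  product-nonzero {suc m} f f≢0    = *-nonzero (f≢0 zero) (product-nonzero (f ∘ suc) (f≢0 ∘ suc))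

  ifZero : Carrier → Carrier → Carrier → Carrier
  ifZero a b y with y ≟ᶜ 0#
  ... | yes _ = a
  ... | no  _ = b

  ifZero-0 : ∀ {a b y} → y ≡ 0# → ifZero a b y ≡ a
  ifZero-0 {y = y} y≡0 with y ≟ᶜ 0#
  ... | yes _   = refl
  ... | no  y≢0 = contradiction y≡0 y≢0

  ifZero-≢0 : ∀ {a b y} → y ≢ 0# → ifZero a b y ≡ b
  ifZero-≢0 {y = y} y≢0 with y ≟ᶜ 0#
  ... | yes y≡0 = contradiction y≡0 y≢0
  ... | no  _   = refl

  product-ifZero : ∀ {m} x → q ≡ suc m → sumOver *-commutativeMonoid (ifZero 1# x) ≡ x ^ m
  product-ifZero {m} x refl = begin
    sumOver *-commutativeMonoid (ifZero 1# x)
      ≡⟨ Sum.sum-remove *-commutativeMonoid {i = to 0#} (ifZero 1# x ∘ from) ⟩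
    ifZero 1# x (from (to 0#)) * Sum.sum *-commutativeMonoid (ifZero 1# x ∘ from ∘ punchIn (to 0#))
      ≡⟨ cong₂ _*_ (ifZero-0 (from∘to 0#)) (Sum.sum-cong-≗ *-commutativeMonoid λ i → ifZero-≢0 (λ eq → punchInᵢ≢i (to 0#) i (from-injective (trans eq (sym (from∘to 0#)))))) ⟩
    1# * Sum.sum *-commutativeMonoid {m} (λ _ → x)
      ≡⟨ *-identityˡ _ ⟩
    Sum.sum *-commutativeMonoid {m} (λ _ → x)
      ≡⟨ Sum.sum-replicate *-commutativeMonoid m ⟩
    x ^ m ∎
    where open ≡-Reasoning

  -- Multiplication by x permutes the factors of the product of all nonzero elements. The function
  -- `g` replaces the factor 0 by 1, so that the product runs over the whole carrier and can be
  -- reindexed there.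
  fermat : ∀ {x} → x ≢ 0# → x ^ m ≡ 1#
  fermat {x} x≢0 = *-cancelʳ (product-nonzero (g ∘ from) λ i → g≢0 (from i)) (begin
    x ^ m * Π g                    ≡⟨ cong (_* Π g) (product-ifZero x q≡1+m) ⟨
    Π (ifZero 1# x) * Π g          ≡⟨ Sum.∑-distrib-+ *-commutativeMonoid (ifZero 1# x ∘ from) (g ∘ from) ⟨
    Π (λ y → ifZero 1# x y * g y)  ≡⟨ Sum.sum-cong-≗ *-commutativeMonoid (λ i → g-mul (from i)) ⟨
    Π (λ y → g (x * y))            ≡⟨ sumOver-reindex *-commutativeMonoid g (x *_) (proj₁ (inverse x≢0) *_) (*-inverse-cancel x≢0) (inverse-*-cancel x≢0) ⟨
    Π g                            ≡⟨ *-identityˡ _ ⟨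
    1# * Π g                       ∎)
    where
    open ≡-Reasoning
    Π = sumOver *-commutativeMonoid
    g : Carrier → Carrier
    g y = ifZero 1# y y
    g≢0 : ∀ y → g y ≢ 0#
    g≢0 y with y ≟ᶜ 0#
    ... | yes _   = 0≢1 ∘ sym
    ... | no  y≢0 = y≢0
    g-mul : ∀ y → g (x * y) ≡ ifZero 1# x y * g y
    g-mul y with y ≟ᶜ 0#
    ... | yes y≡0 = trans (ifZero-0 (trans (cong (x *_) y≡0) (zeroʳ x))) (sym (*-identityˡ 1#))
    ... | no  y≢0 = ifZero-≢0 (*-nonzero x≢0 y≢0)

  -- The translation by 1 leaves the sum of all elements unchanged, so `q · 1` vanishes. As q is
  -- odd, `1 + 1 ≡ 0` would turn `q · 1` into 1.
  1+1≢0 : ∀ k → m ≡ k ℕ.* 2 → 1# + 1# ≢ 0#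
  1+1≢0 k m≡2k 2≡0 = 0≢1 (begin
    0#                           ≡⟨ +-cancelˡ _ _ _ (trans (+-identityʳ _) total) ⟩
    q · 1#                       ≡⟨ cong (_· 1#) q≡1+m ⟩
    1# + m · 1#                  ≡⟨ cong (λ j → 1# + j · 1#) m≡2k ⟩
    1# + (k ℕ.* 2) · 1#          ≡⟨ cong (1# +_) (×-assocˡ 1# k 2) ⟨
    1# + k · (2 · 1#)            ≡⟨ cong (λ z → 1# + k · z) (trans (cong (1# +_) (+-identityʳ 1#)) 2≡0) ⟩
    1# + k · 0#                  ≡⟨ cong (1# +_) (×-zero k) ⟩
    1# + 0#                      ≡⟨ +-identityʳ 1# ⟩
    1#                           ∎)
    where
    open ≡-Reasoning
    open Mult +-monoid using (×-assocˡ) renaming (_×_ to _·_)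
    Σ′ = sumOver +-commutativeMonoid
    ×-zero : ∀ m → m · 0# ≡ 0#
    ×-zero zero    = refl
    ×-zero (suc m) = trans (+-identityˡ _) (×-zero m)
    total : Σ′ (λ x → x) ≡ Σ′ (λ x → x) + q · 1#
    total = begin
      Σ′ (λ x → x)                 ≡⟨ sumOver-reindex +-commutativeMonoid (λ x → x) (_+ 1#) (_- 1#)
                                        (λ x → x-y+y≡x 1# x)
                                        (λ x → trans (+-assoc x 1# (- 1#)) (trans (cong (x +_) (x-x≡0 1#)) (+-identityʳ x))) ⟩
      Σ′ (_+ 1#)                   ≡⟨ Sum.∑-distrib-+ +-commutativeMonoid from (λ _ → 1#) ⟩
      Σ′ (λ x → x) + Σ′ (λ _ → 1#) ≡⟨ cong (Σ′ (λ x → x) +_) (Sum.sum-replicate +-commutativeMonoid q) ⟩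
      Σ′ (λ x → x) + q · 1#        ∎

  2≢0⇒x≢-x : 1# + 1# ≢ 0# → ∀ {x} → x ≢ 0# → x ≢ - x
  2≢0⇒x≢-x 2≢0 {x} x≢0 eq = *-nonzero 2≢0 x≢0 (begin
    (1# + 1#) * x    ≡⟨ distribʳ x 1# 1# ⟩
    1# * x + 1# * x  ≡⟨ cong₂ _+_ (*-identityˡ x) (*-identityˡ x) ⟩
    x + x            ≡⟨ cong (x +_) eq ⟩
    x - x            ≡⟨ x-x≡0 x ⟩
    0#               ∎)
    where open ≡-Reasoning

  -- Only the coefficients below the leading one are listed, the constant term first.
  evalMonic : ∀ {m} → Vec Carrier m → Carrier → Carrier
  evalMonic []      x = 1#
  evalMonic (a ∷ p) x = a + x * evalMonic p x

  -- Synthetic division by `X - r`: the coefficients are the intermediate values of Horner's scheme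
  -- at r.
  quotient : ∀ {m} → Vec Carrier (suc m) → Carrier → Vec Carrier m
  quotient (a ∷ [])        r = []
  quotient (a ∷ p@(_ ∷ _)) r = evalMonic p r ∷ quotient p r

  evalMonic-quotient : ∀ {m} (p : Vec Carrier (suc m)) r x →
                       evalMonic p x ≡ evalMonic p r + (x - r) * evalMonic (quotient p r) x
  evalMonic-quotient (a ∷ []) r x = begin
    a + x * 1#                       ≡⟨ cong (λ z → a + z * 1#) (trans (sym (x-y+y≡x r x)) (+-comm _ r)) ⟩
    a + (r + (x - r)) * 1#           ≡⟨ cong (a +_) (distribʳ 1# r (x - r)) ⟩
    a + (r * 1# + (x - r) * 1#)      ≡⟨ +-assoc a _ _ ⟨
    a + r * 1# + (x - r) * 1#        ∎
    where open ≡-Reasoning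
  evalMonic-quotient (a ∷ p@(_ ∷ _)) r x = begin
    a + x * evalMonic p x              ≡⟨ cong (λ z → a + x * z) (evalMonic-quotient p r x) ⟩
    a + x * (pr + (x - r) * Q)         ≡⟨ cong (a +_) (distribˡ x pr _) ⟩
    a + (x * pr + x * ((x - r) * Q))   ≡⟨ cong (λ z → a + (z + x * ((x - r) * Q))) x*pr ⟩
    a + ((r * pr + (x - r) * pr) + x * ((x - r) * Q))
      ≡⟨ cong (λ z → a + ((r * pr + (x - r) * pr) + z)) (trans (sym (*-assoc x _ _)) (trans (cong (_* Q) (*-comm x _)) (*-assoc _ x Q))) ⟩
    a + ((r * pr + (x - r) * pr) + (x - r) * (x * Q))
      ≡⟨ cong (a +_) (trans (+-assoc _ _ _) (cong (r * pr +_) (sym (distribˡ (x - r) pr (x * Q))))) ⟩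
    a + (r * pr + (x - r) * (pr + x * Q)) ≡⟨ +-assoc a _ _ ⟨
    a + r * pr + (x - r) * (pr + x * Q) ∎
    where
    open ≡-Reasoning
    pr = evalMonic p r
    Q  = evalMonic (quotient p r) x
    x*pr : x * pr ≡ r * pr + (x - r) * pr
    x*pr = trans (cong (_* pr) (trans (sym (x-y+y≡x r x)) (+-comm _ r))) (distribʳ pr r (x - r))

  root-bound : ∀ {m k} (p : Vec Carrier m) (f : Fin k → Carrier) → Injective _≡_ _≡_ f →
               (∀ i → evalMonic p (f i) ≡ 0#) → k ℕ.≤ m
  root-bound {k = zero}  p f inj root = z≤n
  root-bound {zero}  {suc k} [] f inj root = contradiction (sym (root zero)) 0≢1
  root-bound {suc m} {suc k} p  f inj root = s≤s (root-bound (quotient p r) (f ∘ suc) (suc-injective ∘ inj) root′)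
    where
    r = f zero
    root′ : ∀ i → evalMonic (quotient p r) (f (suc i)) ≡ 0#
    root′ i with integral (f (suc i) - r) (evalMonic (quotient p r) (f (suc i)))
                   (trans (sym (+-identityˡ _)) (trans (cong (_+ (f (suc i) - r) * evalMonic (quotient p r) (f (suc i))) (sym (root zero)))
                     (trans (sym (evalMonic-quotient p r (f (suc i)))) (root (suc i)))))
    ... | inj₂ eq = eq
    ... | inj₁ eq with inj (x∙y⁻¹≈ε⇒x≈y _ _ eq)
    ... | ()

  power-bound : ∀ {m k} a (f : Fin k → Carrier) → Injective _≡_ _≡_ f → (∀ i → f i ^ suc m ≡ a) → k ℕ.≤ suc m
  power-bound {m} a f inj eq = root-bound (- a ∷ Vec.replicate m 0#) f inj λ i →
    trans (cong (λ z → - a + f i * z) (monomial m (f i))) (trans (cong (- a +_) (eq i)) (-‿inverseˡ a))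
    where
    monomial : ∀ m x → evalMonic (Vec.replicate m 0#) x ≡ x ^ m
    monomial zero    x = refl
    monomial (suc m) x = trans (+-identityˡ _) (cong (x *_) (monomial m x))

-- Rainbow planes

next : Fin 3 → Fin 3
next 0F = 1F
next 1F = 2F
next 2F = 0F

next≢ : ∀ r → next r ≢ r
next≢ 0F ()
next≢ 1F ()
next≢ 2F ()

next² : Fin 3 → Fin 3
next² r = next (next r)

module RainbowPlanes {q n : ℕ} (D : FiniteDomain q) (q≡1+6n : q ≡ suc (6 ℕ.* n)) where
  open DomainProperties {q} {6 ℕ.* n} D q≡1+6n public

  x≢-x : ∀ {x} → x ≢ 0# → x ≢ - x
  x≢-x = 2≢0⇒x≢-x (1+1≢0 (3 ℕ.* n) (6n≡3n*2 n))
    where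
    6n≡3n*2 : ∀ n → 6 ℕ.* n ≡ (3 ℕ.* n) ℕ.* 2
    6n≡3n*2 = solve-∀

  e : ℕ
  e = 2 ℕ.* n

  n≢0 : n ≢ 0
  n≢0 refl = 0≢1 (trans (sym (from∘to 0#)) (trans (cong from (one (to 0#) (to 1#))) (from∘to 1#)))
    where
    one : ∀ (i j : Fin q) → i ≡ j
    one rewrite q≡1+6n = λ { zero zero → refl }

  e≡suc : ∃ λ m → e ≡ suc m
  e≡suc = positive n n≢0
    where
    positive : ∀ m → m ≢ 0 → ∃ λ k → 2 ℕ.* m ≡ suc k
    positive zero    m≢0 = contradiction refl m≢0
    positive (suc m) _   = _ , refl

  square-neg : ∀ x → - x * - x ≡ x * x
  square-neg x = trans (sym (-‿distribˡ-* x (- x))) (trans (cong -_ (sym (-‿distribʳ-* x x))) (-‿involutive _))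

  -- As `e` is even, -1 is in the class of 1. The class of a difference thus belongs to the
  -- unordered pair of points.
  neg-^e : ∀ x → (- x) ^ e ≡ x ^ e
  neg-^e x = trans (sym (^-assocʳ (- x) 2 n)) (trans (cong (_^ n) (begin
    - x * (- x * 1#)  ≡⟨ cong (- x *_) (*-identityʳ (- x)) ⟩
    - x * - x         ≡⟨ square-neg x ⟩
    x * x             ≡⟨ cong (x *_) (*-identityʳ x) ⟨
    x * (x * 1#)      ∎)) (^-assocʳ x 2 n))
    where open ≡-Reasoning

  minus-^e : ∀ x y → (x - y) ^ e ≡ (y - x) ^ e
  minus-^e x y = trans (sym (neg-^e (x - y))) (cong (_^ e) (-[x-y]≡y-x x y))

  0^e≡0 : 0# ^ e ≡ 0#
  0^e≡0 with e≡suc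
  ... | m , eq rewrite eq = zeroˡ _

  cube-^e : ∀ {x} → x ≢ 0# → (x ^ e) ^ 3 ≡ 1#
  cube-^e {x} x≢0 = trans (^-assocʳ x e 3) (trans (cong (x ^_) (2n*3≡6n n)) (fermat x≢0))
    where
    2n*3≡6n : ∀ n → 2 ℕ.* n ℕ.* 3 ≡ 6 ℕ.* n
    2n*3≡6n = solve-∀

  -- A value missed by `E` would be a fourth root of `X³ - 1`.
  cubeRoot : (E : Fin 3 → Carrier) → Injective _≡_ _≡_ E → (∀ r → E r ^ 3 ≡ 1#) →
             ∀ {y} → y ^ 3 ≡ 1# → ∃ λ r → E r ≡ y
  cubeRoot E E-inj E³ {y} y³ with any? (λ r → E r ≟ᶜ y)
  ... | yes found = found
  ... | no ¬found = contradiction (power-bound {2} 1# f (f-inj _ _) f³) λ { (s≤s (s≤s (s≤s ()))) }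
    where
    f : Fin 4 → Carrier
    f zero    = y
    f (suc r) = E r
    f-inj : ∀ i j → f i ≡ f j → i ≡ j
    f-inj zero    zero    eq = refl
    f-inj zero    (suc j) eq = contradiction (j , sym eq) ¬found
    f-inj (suc i) zero    eq = contradiction (i , eq) ¬found
    f-inj (suc i) (suc j) eq = cong suc (E-inj eq)
    f³ : ∀ i → f i ^ 3 ≡ 1#
    f³ zero    = y³
    f³ (suc r) = E³ r

  -- A side of a triangle is indexed by its opposite vertex and its class is read off as the e-th
  -- power, a cube root of unity. Being rainbow is then injectivity on `Fin 3`, with no chosen names
  -- for the classes.
  opposite : (Fin 3 → Carrier) → Fin 3 → Carrier
  opposite x r = (x (next r) - x (next² r)) ^ e

  IsRainbow : (Fin 7 → Carrier) → Set
  IsRainbow b = ∀ c → Injective _≡_ _≡_ (opposite (b ∘ onLine c))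

  IsTriangle : Carrier → Carrier → Carrier → Set
  IsTriangle x y z = (y - z) ^ e ≢ (z - x) ^ e × (z - x) ^ e ≢ (x - y) ^ e × (x - y) ^ e ≢ (y - z) ^ e

  triangles⇒rainbow : ∀ b → (∀ c → IsTriangle (b (onLine c 0F)) (b (onLine c 1F)) (b (onLine c 2F))) → IsRainbow b
  triangles⇒rainbow b triangles c = injective {b ∘ onLine c} (triangles c) _ _
    where
    injective : ∀ {x} → IsTriangle (x 0F) (x 1F) (x 2F) → ∀ r s → opposite x r ≡ opposite x s → r ≡ s
    injective (p , q , r) 0F 1F eq = contradiction eq p
    injective (p , q , r) 1F 0F eq = contradiction (sym eq) p
    injective (p , q , r) 1F 2F eq = contradiction eq q
    injective (p , q , r) 2F 1F eq = contradiction (sym eq) q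
    injective (p , q , r) 2F 0F eq = contradiction eq r
    injective (p , q , r) 0F 2F eq = contradiction (sym eq) r
    injective _           0F 0F _  = refl
    injective _           1F 1F _  = refl
    injective _           2F 2F _  = refl

  private
    third : Fin 3 → Fin 3 → Fin 3
    third 0F 1F = 2F
    third 1F 0F = 2F
    third 0F 2F = 1F
    third 2F 0F = 1F
    third 1F 2F = 0F
    third 2F 1F = 0F
    third 0F 0F = 0F
    third 1F 1F = 0F
    third 2F 2F = 0F

    third-pair : ∀ s t s′ t′ → s ≢ t → s′ ≢ t′ → third s′ t′ ≡ third s t → (s′ ≡ s × t′ ≡ t) ⊎ (s′ ≡ t × t′ ≡ s)
    third-pair = from-yes (all? λ s → all? λ t → all? λ s′ → all? λ t′ →
      ¬? (s ≟ t) →-dec (¬? (s′ ≟ t′) →-dec ((third s′ t′ ≟ third s t) →-dec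
        (((s′ ≟ s) ×-dec (t′ ≟ t)) ⊎-dec ((s′ ≟ t) ×-dec (t′ ≟ s))))))

    opposite-third : ∀ x s t → s ≢ t → (x s - x t) ^ e ≡ opposite x (third s t)
    opposite-third x 0F 1F _ = refl
    opposite-third x 1F 2F _ = refl
    opposite-third x 2F 0F _ = refl
    opposite-third x 1F 0F _ = minus-^e _ _
    opposite-third x 2F 1F _ = minus-^e _ _
    opposite-third x 0F 2F _ = minus-^e _ _
    opposite-third x 0F 0F s≢t = contradiction refl s≢t
    opposite-third x 1F 1F s≢t = contradiction refl s≢t
    opposite-third x 2F 2F s≢t = contradiction refl s≢t

    -- If the points at next r and next² r coincide, the two other differences agree up to sign.
    opposite-nonzero : ∀ x → Injective _≡_ _≡_ (opposite x) → ∀ r → x (next r) ≢ x (next² r)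
    opposite-nonzero x inj 0F eq with inj {1F} {2F} (trans (cong (λ z → (z - x 0F) ^ e) (sym eq)) (minus-^e _ _))
    ... | ()
    opposite-nonzero x inj 1F eq with inj {2F} {0F} (trans (cong (λ z → (z - x 1F) ^ e) (sym eq)) (minus-^e _ _))
    ... | ()
    opposite-nonzero x inj 2F eq with inj {0F} {1F} (trans (cong (λ z → (z - x 2F) ^ e) (sym eq)) (minus-^e _ _))
    ... | ()

  private
    -- A transversal of the e-th roots of unity modulo ±1: of u and -u, which differ because the
    -- characteristic is odd, the one enumerated earlier is kept.
    Half : Fin q → Set
    Half i = (from i ^ e ≡ 1#) × (i Fin.< to (- from i))

    half? : ∀ i → Dec (Half i)
    half? i = (from i ^ e ≟ᶜ 1#) ×-dec (i Fin.<? to (- from i))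

  module _ (b : Fin 7 → Carrier) (b-rainbow : IsRainbow b) where
    private
      open Enumeration (enumerate half?)

      multiplier : Fin _ → Carrier
      multiplier k = from (elt k)

      multiplier-^e : ∀ k → multiplier k ^ e ≡ 1#
      multiplier-^e k = proj₁ (sound k)

      multiplier≢0 : ∀ k → multiplier k ≢ 0#
      multiplier≢0 k eq = 0≢1 (trans (sym 0^e≡0) (trans (cong (_^ e) (sym eq)) (multiplier-^e k)))

      multiplier-neg : ∀ k k′ → multiplier k ≢ - multiplier k′
      multiplier-neg k k′ eq = ℕ.<-asym (below k k′ eq)
        (below k′ k (trans (sym (-‿involutive _)) (cong -_ (sym eq))))
        where
        below : ∀ k k′ → multiplier k ≡ - multiplier k′ → elt k′ Fin.< elt k
        below k k′ eq = subst (elt k′ Fin.<_) (trans (cong to (sym eq)) (to∘from _)) (proj₂ (sound k′))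

      half-complete : ∀ {u} → u ^ e ≡ 1# → ∃ λ k → (multiplier k ≡ u) ⊎ (multiplier k ≡ - u)
      half-complete {u} uᵉ with Fin.<-cmp (to u) (to (- u))
      ... | tri< lt _ _ = let k , eq = complete (to u) (trans (cong (_^ e) (from∘to u)) uᵉ ,
                                          subst (λ z → to u Fin.< to (- z)) (sym (from∘to u)) lt)
                          in k , inj₁ (trans (cong from eq) (from∘to u))
      ... | tri> _ _ gt = let k , eq = complete (to (- u)) (trans (cong (_^ e) (from∘to (- u))) (trans (neg-^e u) uᵉ) ,
                                          subst (λ z → to (- u) Fin.< to z) (trans (sym (-‿involutive u)) (cong -_ (sym (from∘to (- u))))) gt)
                          in k , inj₂ (trans (cong from eq) (from∘to (- u)))
      ... | tri≈ _ eq _ = contradiction (trans (sym (from∘to u)) (trans (cong from eq) (from∘to (- u)))) (x≢-x u≢0)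
        where
        u≢0 : u ≢ 0#
        u≢0 refl = 0≢1 (trans (sym 0^e≡0) uᵉ)

      b-injective : Injective _≡_ _≡_ b
      b-injective {i} {j} eq with i ≟ j
      ... | yes i≡j = i≡j
      ... | no  i≢j with joinLine i j
      ... | c , (s , refl) , (t , refl) = contradiction eq (distinct s t (λ { refl → i≢j refl }))
        where
        x = b ∘ onLine c
        d : ∀ r → x (next r) ≢ x (next² r)
        d = opposite-nonzero x (b-rainbow c)
        distinct : ∀ s t → s ≢ t → x s ≢ x t
        distinct 0F 1F _ = d 2F
        distinct 1F 2F _ = d 0F
        distinct 2F 0F _ = d 1F
        distinct 1F 0F _ = d 2F ∘ sym
        distinct 2F 1F _ = d 0F ∘ sym
        distinct 0F 2F _ = d 1F ∘ sym
        distinct 0F 0F s≢t = contradiction refl s≢t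
        distinct 1F 1F s≢t = contradiction refl s≢t
        distinct 2F 2F s≢t = contradiction refl s≢t

      difference : ∀ {g x y m} → m * x ≡ g + m * y → m * (x - y) ≡ g
      difference {g} {x} {y} {m} eq = trans (x[y-z]≈xy-xz m x y) (trans (cong (_- m * y) eq)
        (trans (+-assoc g _ _) (trans (cong (g +_) (x-x≡0 _)) (+-identityʳ g))))

      difference⁻¹ : ∀ {g x y m} → m * (x - y) ≡ g → m * x ≡ g + m * y
      difference⁻¹ {g} {x} {y} {m} eq = trans (sym (x-y+y≡x (m * y) (m * x))) (cong (_+ m * y) (trans (sym (x[y-z]≈xy-xz m x y)) eq))

      -- The ratio of g to the difference `x s - x t` is an e-th root of unity u. Either u is a
      -- multiplier, or -u is one and the two points exchange their roles.
      scale : ∀ (x : Fin 3 → Carrier) {s t g} → x s ≢ x t → (x s - x t) ^ e ≡ g ^ e →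
              ∃ λ k → ∃ λ s → ∃ λ t → multiplier k * x s ≡ g + multiplier k * x t
      scale x {s} {t} {g} xs≢xt eq = finish (half-complete uᵉ)
        where
        d = x s - x t
        d≢0 : d ≢ 0#
        d≢0 = x≢y⇒x-y≢0 xs≢xt
        d⁻¹ = proj₁ (inverse d≢0)
        u = g * d⁻¹
        u*d≡g : u * d ≡ g
        u*d≡g = trans (*-assoc g d⁻¹ d) (trans (cong (g *_) (trans (*-comm d⁻¹ d) (proj₂ (inverse d≢0)))) (*-identityʳ g))
        uᵉ : u ^ e ≡ 1#
        uᵉ = *-cancelʳ (^-nonzero e d≢0) (trans (sym (^-distrib-* u d e)) (trans (cong (_^ e) u*d≡g) (trans (sym eq) (sym (*-identityˡ _)))))
        finish : (∃ λ k → (multiplier k ≡ u) ⊎ (multiplier k ≡ - u)) →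
                 ∃ λ k → ∃ λ s → ∃ λ t → multiplier k * x s ≡ g + multiplier k * x t
        finish (k , inj₁ m≡u)  = k , s , t , difference⁻¹ (trans (cong (_* d) m≡u) u*d≡g)
        finish (k , inj₂ m≡-u) = k , t , s , difference⁻¹ (trans (cong₂ _*_ m≡-u (sym (-[x-y]≡y-x (x s) (x t))))
          (trans (sym (-‿distribˡ-* u (- d))) (trans (cong -_ (sym (-‿distribʳ-* u d))) (trans (-‿involutive _) u*d≡g))))

      represented : ∀ c g → g ≢ 0# → ∃ λ k → ∃ λ s → ∃ λ t →
                    multiplier k * b (onLine c s) ≡ g + multiplier k * b (onLine c t)
      represented c g g≢0 =
        let r , eq = cubeRoot (opposite x) (b-rainbow c) (λ r → cube-^e (x≢y⇒x-y≢0 (apart r))) (cube-^e g≢0)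
        in scale x {next r} {next² r} (apart r) eq
        where
        x = b ∘ onLine c
        apart = opposite-nonzero x (b-rainbow c)

      -- The class of g determines the side of the line, hence s and t up to order. The same order
      -- gives the same multiplier; the opposite order would give multipliers that are negatives of
      -- each other, which a transversal modulo ±1 excludes.
      represented-unique : ∀ c {g} → g ≢ 0# → ∀ {k s t k′ s′ t′} →
        multiplier k  * b (onLine c s)  ≡ g + multiplier k  * b (onLine c t)  →
        multiplier k′ * b (onLine c s′) ≡ g + multiplier k′ * b (onLine c t′) → k′ ≡ k × s′ ≡ s × t′ ≡ t
      represented-unique c {g} g≢0 {k} {s} {t} {k′} {s′} {t′} eq eq′ =
        conclude (third-pair s t s′ t′ s≢t s′≢t′ (b-rainbow c (begin
          opposite x (third s′ t′)               ≡⟨ opposite-third x s′ t′ s′≢t′ ⟨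
          (x s′ - x t′) ^ e                      ≡⟨ power k′ s′ t′ δ′ ⟩
          g ^ e                                  ≡⟨ power k s t δ ⟨
          (x s - x t) ^ e                        ≡⟨ opposite-third x s t s≢t ⟩
          opposite x (third s t)                 ∎)))
        where
        open ≡-Reasoning
        x = b ∘ onLine c
        δ : multiplier k * (x s - x t) ≡ g
        δ = difference eq
        δ′ : multiplier k′ * (x s′ - x t′) ≡ g
        δ′ = difference eq′
        nonzero : ∀ k {d} → multiplier k * d ≡ g → d ≢ 0#
        nonzero k md≡g d≡0 = g≢0 (trans (sym md≡g) (trans (cong (multiplier k *_) d≡0) (zeroʳ _)))
        s≢t : s ≢ t
        s≢t s≡t = nonzero k δ (trans (cong (λ r → x r - x t) s≡t) (x-x≡0 (x t)))
        s′≢t′ : s′ ≢ t′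
        s′≢t′ s≡t = nonzero k′ δ′ (trans (cong (λ r → x r - x t′) s≡t) (x-x≡0 (x t′)))
        power : ∀ k s t → multiplier k * (x s - x t) ≡ g → (x s - x t) ^ e ≡ g ^ e
        power k s t md≡g = trans (sym (*-identityˡ _)) (trans (cong (_* (x s - x t) ^ e) (sym (multiplier-^e k)))
          (trans (sym (^-distrib-* _ _ e)) (cong (_^ e) md≡g)))
        conclude : (s′ ≡ s × t′ ≡ t) ⊎ (s′ ≡ t × t′ ≡ s) → k′ ≡ k × s′ ≡ s × t′ ≡ t
        conclude (inj₁ (s′≡s , t′≡t)) = elt-injective (from-injective (*-cancelʳ (nonzero k δ)
          (trans (cong₂ (λ i j → multiplier k′ * (x i - x j)) (sym s′≡s) (sym t′≡t)) (trans δ′ (sym δ))))) , s′≡s , t′≡t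
        conclude (inj₂ (s′≡t , t′≡s)) = contradiction (*-cancelʳ (nonzero k′ δ′) (begin
          multiplier k′ * (x s′ - x t′)     ≡⟨ δ′ ⟩
          g                                 ≡⟨ δ ⟨
          multiplier k * (x s - x t)        ≡⟨ cong₂ (λ i j → multiplier k * (x i - x j)) t′≡s s′≡t ⟨
          multiplier k * (x t′ - x s′)      ≡⟨ cong (multiplier k *_) (-[x-y]≡y-x _ _) ⟨
          multiplier k * - (x s′ - x t′)    ≡⟨ -‿distribʳ-* _ _ ⟨
          - (multiplier k * (x s′ - x t′))  ≡⟨ -‿distribˡ-* _ _ ⟩
          - multiplier k * (x s′ - x t′)    ∎)) (multiplier-neg k′ k)

    rainbow⇒baseFamily : BaseFamily q
    rainbow⇒baseFamily = record
      { Point            = Carrier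
      ; enumPoint        = enum
      ; _+_              = _+_
      ; 0#               = 0#
      ; -_               = -_
      ; isAbelianGroup   = CommutativeRing.+-isAbelianGroup commutativeRing
      ; Plane            = Fin _
      ; size             = _
      ; enumPlane        = ↔-id _
      ; pt               = λ k i → multiplier k * b i
      ; pt-injective     = λ k eq → b-injective (*-cancelˡ (multiplier≢0 k) eq)
      ; represent        = represented
      ; represent-unique = represented-unique
      -- The difference of the rows i and j is `t * (b i - b j)`, a bijection in t because the
      -- points of the plane are distinct.
      ; row              = λ i t → t * b i
      ; row-solve        = λ {i} {j} i≢j g →
          let d≢0 = x≢y⇒x-y≢0 (i≢j ∘ b-injective)
              d⁻¹ , eq = inverse d≢0
          in g * d⁻¹ , difference⁻¹ (trans (*-assoc g d⁻¹ _) (trans (cong (g *_) (trans (*-comm d⁻¹ _) eq)) (*-identityʳ g)))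
      ; row-unique       = λ i≢j eq eq′ → *-cancelʳ (x≢y⇒x-y≢0 (i≢j ∘ b-injective)) (trans (difference eq′) (sym (difference eq)))
      }

-- Counting by cubic classes

-- Linear arithmetic by certificate: `L ≤ R` is a combination of the hypotheses with nonnegative
-- coefficients, `s` is the slack, and the remaining equation is a polynomial identity for the ring
-- solver.
linear : ∀ {A B L R} s → L ≤ R → B ⊕ L ≡ A ⊕ R ⊕ s → A ≤ B
linear {A} {B} {L} {R} s L≤R eq = ℕ.+-cancelʳ-≤ R A B (begin
  A ⊕ R      ≤⟨ ℕ.m≤m+n (A ⊕ R) s ⟩
  A ⊕ R ⊕ s  ≡⟨ eq ⟨
  B ⊕ L      ≤⟨ ℕ.+-monoʳ-≤ B L≤R ⟩
  B ⊕ R      ∎)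
  where open ℕ.≤-Reasoning

0or1 : ℕ → Set
0or1 k = k ≡ 0 ⊎ k ≡ 1

0or1-* : ∀ {j k} → 0or1 j → 0or1 k → 0or1 (j ⊛ k)
0or1-* (inj₁ refl) _           = inj₁ refl
0or1-* (inj₂ refl) (inj₁ refl) = inj₁ refl
0or1-* (inj₂ refl) (inj₂ refl) = inj₂ refl

0or1-+ : ∀ {j k} → 0or1 j → 0or1 k → j ⊛ k ≡ 0 → 0or1 (j ⊕ k)
0or1-+ (inj₁ refl) k₁          _ = k₁
0or1-+ (inj₂ refl) (inj₁ refl) _ = inj₂ refl
0or1-+ (inj₂ refl) (inj₂ refl) ()

0or1-square : ∀ {k} → 0or1 k → k ⊛ k ≡ k
0or1-square (inj₁ refl) = refl
0or1-square (inj₂ refl) = refl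

*≡1 : ∀ {j k} → j ⊛ k ≡ 1 → j ≡ 1 × k ≡ 1
*≡1 {j} {k} eq = ℕ.m*n≡1⇒m≡1 j k eq , ℕ.m*n≡1⇒n≡1 j k eq

+≡1 : ∀ {j k} → j ⊕ k ≡ 1 → j ≡ 1 ⊎ k ≡ 1
+≡1 {zero}        eq = inj₂ eq
+≡1 {suc zero}    eq = inj₁ refl

0or1-≤ : ∀ {k} → 0or1 k → k ≤ 1
0or1-≤ (inj₁ refl) = z≤n
0or1-≤ (inj₂ refl) = s≤s z≤n

𝟙-0or1 : ∀ {P : Set} (d : Dec P) → 0or1 (𝟙 d)
𝟙-0or1 (yes _) = inj₂ refl
𝟙-0or1 (no  _) = inj₁ refl

𝟙-sound : ∀ {P : Set} (d : Dec P) → 𝟙 d ≡ 1 → P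
𝟙-sound (yes p) _ = p

𝟙-true : ∀ {P : Set} (d : Dec P) → P → 𝟙 d ≡ 1
𝟙-true (yes _) _ = refl
𝟙-true (no ¬p) p = contradiction p ¬p

𝟙-false : ∀ {P : Set} (d : Dec P) → ¬ P → 𝟙 d ≡ 0
𝟙-false (yes p) ¬p = contradiction p ¬p
𝟙-false (no _)  _  = refl

sum-mono-≤ : ∀ {q} {f g : Fin q → ℕ} → (∀ i → f i ≤ g i) → ℕSum.sum f ≤ ℕSum.sum g
sum-mono-≤ {zero}  f≤g = z≤n
sum-mono-≤ {suc q} f≤g = ℕ.+-mono-≤ (f≤g zero) (sum-mono-≤ (f≤g ∘ suc))

sum-*ˡ : ∀ {q} k (f : Fin q → ℕ) → ℕSum.sum (λ i → k ⊛ f i) ≡ k ⊛ ℕSum.sum f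
sum-*ˡ {zero}  k f = sym (ℕ.*-zeroʳ k)
sum-*ˡ {suc q} k f = trans (cong (k ⊛ f zero ⊕_) (sum-*ˡ k (f ∘ suc))) (sym (ℕ.*-distribˡ-+ k (f zero) _))

sum-const : ∀ q k → ℕSum.sum {q} (λ _ → k) ≡ q ⊛ k
sum-const zero    k = refl
sum-const (suc q) k = cong (k ⊕_) (sum-const q k)

-- The variance bound grows with the size of the set. The averaging arguments compare several sets
-- and work once these are cut down to one common size.
sum-trim : ∀ {q} (f : Fin q → ℕ) → (∀ i → 0or1 (f i)) → ∀ m → m ≤ ℕSum.sum f →
           ∃ λ g → (∀ i → 0or1 (g i)) × (∀ i → g i ≡ 1 → f i ≡ 1) × ℕSum.sum g ≡ m
sum-trim {q}     f f₁ zero    _  = (λ _ → 0) , (λ _ → inj₁ refl) , (λ _ ()) , trans (sum-const q 0) (ℕ.*-zeroʳ q)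
sum-trim {suc q} f f₁ (suc m) m≤ with f zero in f0 | f₁ zero
... | _ | inj₁ refl = let g , g₁ , g⊆f , eq = sum-trim (f ∘ suc) (f₁ ∘ suc) (suc m) m≤ in
  (λ { zero → 0 ; (suc i) → g i }) , (λ { zero → inj₁ refl ; (suc i) → g₁ i }) , (λ { zero () ; (suc i) → g⊆f i }) , eq
... | _ | inj₂ refl = let g , g₁ , g⊆f , eq = sum-trim (f ∘ suc) (f₁ ∘ suc) m (ℕ.≤-pred m≤) in
  (λ { zero → 1 ; (suc i) → g i }) , (λ { zero → inj₂ refl ; (suc i) → g₁ i }) , (λ { zero _ → f0 ; (suc i) → g⊆f i }) , cong suc eq

ceiling : ∀ k q → ∃ λ ρ → q ≤ suc k ⊛ ρ × (∀ x → q ≤ suc k ⊛ x → ρ ≤ x)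
ceiling k zero    = 0 , z≤n , λ _ _ → z≤n
ceiling k (suc q) with ceiling k q
... | ρ , q≤ , least with suc q ℕ.≤? suc k ⊛ ρ
... | yes q< = ρ , q< , λ x le → least x (ℕ.<⇒≤ le)
... | no  q≮ = suc ρ
  , ℕ.≤-trans (s≤s q≤) (ℕ.≤-trans (s≤s (ℕ.m≤n+m (suc k ⊛ ρ) k)) (ℕ.≤-reflexive (sym (ℕ.*-suc (suc k) ρ))))
  , λ x le → ℕ.≤∧≢⇒< (least x (ℕ.<⇒≤ le)) λ { refl → q≮ le }

square-distance : ∀ a b → ∣ a - b ∣ ⊛ ∣ a - b ∣ ⊕ 2 ⊛ (a ⊛ b) ≡ a ⊛ a ⊕ b ⊛ b
square-distance zero    b       = ℕ.+-identityʳ (b ⊛ b)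
square-distance (suc a) zero    = cong (suc a ⊛ suc a ⊕_) (trans (cong (2 ⊛_) (ℕ.*-zeroʳ a)) refl)
square-distance (suc a) (suc b) = trans (step₁ ∣ a - b ∣ a b) (trans (cong (_⊕ (2 ⊛ a ⊕ 2 ⊛ b ⊕ 2)) (square-distance a b)) (step₂ a b))
  where
  step₁ : ∀ d a b → d ⊛ d ⊕ 2 ⊛ (suc a ⊛ suc b) ≡ (d ⊛ d ⊕ 2 ⊛ (a ⊛ b)) ⊕ (2 ⊛ a ⊕ 2 ⊛ b ⊕ 2)
  step₁ = solve-∀
  step₂ : ∀ a b → (a ⊛ a ⊕ b ⊛ b) ⊕ (2 ⊛ a ⊕ 2 ⊛ b ⊕ 2) ≡ suc a ⊛ suc a ⊕ suc b ⊛ suc b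
  step₂ = solve-∀

-- Nine times the variance of the three numbers, written with distances in order to stay within ℕ.
spread : ℕ → ℕ → ℕ → ℕ
spread a b c = ∣ a - b ∣ ⊛ ∣ a - b ∣ ⊕ ∣ b - c ∣ ⊛ ∣ b - c ∣ ⊕ ∣ c - a ∣ ⊛ ∣ c - a ∣

spread-rotate : ∀ a b c → spread a b c ≡ spread b c a
spread-rotate a b c = rotate (∣ a - b ∣ ⊛ ∣ a - b ∣) _ _
  where
  rotate : ∀ x y z → x ⊕ y ⊕ z ≡ y ⊕ z ⊕ x
  rotate = solve-∀

spread-identity : ∀ a b c → spread a b c ⊕ (a ⊕ b ⊕ c) ⊛ (a ⊕ b ⊕ c) ≡ 3 ⊛ (a ⊛ a ⊕ b ⊛ b ⊕ c ⊛ c)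
spread-identity a b c = trans (expand (∣ a - b ∣ ⊛ ∣ a - b ∣) (∣ b - c ∣ ⊛ ∣ b - c ∣) (∣ c - a ∣ ⊛ ∣ c - a ∣) a b c)
  (trans (cong₂ (λ u v → u ⊕ v ⊕ (a ⊛ a ⊕ b ⊛ b ⊕ c ⊛ c)) (cong₂ _⊕_ (square-distance a b) (square-distance b c)) (square-distance c a)) (collect a b c))
  where
  expand : ∀ x y z a b c → x ⊕ y ⊕ z ⊕ (a ⊕ b ⊕ c) ⊛ (a ⊕ b ⊕ c) ≡
    (x ⊕ 2 ⊛ (a ⊛ b)) ⊕ (y ⊕ 2 ⊛ (b ⊛ c)) ⊕ (z ⊕ 2 ⊛ (c ⊛ a)) ⊕ (a ⊛ a ⊕ b ⊛ b ⊕ c ⊛ c)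
  expand = solve-∀
  collect : ∀ a b c → (a ⊛ a ⊕ b ⊛ b) ⊕ (b ⊛ b ⊕ c ⊛ c) ⊕ (c ⊛ c ⊕ a ⊛ a) ⊕ (a ⊛ a ⊕ b ⊛ b ⊕ c ⊛ c) ≡ 3 ⊛ (a ⊛ a ⊕ b ⊛ b ⊕ c ⊛ c)
  collect = solve-∀

square-sum : ∀ u w → (u ⊕ w) ⊛ (u ⊕ w) ≤ 2 ⊛ (u ⊛ u ⊕ w ⊛ w)
square-sum u w = begin
  (u ⊕ w) ⊛ (u ⊕ w)            ≡⟨ expand u w ⟩
  u ⊛ u ⊕ w ⊛ w ⊕ 2 ⊛ (u ⊛ w)  ≤⟨ ℕ.+-monoʳ-≤ (u ⊛ u ⊕ w ⊛ w) (ℕ.≤-trans (ℕ.m≤n+m (2 ⊛ (u ⊛ w)) (∣ u - w ∣ ⊛ ∣ u - w ∣)) (ℕ.≤-reflexive (square-distance u w))) ⟩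
  u ⊛ u ⊕ w ⊛ w ⊕ (u ⊛ u ⊕ w ⊛ w) ≡⟨ double (u ⊛ u ⊕ w ⊛ w) ⟩
  2 ⊛ (u ⊛ u ⊕ w ⊛ w)          ∎
  where
  open ℕ.≤-Reasoning
  expand : ∀ u w → (u ⊕ w) ⊛ (u ⊕ w) ≡ u ⊛ u ⊕ w ⊛ w ⊕ 2 ⊛ (u ⊛ w)
  expand = solve-∀
  double : ∀ x → x ⊕ x ≡ 2 ⊛ x
  double = solve-∀

-- A lower bound for a in terms of the mean. The number u is `∣ a - b ∣ + ∣ c - a ∣`, which avoids
-- both square roots and signs; its square is controlled by two of the three terms of the spread.
deviation : ∀ a b c → ∃ λ u → a ⊕ b ⊕ c ≤ 3 ⊛ a ⊕ u × u ⊛ u ≤ 2 ⊛ spread a b c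
deviation a b c = ∣ a - b ∣ ⊕ ∣ c - a ∣ , above , (begin
  (∣ a - b ∣ ⊕ ∣ c - a ∣) ⊛ (∣ a - b ∣ ⊕ ∣ c - a ∣)              ≤⟨ square-sum ∣ a - b ∣ ∣ c - a ∣ ⟩
  2 ⊛ (∣ a - b ∣ ⊛ ∣ a - b ∣ ⊕ ∣ c - a ∣ ⊛ ∣ c - a ∣)            ≤⟨ ℕ.*-monoʳ-≤ 2 (ℕ.+-monoˡ-≤ (∣ c - a ∣ ⊛ ∣ c - a ∣) (ℕ.m≤m+n (∣ a - b ∣ ⊛ ∣ a - b ∣) (∣ b - c ∣ ⊛ ∣ b - c ∣))) ⟩
  2 ⊛ spread a b c                                              ∎)
  where
  open ℕ.≤-Reasoning
  reassoc : ∀ a u w → a ⊕ (a ⊕ u) ⊕ (a ⊕ w) ≡ 3 ⊛ a ⊕ (u ⊕ w)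
  reassoc = solve-∀
  above : a ⊕ b ⊕ c ≤ 3 ⊛ a ⊕ (∣ a - b ∣ ⊕ ∣ c - a ∣)
  above = ℕ.≤-trans (ℕ.+-mono-≤ (ℕ.+-monoʳ-≤ a (ℕ.m≤n+∣n-m∣ b a)) (ℕ.m≤n+∣m-n∣ c a)) (ℕ.≤-reflexive (reassoc a _ _))

square-cancel-≤ : ∀ {a b} → a ⊛ a ≤ b ⊛ b → a ≤ b
square-cancel-≤ {a} {b} a²≤b² = ℕ.≮⇒≥ λ b<a → ℕ.<⇒≱ (ℕ.*-mono-< b<a b<a) a²≤b²

-- Replaces the square root of `c q` by `q / k`, which is legitimate once `q ≥ k² c`. The numerical
-- estimates become linear in this way.
scale-square : ∀ k {u c q} → u ⊛ u ≤ c ⊛ q → k ⊛ k ⊛ c ≤ q → k ⊛ u ≤ q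
scale-square k {u} {c} {q} u²≤ kkc≤q = square-cancel-≤ (begin
  k ⊛ u ⊛ (k ⊛ u)    ≡⟨ rearrange₁ k u ⟩
  k ⊛ k ⊛ (u ⊛ u)    ≤⟨ ℕ.*-monoʳ-≤ (k ⊛ k) u²≤ ⟩
  k ⊛ k ⊛ (c ⊛ q)    ≡⟨ ℕ.*-assoc (k ⊛ k) c q ⟨
  k ⊛ k ⊛ c ⊛ q      ≤⟨ ℕ.*-monoˡ-≤ q kkc≤q ⟩
  q ⊛ q              ∎)
  where
  open ℕ.≤-Reasoning
  rearrange₁ : ∀ k u → k ⊛ u ⊛ (k ⊛ u) ≡ k ⊛ k ⊛ (u ⊛ u)
  rearrange₁ = solve-∀

-- Cubic classes and the variance of their counts

module Characters {q n : ℕ} (D : FiniteDomain q) (q≡1+6n : q ≡ suc (6 ℕ.* n)) where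
  open RainbowPlanes {q} {n} D q≡1+6n public

  q≡1+3e : q ≡ suc (3 ⊛ e)
  q≡1+3e = trans q≡1+6n (cong suc (6n≡3e n))
    where
    6n≡3e : ∀ n → 6 ⊛ n ≡ 3 ⊛ (2 ⊛ n)
    6n≡3e = solve-∀

  abstract
    ∑ : (Carrier → ℕ) → ℕ
    ∑ f = ℕSum.sum (f ∘ from)

    ∑-cong : ∀ {f g} → (∀ x → f x ≡ g x) → ∑ f ≡ ∑ g
    ∑-cong eq = ℕSum.sum-cong-≗ (eq ∘ from)

    ∑-+ : ∀ f g → ∑ (λ x → f x ⊕ g x) ≡ ∑ f ⊕ ∑ g
    ∑-+ f g = ℕSum.∑-distrib-+ (f ∘ from) (g ∘ from)

    ∑-*ˡ : ∀ k f → ∑ (λ x → k ⊛ f x) ≡ k ⊛ ∑ f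
    ∑-*ˡ k f = sum-*ˡ k (f ∘ from)

    ∑-comm : ∀ (f : Carrier → Carrier → ℕ) → ∑ (λ x → ∑ (f x)) ≡ ∑ (λ y → ∑ (λ x → f x y))
    ∑-comm f = ℕSum.∑-comm (λ i j → f (from i) (from j))

    ∑-mono-≤ : ∀ {f g} → (∀ x → f x ≤ g x) → ∑ f ≤ ∑ g
    ∑-mono-≤ f≤g = sum-mono-≤ (f≤g ∘ from)

    ∑-const : ∀ k → ∑ (λ _ → k) ≡ q ⊛ k
    ∑-const k = sum-const q k

    ∑-reindex : ∀ f (φ ψ : Carrier → Carrier) → (∀ x → φ (ψ x) ≡ x) → (∀ x → ψ (φ x) ≡ x) → ∑ f ≡ ∑ (f ∘ φ)
    ∑-reindex = sumOver-reindex ℕ.+-0-commutativeMonoid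

    ∑-trim : ∀ f → (∀ x → 0or1 (f x)) → ∀ m → m ≤ ∑ f →
             ∃ λ g → (∀ x → 0or1 (g x)) × (∀ x → g x ≡ 1 → f x ≡ 1) × ∑ g ≡ m
    ∑-trim f f₁ m m≤ = let g , g₁ , g⊆f , eq = sum-trim (f ∘ from) (f₁ ∘ from) m m≤ in
      g ∘ to , g₁ ∘ to , (λ x gx → trans (cong f (sym (from∘to x))) (g⊆f (to x) gx)) ,
      trans (ℕSum.sum-cong-≗ (λ i → cong g (to∘from i))) eq

    exists? : ∀ {P : Carrier → Set} → (∀ x → Dec (P x)) → (∃ P) ⊎ (∀ x → ¬ P x)
    exists? {P} P? with any? (P? ∘ from)
    ... | yes (i , p) = inj₁ (from i , p)
    ... | no  ¬p      = inj₂ λ x p → ¬p (to x , subst P (sym (from∘to x)) p)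

    support : ∀ f → (∀ x → 0or1 (f x)) → ∃ λ (g : Fin (∑ f) → Carrier) → Injective _≡_ _≡_ g × (∀ j → f (g j) ≡ 1)
    support f f₁ = subst (λ k → ∃ λ (g : Fin k → Carrier) → Injective _≡_ _≡_ g × (∀ j → f (g j) ≡ 1))
      (ℕSum.sum-cong-≗ (λ i → count (f₁ (from i))))
      (from ∘ elt , (λ eq → elt-injective (from-injective eq)) , sound)
      where
      open Enumeration (enumerate (λ i → f (from i) ℕ.≟ 1))
      count : ∀ {k} → 0or1 k → 𝟙 (k ℕ.≟ 1) ≡ k
      count (inj₁ refl) = refl
      count (inj₂ refl) = refl

    ∑-single : ∀ f z → (∀ x → x ≢ z → f x ≡ 0) → ∑ f ≡ f z
    ∑-single f z others = single q refl
      where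
      single : ∀ m → m ≡ q → ∑ f ≡ f z
      single zero    refl = contradiction (to 0#) λ ()
      single (suc m) refl = begin
        ∑ f   ≡⟨ ℕSum.sum-remove {i = to z} (f ∘ from) ⟩
        f (from (to z)) ⊕ ℕSum.sum (f ∘ from ∘ punchIn (to z))
          ≡⟨ cong₂ _⊕_ (cong f (from∘to z)) (ℕSum.sum-cong-≗ λ i → others _ λ eq → Fin.punchInᵢ≢i (to z) i (trans (sym (to∘from _)) (cong to eq))) ⟩
        f z ⊕ ℕSum.sum {m} (λ _ → 0)  ≡⟨ cong (f z ⊕_) (trans (sum-const m 0) (ℕ.*-zeroʳ m)) ⟩
        f z ⊕ 0                       ≡⟨ ℕ.+-identityʳ (f z) ⟩
        f z                           ∎
        where open ≡-Reasoning

  ∑-*ʳ : ∀ k f → ∑ (λ x → f x ⊛ k) ≡ ∑ f ⊛ k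
  ∑-*ʳ k f = trans (∑-cong (λ x → ℕ.*-comm (f x) k)) (trans (∑-*ˡ k f) (ℕ.*-comm k (∑ f)))

  average : ∀ (f g : Carrier → ℕ) {ρ B} → (∀ x → 0or1 (f x)) → 1 ≤ ρ → ρ ≤ ∑ f → ∑ (λ x → f x ⊛ g x) ≤ ρ ⊛ B →
            ∃ λ x → f x ≡ 1 × g x ≤ B
  average f g {ρ} {B} f₁ 1≤ρ ρ≤ bound with exists? (λ x → (f x ℕ.≟ 1) ×-dec (g x ℕ.≤? B))
  ... | inj₁ found = found
  ... | inj₂ none  = contradiction (begin-strict
    ρ ⊛ B                        <⟨ ℕ.m<m+n (ρ ⊛ B) 1≤ρ ⟩
    ρ ⊛ B ⊕ ρ                    ≡⟨ trans (ℕ.+-comm (ρ ⊛ B) ρ) (sym (ℕ.*-suc ρ B)) ⟩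
    ρ ⊛ suc B                    ≤⟨ ℕ.*-monoˡ-≤ (suc B) ρ≤ ⟩
    ∑ f ⊛ suc B                  ≡⟨ ∑-*ʳ (suc B) f ⟨
    ∑ (λ x → f x ⊛ suc B)        ≤⟨ ∑-mono-≤ pointwise ⟩
    ∑ (λ x → f x ⊛ g x)          ≤⟨ bound ⟩
    ρ ⊛ B                        ∎) (ℕ.<-irrefl refl)
    where
    open ℕ.≤-Reasoning
    pointwise : ∀ x → f x ⊛ suc B ≤ f x ⊛ g x
    pointwise x with f₁ x
    ... | inj₁ fx≡0 = ℕ.≤-trans (ℕ.≤-reflexive (cong (_⊛ suc B) fx≡0)) z≤n
    ... | inj₂ fx≡1 = ℕ.*-monoʳ-≤ (f x) (ℕ.≰⇒> λ le → none x (fx≡1 , le))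

  -- Otherwise all 6n nonzero elements would be roots of a polynomial of degree 2n.
  nonResidue : ∃ λ x → x ≢ 0# × x ^ e ≢ 1#
  nonResidue with exists? (λ x → ¬? (x ≟ᶜ 0#) ×-dec ¬? (x ^ e ≟ᶜ 1#))
  ... | inj₁ found = found
  ... | inj₂ none  = contradiction (all-residues q q≡1+6n refl) (n≢0 ∘ 6n≤2n n)
    where
    6n≤2n : ∀ n → 6 ⊛ n ≤ 2 ⊛ n → n ≡ 0
    6n≤2n zero    _  = refl
    6n≤2n (suc n) le = contradiction le (ℕ.<⇒≱ (ℕ.*-monoˡ-< (suc n) {2} {6} (s≤s (s≤s (s≤s z≤n)))))
    all-residues : ∀ m → m ≡ suc (6 ⊛ n) → m ≡ q → 6 ⊛ n ≤ e
    all-residues _ refl refl with e≡suc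
    ... | k , e≡ = subst (6 ⊛ n ≤_) (sym e≡) (power-bound {k} 1# (from ∘ punchIn (to 0#))
      (λ eq → Fin.punchIn-injective (to 0#) _ _ (from-injective eq))
      λ i → residue (from (punchIn (to 0#) i)) λ eq → Fin.punchInᵢ≢i (to 0#) i (trans (sym (to∘from _)) (cong to eq)))
      where
      residue : ∀ x → x ≢ 0# → x ^ suc k ≡ 1#
      residue x x≢0 with x ^ suc k ≟ᶜ 1#
      ... | yes eq = eq
      ... | no neq = contradiction (x≢0 , subst (λ m → x ^ m ≢ 1#) (sym e≡) neq) (none x)

  ω : Carrier
  ω = proj₁ nonResidue ^ e

  ω³ : ω * (ω * ω) ≡ 1#
  ω³ = trans (cong (λ z → ω * (ω * z)) (sym (*-identityʳ ω))) (cube-^e (proj₁ (proj₂ nonResidue)))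

  ω≢1 : ω ≢ 1#
  ω≢1 = proj₂ (proj₂ nonResidue)

  ω≢0 : ω ≢ 0#
  ω≢0 = ^-nonzero e (proj₁ (proj₂ nonResidue))

  root : Fin 3 → Carrier
  root 0F = 1#
  root 1F = ω
  root 2F = ω * ω

  root-cube : ∀ r → root r ^ 3 ≡ 1#
  root-cube 0F = 1^k≡1 3
  root-cube 1F = cube-^e (proj₁ (proj₂ nonResidue))
  root-cube 2F = trans (^-distrib-* ω ω 3) (trans (cong₂ _*_ (root-cube 1F) (root-cube 1F)) (*-identityˡ 1#))

  ω²≢ω : ω * ω ≢ ω
  ω²≢ω eq = ω≢1 (*-cancelˡ ω≢0 (trans eq (sym (*-identityʳ ω))))

  ω²≢1 : ω * ω ≢ 1#
  ω²≢1 eq = ω≢1 (trans (trans (sym (*-identityʳ ω)) (cong (ω *_) (sym eq))) ω³)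

  root-injective : Injective _≡_ _≡_ root
  root-injective {0F} {0F} _  = refl
  root-injective {1F} {1F} _  = refl
  root-injective {2F} {2F} _  = refl
  root-injective {0F} {1F} eq = contradiction (sym eq) ω≢1
  root-injective {1F} {0F} eq = contradiction eq ω≢1
  root-injective {0F} {2F} eq = contradiction (sym eq) ω²≢1
  root-injective {2F} {0F} eq = contradiction eq ω²≢1
  root-injective {1F} {2F} eq = contradiction (sym eq) ω²≢ω
  root-injective {2F} {1F} eq = contradiction eq ω²≢ω

  abstract
    c : Fin 3 → Carrier → ℕ
    c r x = 𝟙 (x ^ e ≟ᶜ root r)

    δ : Carrier → ℕ
    δ x = 𝟙 (x ≟ᶜ 0#)

    c-0or1 : ∀ r x → 0or1 (c r x)
    c-0or1 r x = 𝟙-0or1 (x ^ e ≟ᶜ root r)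

    c-sound : ∀ {r x} → c r x ≡ 1 → x ^ e ≡ root r
    c-sound {r} {x} = 𝟙-sound (x ^ e ≟ᶜ root r)

    c-complete : ∀ {r x} → x ^ e ≡ root r → c r x ≡ 1
    c-complete {r} {x} = 𝟙-true (x ^ e ≟ᶜ root r)

    c-cong : ∀ r {x y} → x ^ e ≡ y ^ e → c r x ≡ c r y
    c-cong r eq = cong (λ p → 𝟙 (p ≟ᶜ root r)) eq

    δ-zero : ∀ {x} → x ≡ 0# → δ x ≡ 1
    δ-zero {x} = 𝟙-true (x ≟ᶜ 0#)

    δ-nonzero : ∀ {x} → x ≢ 0# → δ x ≡ 0
    δ-nonzero {x} = 𝟙-false (x ≟ᶜ 0#)

  c-other : ∀ {r s x} → c r x ≡ 1 → s ≢ r → c s x ≡ 0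
  c-other {r} {s} {x} cr≡1 s≢r with c-0or1 s x
  ... | inj₁ cs≡0 = cs≡0
  ... | inj₂ cs≡1 = contradiction (root-injective (trans (sym (c-sound cs≡1)) (c-sound cr≡1))) s≢r

  c-zero : ∀ {x} r → x ≡ 0# → c r x ≡ 0
  c-zero {x} r refl with c-0or1 r x
  ... | inj₁ eq = eq
  ... | inj₂ eq = contradiction (trans (sym 0^e≡0) (c-sound eq)) (root≢0 r)
    where
    root≢0 : ∀ r → 0# ≢ root r
    root≢0 0F = 0≢1
    root≢0 1F = ω≢0 ∘ sym
    root≢0 2F = *-nonzero ω≢0 ω≢0 ∘ sym

  c-class : ∀ {x} → x ≢ 0# → ∃ λ r → c r x ≡ 1
  c-class x≢0 = let r , eq = cubeRoot root root-injective root-cube (cube-^e x≢0) in r , c-complete (sym eq)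

  c-nonzero : ∀ {r x} → c r x ≡ 1 → x ≢ 0#
  c-nonzero {r} cr≡1 x≡0 = contradiction (trans (sym cr≡1) (c-zero r x≡0)) λ ()

  c-disjoint : ∀ {r s} x → r ≢ s → c r x ⊛ c s x ≡ 0
  c-disjoint {r} {s} x r≢s with c-0or1 r x
  ... | inj₁ cr≡0 = cong (_⊛ c s x) cr≡0
  ... | inj₂ cr≡1 = trans (cong (c r x ⊛_) (c-other cr≡1 (r≢s ∘ sym))) (ℕ.*-zeroʳ (c r x))

  c-minus : ∀ r x y → c r (x - y) ≡ c r (y - x)
  c-minus r x y = c-cong r (minus-^e x y)

  c-scale : ∀ r {t} x → c 0F t ≡ 1 → c r (t * x) ≡ c r x
  c-scale r {t} x ct≡1 = c-cong r (trans (^-distrib-* t x e) (trans (cong (_* x ^ e) (c-sound ct≡1)) (*-identityˡ _)))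

  ∑₃ : (Fin 3 → ℕ) → ℕ
  ∑₃ f = f 0F ⊕ f 1F ⊕ f 2F

  ∑₃-cong : ∀ {f g : Fin 3 → ℕ} → (∀ r → f r ≡ g r) → ∑₃ f ≡ ∑₃ g
  ∑₃-cong eq = cong₂ _⊕_ (cong₂ _⊕_ (eq 0F) (eq 1F)) (eq 2F)

  ∑₃-single : ∀ {f : Fin 3 → ℕ} r → (∀ s → s ≢ r → f s ≡ 0) → ∑₃ f ≡ f r
  ∑₃-single {f} 0F others rewrite others 1F (λ ()) | others 2F (λ ()) = trans (ℕ.+-identityʳ _) (ℕ.+-identityʳ _)
  ∑₃-single {f} 1F others rewrite others 0F (λ ()) | others 2F (λ ()) = ℕ.+-identityʳ _
  ∑₃-single {f} 2F others rewrite others 0F (λ ()) | others 1F (λ ()) = refl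

  ∑₃-*ˡ : ∀ k (f : Fin 3 → ℕ) → ∑₃ (λ r → k ⊛ f r) ≡ k ⊛ ∑₃ f
  ∑₃-*ˡ k f = sym (trans (ℕ.*-distribˡ-+ k (f 0F ⊕ f 1F) (f 2F)) (cong (_⊕ k ⊛ f 2F) (ℕ.*-distribˡ-+ k (f 0F) (f 1F))))

  ∑-∑₃ : ∀ (f : Carrier → Fin 3 → ℕ) → ∑ (λ x → ∑₃ (f x)) ≡ ∑₃ (λ r → ∑ (λ x → f x r))
  ∑-∑₃ f = trans (∑-+ (λ x → f x 0F ⊕ f x 1F) (λ x → f x 2F)) (cong (_⊕ ∑ (λ x → f x 2F)) (∑-+ (λ x → f x 0F) (λ x → f x 1F)))

  c-total : ∀ x → ∑₃ (λ r → c r x) ⊕ δ x ≡ 1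
  c-total x with x ≟ᶜ 0#
  ... | yes x≡0 = cong₂ _⊕_ (∑₃-cong {λ r → c r x} {λ _ → 0} (λ r → c-zero r x≡0)) (δ-zero x≡0)
  ... | no  x≢0 = let r , cr≡1 = c-class x≢0 in
    cong₂ _⊕_ (trans (∑₃-single {λ r → c r x} r (λ s → c-other cr≡1)) cr≡1) (δ-nonzero x≢0)

  N : (Carrier → ℕ) → Fin 3 → Carrier → ℕ
  N f r z = ∑ (λ x → f x ⊛ c r (x - z))

  T : (Carrier → ℕ) → Carrier → ℕ
  T f z = ∑₃ (λ r → N f r z)

  S : (Carrier → ℕ) → Carrier → ℕ
  S f z = spread (N f 0F z) (N f 1F z) (N f 2F z)

  ∑-δ : ∀ (f : Carrier → ℕ) z → ∑ (λ x → f x ⊛ δ (x - z)) ≡ f z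
  ∑-δ f z = trans (∑-single (λ x → f x ⊛ δ (x - z)) z (λ x x≢z → trans (cong (f x ⊛_) (δ-nonzero (x≢y⇒x-y≢0 x≢z))) (ℕ.*-zeroʳ (f x))))
    (trans (cong (f z ⊛_) (δ-zero (x-x≡0 z))) (ℕ.*-identityʳ (f z)))

  T-total : ∀ f z → T f z ⊕ f z ≡ ∑ f
  T-total f z = begin
    T f z ⊕ f z
      ≡⟨ cong₂ _⊕_ (∑-∑₃ (λ x r → f x ⊛ c r (x - z))) (∑-δ f z) ⟨
    ∑ (λ x → ∑₃ (λ r → f x ⊛ c r (x - z))) ⊕ ∑ (λ x → f x ⊛ δ (x - z))
      ≡⟨ ∑-+ _ _ ⟨
    ∑ (λ x → ∑₃ (λ r → f x ⊛ c r (x - z)) ⊕ f x ⊛ δ (x - z))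
      ≡⟨ ∑-cong (λ x → trans (cong (_⊕ f x ⊛ δ (x - z)) (∑₃-*ˡ (f x) (λ r → c r (x - z))))
           (trans (sym (ℕ.*-distribˡ-+ (f x) (∑₃ (λ r → c r (x - z))) (δ (x - z)))) (trans (cong (f x ⊛_) (c-total (x - z))) (ℕ.*-identityʳ (f x))))) ⟩
    ∑ f ∎
    where open ≡-Reasoning

  T≥ : ∀ f z → (∀ x → 0or1 (f x)) → ∑ f ≤ T f z ⊕ 1
  T≥ f z f₁ = ℕ.≤-trans (ℕ.≤-reflexive (sym (T-total f z))) (ℕ.+-monoʳ-≤ (T f z) (0or1-≤ (f₁ z)))

  ∑-product : ∀ f g → ∑ f ⊛ ∑ g ≡ ∑ (λ x → ∑ (λ y → f x ⊛ g y))
  ∑-product f g = trans (sym (∑-*ʳ (∑ g) f)) (∑-cong (λ x → sym (∑-*ˡ (f x) g)))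

  -- At most one term is nonzero: this is the indicator of z seeing x and y in the same class.
  agree : Carrier → Carrier → Carrier → ℕ
  agree x y z = ∑₃ (λ r → c r (x - z) ⊛ c r (y - z))

  agree-self : ∀ x → ∑ (agree x x) ⊕ 1 ≡ q
  agree-self x = begin
    ∑ (agree x x) ⊕ 1                               ≡⟨ cong (∑ (agree x x) ⊕_) (∑-δ (λ _ → 1) x) ⟨
    ∑ (agree x x) ⊕ ∑ (λ z → 1 ⊛ δ (z - x))         ≡⟨ ∑-+ _ _ ⟨
    ∑ (λ z → agree x x z ⊕ 1 ⊛ δ (z - x))           ≡⟨ ∑-cong pointwise ⟩
    ∑ (λ _ → 1)                                     ≡⟨ trans (∑-const 1) (ℕ.*-identityʳ q) ⟩
    q ∎
    where
    open ≡-Reasoning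
    pointwise : ∀ z → agree x x z ⊕ 1 ⊛ δ (z - x) ≡ 1
    pointwise z = trans (cong₂ _⊕_
      (∑₃-cong (λ r → trans (0or1-square (c-0or1 r (x - z))) (c-minus r x z)))
      (ℕ.*-identityˡ (δ (z - x)))) (c-total (z - x))

  agree-0or1 : ∀ x y z → 0or1 (agree x y z)
  agree-0or1 x y z with (x - z) ≟ᶜ 0#
  ... | yes eq = inj₁ (∑₃-cong {λ r → c r (x - z) ⊛ c r (y - z)} {λ _ → 0} (λ r → cong (_⊛ c r (y - z)) (c-zero r eq)))
  ... | no neq = let r , cr≡1 = c-class neq in
    subst 0or1 (sym (∑₃-single {λ r → c r (x - z) ⊛ c r (y - z)} r (λ s s≢r → cong (_⊛ c s (y - z)) (c-other cr≡1 s≢r))))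
      (0or1-* (c-0or1 r (x - z)) (c-0or1 r (y - z)))

  agree-sound : ∀ x y z → agree x y z ≡ 1 → (x - z) ^ e ≡ (y - z) ^ e × y - z ≢ 0#
  agree-sound x y z eq = [ [ same 0F , same 1F ]′ ∘ +≡1 , same 2F ]′ (+≡1 {c 0F (x - z) ⊛ c 0F (y - z) ⊕ c 1F (x - z) ⊛ c 1F (y - z)} eq)
    where
    same : ∀ r → c r (x - z) ⊛ c r (y - z) ≡ 1 → (x - z) ^ e ≡ (y - z) ^ e × y - z ≢ 0#
    same r eq = let cx , cy = *≡1 {c r (x - z)} eq in trans (c-sound cx) (sym (c-sound cy)) , c-nonzero cy

  -- For x ≢ y the map z ↦ (x - z) / (y - z) is injective and takes values ≢ 1 whose e-th power is 1.
  agree-distinct : ∀ {x y} → x ≢ y → ∑ (agree x y) ⊕ 1 ≤ e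
  agree-distinct {x} {y} x≢y with support (agree x y) (agree-0or1 x y) | e≡suc
  ... | g , g-inj , g-agree | k , e≡ = ℕ.≤-trans (ℕ.≤-reflexive (ℕ.+-comm _ 1))
    (subst (suc (∑ (agree x y)) ≤_) (sym e≡) (power-bound {k} 1# f (f-inj _ _) (subst (λ m → ∀ i → f i ^ m ≡ 1#) e≡ fᵉ)))
    where
    y-g≢0 : ∀ j → y - g j ≢ 0#
    y-g≢0 j = proj₂ (agree-sound x y (g j) (g-agree j))
    f : Fin (suc (∑ (agree x y))) → Carrier
    -- The root 1 is not one of the ratios; it accounts for the 1 added on the left of the bound.
    f zero    = 1#
    f (suc j) = (x - g j) * proj₁ (inverse (y-g≢0 j))
    f-mul : ∀ j → f (suc j) * (y - g j) ≡ x - g j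
    f-mul j = trans (*-assoc _ _ _) (trans (cong ((x - g j) *_) (trans (*-comm _ _) (proj₂ (inverse (y-g≢0 j))))) (*-identityʳ _))
    fᵉ : ∀ i → f i ^ e ≡ 1#
    fᵉ zero    = 1^k≡1 e
    fᵉ (suc j) = *-cancelʳ (^-nonzero e (y-g≢0 j)) (trans (sym (^-distrib-* (f (suc j)) (y - g j) e))
      (trans (cong (_^ e) (f-mul j)) (trans (proj₁ (agree-sound x y (g j) (g-agree j))) (sym (*-identityˡ _)))))
    f≢1 : ∀ j → f (suc j) ≢ 1#
    f≢1 j eq = x≢y (+-cancelʳ (- g j) _ _ (trans (sym (f-mul j)) (trans (cong (_* (y - g j)) eq) (*-identityˡ _))))
    -- The ratio u determines z, since the coefficient `u - 1` is nonzero.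
    solve-z : ∀ u z → u * (y - z) ≡ x - z → (u - 1#) * z ≡ u * y - x
    solve-z u z eq = +-cancelʳ (u * (y - z)) _ _ (begin
      (u - 1#) * z + u * (y - z)     ≡⟨ cong₂ _+_ (trans ([y-z]x≈yx-zx z u 1#) (cong (λ a → u * z - a) (*-identityˡ z))) (x[y-z]≈xy-xz u y z) ⟩
      (u * z - z) + (u * y - u * z)  ≡⟨ cancel (u * z) z (u * y) ⟩
      u * y - z                      ≡⟨ insert (u * y) x z ⟩
      (u * y - x) + (x - z)          ≡⟨ cong ((u * y - x) +_) eq ⟨
      (u * y - x) + u * (y - z)      ∎)
      where
      open ≡-Reasoning
      insert : ∀ a b d → a - d ≡ (a - b) + (b - d)
      insert a b d = sym (trans (sym (+-assoc (a - b) b (- d))) (cong (_- d) (x-y+y≡x b a)))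
      cancel : ∀ a b d → (a - b) + (d - a) ≡ d - b
      cancel a b d = trans (+-comm _ _) (sym (insert d a b))
    f-inj : ∀ i j → f i ≡ f j → i ≡ j
    f-inj zero    zero    eq = refl
    f-inj zero    (suc j) eq = contradiction (sym eq) (f≢1 j)
    f-inj (suc i) zero    eq = contradiction eq (f≢1 i)
    f-inj (suc i) (suc j) eq = cong suc (g-inj (*-cancelˡ (x≢y⇒x-y≢0 (f≢1 i))
      (trans (solve-z (f (suc i)) (g i) (f-mul i)) (sym (solve-z (f (suc i)) (g j) (trans (cong (_* (y - g j)) eq) (f-mul j)))))))

  agree-bound : ∀ x y → ∑ (agree x y) ⊕ 1 ≤ e ⊕ δ (x - y) ⊛ (2 ⊛ e ⊕ 1)
  agree-bound x y with x ≟ᶜ y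
  ... | yes refl = ℕ.≤-reflexive (begin
    ∑ (agree x x) ⊕ 1                ≡⟨ agree-self x ⟩
    q                                ≡⟨ q≡1+3e ⟩
    suc (3 ⊛ e)                      ≡⟨ split e ⟩
    e ⊕ 1 ⊛ (2 ⊛ e ⊕ 1)              ≡⟨ cong (λ k → e ⊕ k ⊛ (2 ⊛ e ⊕ 1)) (δ-zero (x-x≡0 x)) ⟨
    e ⊕ δ (x - x) ⊛ (2 ⊛ e ⊕ 1)      ∎)
    where
    open ≡-Reasoning
    split : ∀ e → suc (3 ⊛ e) ≡ e ⊕ 1 ⊛ (2 ⊛ e ⊕ 1)
    split = solve-∀
  ... | no x≢y = ℕ.≤-trans (agree-distinct x≢y) (ℕ.m≤m+n e _)

  -- Double counting: the square of `N f r z` counts the pairs of points of the set that z sees in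
  -- class r; summation over z is then moved inside.
  pair-count : ∀ f → ∑ (λ z → ∑₃ (λ r → N f r z ⊛ N f r z)) ≡ ∑ (λ x → ∑ (λ y → f x ⊛ f y ⊛ ∑ (agree x y)))
  pair-count f = begin
    ∑ (λ z → ∑₃ (λ r → N f r z ⊛ N f r z))
      ≡⟨ ∑-cong (λ z → trans (∑₃-cong (λ r → ∑-product (g r z) (g r z)))
           (trans (sym (∑-∑₃ (λ x r → ∑ (λ y → g r z x ⊛ g r z y)))) (∑-cong (λ x → sym (∑-∑₃ (λ y r → g r z x ⊛ g r z y)))))) ⟩
    ∑ (λ z → ∑ (λ x → ∑ (λ y → ∑₃ (λ r → (f x ⊛ c r (x - z)) ⊛ (f y ⊛ c r (y - z))))))
      ≡⟨ ∑-cong (λ z → ∑-cong (λ x → ∑-cong (λ y → trans (∑₃-cong (λ r → *-interchange (f x) (c r (x - z)) (f y) (c r (y - z)))) (∑₃-*ˡ (f x ⊛ f y) (λ r → c r (x - z) ⊛ c r (y - z)))))) ⟩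
    ∑ (λ z → ∑ (λ x → ∑ (λ y → f x ⊛ f y ⊛ agree x y z)))
      ≡⟨ ∑-comm _ ⟩
    ∑ (λ x → ∑ (λ z → ∑ (λ y → f x ⊛ f y ⊛ agree x y z)))
      ≡⟨ ∑-cong (λ x → trans (∑-comm _) (∑-cong (λ y → ∑-*ˡ (f x ⊛ f y) (agree x y)))) ⟩
    ∑ (λ x → ∑ (λ y → f x ⊛ f y ⊛ ∑ (agree x y))) ∎
    where
    open ≡-Reasoning
    g : Fin 3 → Carrier → Carrier → ℕ
    g r z x = f x ⊛ c r (x - z)

  pair-bound : ∀ f → (∀ x → 0or1 (f x)) → let m = ∑ f in
               ∑ (λ z → ∑₃ (λ r → N f r z ⊛ N f r z)) ⊕ m ⊛ m ≤ e ⊛ (m ⊛ m) ⊕ m ⊛ (2 ⊛ e ⊕ 1)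
  pair-bound f f₁ = begin
    ∑ (λ z → ∑₃ (λ r → N f r z ⊛ N f r z)) ⊕ ∑ f ⊛ ∑ f
      ≡⟨ cong₂ _⊕_ (pair-count f) (∑-product f f) ⟩
    ∑ (λ x → ∑ (λ y → f x ⊛ f y ⊛ ∑ (agree x y))) ⊕ ∑ (λ x → ∑ (λ y → f x ⊛ f y))
      ≡⟨ trans (sym (∑-+ _ _)) (∑-cong (λ x → sym (∑-+ _ _))) ⟩
    ∑ (λ x → ∑ (λ y → f x ⊛ f y ⊛ ∑ (agree x y) ⊕ f x ⊛ f y))
      ≤⟨ ∑-mono-≤ (λ x → ∑-mono-≤ (λ y → pointwise x y)) ⟩
    ∑ (λ x → ∑ (λ y → e ⊛ (f x ⊛ f y) ⊕ (2 ⊛ e ⊕ 1) ⊛ (f x ⊛ (f y ⊛ δ (y - x)))))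
      ≡⟨ trans (∑-cong (λ x → ∑-+ _ _)) (∑-+ _ _) ⟩
    ∑ (λ x → ∑ (λ y → e ⊛ (f x ⊛ f y))) ⊕ ∑ (λ x → ∑ (λ y → (2 ⊛ e ⊕ 1) ⊛ (f x ⊛ (f y ⊛ δ (y - x)))))
      ≡⟨ cong₂ _⊕_
           (trans (∑-cong (λ x → ∑-*ˡ e _)) (trans (∑-*ˡ e _) (cong (e ⊛_) (sym (∑-product f f)))))
           (trans (∑-cong (λ x → trans (∑-*ˡ (2 ⊛ e ⊕ 1) _) (cong ((2 ⊛ e ⊕ 1) ⊛_)
             (trans (∑-*ˡ (f x) _) (trans (cong (f x ⊛_) (∑-δ f x)) (0or1-square (f₁ x))))))) (trans (∑-*ˡ (2 ⊛ e ⊕ 1) f) (ℕ.*-comm (2 ⊛ e ⊕ 1) (∑ f)))) ⟩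
    e ⊛ (∑ f ⊛ ∑ f) ⊕ ∑ f ⊛ (2 ⊛ e ⊕ 1) ∎
    where
    open ℕ.≤-Reasoning
    δ-sym : ∀ x y → δ (x - y) ≡ δ (y - x)
    δ-sym x y with x ≟ᶜ y
    ... | yes refl = refl
    ... | no x≢y = trans (δ-nonzero (x≢y⇒x-y≢0 x≢y)) (sym (δ-nonzero (x≢y⇒x-y≢0 (x≢y ∘ sym))))
    factor : ∀ a b k → a ⊛ b ⊛ k ⊕ a ⊛ b ≡ a ⊛ b ⊛ (k ⊕ 1)
    factor = solve-∀
    distribute : ∀ a b e d → a ⊛ b ⊛ (e ⊕ d ⊛ (2 ⊛ e ⊕ 1)) ≡ e ⊛ (a ⊛ b) ⊕ (2 ⊛ e ⊕ 1) ⊛ (a ⊛ (b ⊛ d))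
    distribute = solve-∀
    pointwise : ∀ x y → f x ⊛ f y ⊛ ∑ (agree x y) ⊕ f x ⊛ f y ≤ e ⊛ (f x ⊛ f y) ⊕ (2 ⊛ e ⊕ 1) ⊛ (f x ⊛ (f y ⊛ δ (y - x)))
    pointwise x y = ℕ.≤-trans (ℕ.≤-reflexive (factor (f x) (f y) (∑ (agree x y))))
      (ℕ.≤-trans (ℕ.*-monoʳ-≤ (f x ⊛ f y) (agree-bound x y))
        (ℕ.≤-reflexive (trans (distribute (f x) (f y) e (δ (x - y))) (cong (λ d → e ⊛ (f x ⊛ f y) ⊕ (2 ⊛ e ⊕ 1) ⊛ (f x ⊛ (f y ⊛ d))) (δ-sym x y)))))

  -- Only z itself belongs to no class from z, so `T f z` is `m - f z`, and `f z` is its own square.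
  T-squares : ∀ f → (∀ x → 0or1 (f x)) → let m = ∑ f in
              ∑ (λ z → T f z ⊛ T f z) ⊕ 2 ⊛ (m ⊛ m) ≡ q ⊛ (m ⊛ m) ⊕ m
  T-squares f f₁ = begin
    ∑ (λ z → T f z ⊛ T f z) ⊕ 2 ⊛ (m ⊛ m)
      ≡⟨ cong (∑ (λ z → T f z ⊛ T f z) ⊕_) (trans (sym (ℕ.*-assoc 2 m m)) (sym (∑-*ˡ (2 ⊛ m) f))) ⟩
    ∑ (λ z → T f z ⊛ T f z) ⊕ ∑ (λ z → 2 ⊛ m ⊛ f z)
      ≡⟨ ∑-+ _ _ ⟨
    ∑ (λ z → T f z ⊛ T f z ⊕ 2 ⊛ m ⊛ f z)
      ≡⟨ ∑-cong (λ z → pointwise (T f z) (f z) m (T-total f z) (f₁ z)) ⟩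
    ∑ (λ z → m ⊛ m ⊕ f z)
      ≡⟨ trans (∑-+ _ f) (cong (_⊕ m) (∑-const (m ⊛ m))) ⟩
    q ⊛ (m ⊛ m) ⊕ m ∎
    where
    open ≡-Reasoning
    m = ∑ f
    pointwise : ∀ t k m → t ⊕ k ≡ m → 0or1 k → t ⊛ t ⊕ 2 ⊛ m ⊛ k ≡ m ⊛ m ⊕ k
    pointwise t _ _ refl (inj₁ refl) = at-0 t
      where
      at-0 : ∀ t → t ⊛ t ⊕ 2 ⊛ (t ⊕ 0) ⊛ 0 ≡ (t ⊕ 0) ⊛ (t ⊕ 0) ⊕ 0
      at-0 = solve-∀
    pointwise t _ _ refl (inj₂ refl) = at-1 t
      where
      at-1 : ∀ t → t ⊛ t ⊕ 2 ⊛ (t ⊕ 1) ⊛ 1 ≡ (t ⊕ 1) ⊛ (t ⊕ 1) ⊕ 1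
      at-1 = solve-∀

  -- The spread is three times the sum of the squares of the `N f r z` minus the square of `T f z`.
  -- By `pair-bound` the former sums to at most `3 (e - 1) m² + 3 (2 e + 1) m`, by `T-squares` the
  -- latter to `(q - 2) m² + m`. With `q = 3 e + 1` the terms in `q m²` cancel and `2 m q - 2 m²`
  -- remains.
  variance : ∀ f → (∀ x → 0or1 (f x)) → ∑ (S f) ≤ 2 ⊛ ∑ f ⊛ q
  variance f f₁ = linear (2 ⊛ (m ⊛ m)) (ℕ.*-monoʳ-≤ 3 (pair-bound f f₁)) (begin
    2 ⊛ m ⊛ q ⊕ 3 ⊛ (Q ⊕ m ⊛ m)                        ≡⟨ distribute m q Q ⟩
    3 ⊛ Q ⊕ (2 ⊛ m ⊛ q ⊕ 3 ⊛ (m ⊛ m))                  ≡⟨ cong (_⊕ (2 ⊛ m ⊛ q ⊕ 3 ⊛ (m ⊛ m))) sums ⟨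
    ∑ (S f) ⊕ ∑T² ⊕ (2 ⊛ m ⊛ q ⊕ 3 ⊛ (m ⊛ m))          ≡⟨ regroup (∑ (S f)) ∑T² m q ⟩
    ∑ (S f) ⊕ (∑T² ⊕ 2 ⊛ (m ⊛ m)) ⊕ (2 ⊛ m ⊛ q ⊕ m ⊛ m) ≡⟨ cong (λ k → ∑ (S f) ⊕ k ⊕ (2 ⊛ m ⊛ q ⊕ m ⊛ m)) (T-squares f f₁) ⟩
    ∑ (S f) ⊕ (q ⊛ (m ⊛ m) ⊕ m) ⊕ (2 ⊛ m ⊛ q ⊕ m ⊛ m)  ≡⟨ cong (λ k → ∑ (S f) ⊕ (k ⊛ (m ⊛ m) ⊕ m) ⊕ (2 ⊛ m ⊛ k ⊕ m ⊛ m)) q≡1+3e ⟩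
    ∑ (S f) ⊕ (suc (3 ⊛ e) ⊛ (m ⊛ m) ⊕ m) ⊕ (2 ⊛ m ⊛ suc (3 ⊛ e) ⊕ m ⊛ m) ≡⟨ final (∑ (S f)) e m ⟩
    ∑ (S f) ⊕ 3 ⊛ (e ⊛ (m ⊛ m) ⊕ m ⊛ (2 ⊛ e ⊕ 1)) ⊕ 2 ⊛ (m ⊛ m) ∎)
    where
    open ≡-Reasoning
    m = ∑ f
    Q = ∑ (λ z → ∑₃ (λ r → N f r z ⊛ N f r z))
    ∑T² = ∑ (λ z → T f z ⊛ T f z)
    sums : ∑ (S f) ⊕ ∑T² ≡ 3 ⊛ Q
    sums = trans (sym (∑-+ _ _)) (trans (∑-cong (λ z → spread-identity (N f 0F z) (N f 1F z) (N f 2F z))) (∑-*ˡ 3 _))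
    distribute : ∀ m q Q → 2 ⊛ m ⊛ q ⊕ 3 ⊛ (Q ⊕ m ⊛ m) ≡ 3 ⊛ Q ⊕ (2 ⊛ m ⊛ q ⊕ 3 ⊛ (m ⊛ m))
    distribute = solve-∀
    regroup : ∀ s t m q → s ⊕ t ⊕ (2 ⊛ m ⊛ q ⊕ 3 ⊛ (m ⊛ m)) ≡ s ⊕ (t ⊕ 2 ⊛ (m ⊛ m)) ⊕ (2 ⊛ m ⊛ q ⊕ m ⊛ m)
    regroup = solve-∀
    final : ∀ s e m → s ⊕ (suc (3 ⊛ e) ⊛ (m ⊛ m) ⊕ m) ⊕ (2 ⊛ m ⊛ suc (3 ⊛ e) ⊕ m ⊛ m) ≡
                      s ⊕ 3 ⊛ (e ⊛ (m ⊛ m) ⊕ m ⊛ (2 ⊛ e ⊕ 1)) ⊕ 2 ⊛ (m ⊛ m)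
    final = solve-∀

  N-deviation : ∀ f r z → ∃ λ u → T f z ≤ 3 ⊛ N f r z ⊕ u × u ⊛ u ≤ 2 ⊛ S f z
  N-deviation f 0F z = deviation (N f 0F z) (N f 1F z) (N f 2F z)
  N-deviation f 1F z = let u , T≤ , u² = deviation (N f 1F z) (N f 2F z) (N f 0F z) in
    u , ℕ.≤-trans (ℕ.≤-reflexive (rotate (N f 0F z) _ _)) T≤ , ℕ.≤-trans u² (ℕ.*-monoʳ-≤ 2 (ℕ.≤-reflexive (sym (spread-rotate (N f 0F z) _ _))))
    where
    rotate : ∀ x y z → x ⊕ y ⊕ z ≡ y ⊕ z ⊕ x
    rotate = solve-∀
  N-deviation f 2F z = let u , T≤ , u² = deviation (N f 2F z) (N f 0F z) (N f 1F z) in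
    u , ℕ.≤-trans (ℕ.≤-reflexive (rotate (N f 0F z) _ _)) T≤ , ℕ.≤-trans u² (ℕ.*-monoʳ-≤ 2 (ℕ.≤-reflexive (spread-rotate (N f 2F z) _ _)))
    where
    rotate : ∀ x y z → x ⊕ y ⊕ z ≡ z ⊕ x ⊕ y
    rotate = solve-∀

-- Rainbow planes in large fields

_+≤_ : ∀ {a b c d} → a ≤ b → c ≤ d → a ⊕ c ≤ b ⊕ d
_+≤_ = ℕ.+-mono-≤
infixl 6 _+≤_

_×≤_ : ∀ {a b} k → a ≤ b → k ⊛ a ≤ k ⊛ b
k ×≤ le = ℕ.*-monoʳ-≤ k le
infixr 7 _×≤_

weaken : ∀ k {q} → 100000 ≤ q → {k≤ : True (k ℕ.≤? 100000)} → k ≤ q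
weaken k large {k≤} = ℕ.≤-trans (toWitness k≤) large

-- The expected value of N is about `q / 9`. Since `q ≥ 90000 = 150² · 4`, the error u is at most
-- `q / 150`, which leaves more than `q / 10`.
cyclotomic-estimate : ∀ {q e N T u} → q ≡ suc (3 ⊛ e) → 100000 ≤ q → e ≤ T ⊕ 1 → T ≤ 3 ⊛ N ⊕ u → u ⊛ u ≤ 4 ⊛ q →
                      q ⊕ 10 ≤ 10 ⊛ N
cyclotomic-estimate {e = e} {N} {T} {u} refl large e≤ T≤ u² = ℕ.*-cancelˡ-≤ 45
  (linear 0 (150 ×≤ e≤ +≤ 150 ×≤ T≤ +≤ scale-square 150 {u} {4} u² (weaken 90000 large) +≤ weaken 650 (ℕ.≤-trans large (ℕ.m≤m+n _ _)))
    (identity e N T u))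
  where
  identity : ∀ e N T u → 45 ⊛ (10 ⊛ N) ⊕ (150 ⊛ e ⊕ 150 ⊛ T ⊕ 150 ⊛ u ⊕ 650) ≡
    45 ⊛ (suc (3 ⊛ e) ⊕ 10) ⊕ (150 ⊛ (T ⊕ 1) ⊕ 150 ⊛ (3 ⊛ N ⊕ u) ⊕ suc (3 ⊛ e) ⊕ 4 ⊛ suc (3 ⊛ e)) ⊕ 0
  identity = solve-∀

-- Without errors X would be `q / 30`. The deviation u is at most `q / 61`, because
-- `61² · 24 = 89304`, and this lowers the bound to no less than `q / 36`.
candidates-estimate : ∀ {q ρ X u} → 100000 ≤ q → q ≤ 5 ⊛ ρ → ρ ≤ 6 ⊛ X ⊕ 2 ⊛ u ⊕ 5 → u ⊛ u ≤ 24 ⊛ q → q ≤ 36 ⊛ X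
candidates-estimate {q} {ρ} {X} {u} large q≤ ρ≤ u² = ℕ.*-cancelˡ-≤ 1830
  (linear 0 (2196 ×≤ q≤ +≤ 10980 ×≤ ρ≤ +≤ 360 ×≤ scale-square 61 {u} {24} u² (weaken 89304 large) +≤ 6 ×≤ weaken 9150 large)
    (identity q ρ X u))
  where
  identity : ∀ q ρ X u → 1830 ⊛ (36 ⊛ X) ⊕ (2196 ⊛ q ⊕ 10980 ⊛ ρ ⊕ 360 ⊛ (61 ⊛ u) ⊕ 6 ⊛ 9150) ≡
    1830 ⊛ q ⊕ (2196 ⊛ (5 ⊛ ρ) ⊕ 10980 ⊛ (6 ⊛ X ⊕ 2 ⊛ u ⊕ 5) ⊕ 360 ⊛ q ⊕ 6 ⊛ q) ⊕ 0
  identity = solve-∀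

-- This estimate dictates the size of q. Writing `m - 1 = u + w + t`, one has `3 y ≥ w + t` and
-- `3 z ≥ u + t`, whose product is at least `t (u + w + t)`. As `75² · 16 = 90000`, the sum `u + w`
-- is at most `q / 75`, so `t ≥ q / 72`, while `m - 1 ≥ q / 37`. Thus `y z ≤ 4 q` would imply
-- `q ≤ 4 · 9 · 72 · 37 = 95904`.
mixing-estimate : ∀ {q m y z u w} → 100000 ≤ q → q ≤ 36 ⊛ m → m ≤ 3 ⊛ y ⊕ u ⊕ 1 → m ≤ 3 ⊛ z ⊕ w ⊕ 1 →
                  u ⊛ u ⊕ w ⊛ w ≤ 8 ⊛ q → 4 ⊛ q < y ⊛ z
mixing-estimate {q} {zero}        large q≤ = contradiction (ℕ.≤-trans large q≤) λ ()
mixing-estimate {q} {suc zero}    large q≤ = contradiction (ℕ.≤-trans (weaken 37 large) q≤) (ℕ.<⇒≱ ℕ.≤-refl)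
mixing-estimate {q} {suc (suc M)} {y} {z} {u} {w} large q≤ y≤ z≤ u²+w² = ℕ.≰⇒> λ yz≤ → ℕ.<⇒≱ too-large (q*q≤ yz≤)
  where
  open ℕ.≤-Reasoning
  75[u+w]≤q : 75 ⊛ (u ⊕ w) ≤ q
  75[u+w]≤q = scale-square 75 {u ⊕ w} {16} (begin
    (u ⊕ w) ⊛ (u ⊕ w)    ≤⟨ square-sum u w ⟩
    2 ⊛ (u ⊛ u ⊕ w ⊛ w)  ≤⟨ 2 ×≤ u²+w² ⟩
    2 ⊛ (8 ⊛ q)          ≡⟨ ℕ.*-assoc 2 8 q ⟨
    16 ⊛ q               ∎) (weaken 90000 large)
  u+w≤ : u ⊕ w ≤ suc M
  u+w≤ = ℕ.*-cancelˡ-≤ 75 (linear (39 ⊛ M ⊕ 3) (75[u+w]≤q +≤ q≤) (identity M u w q))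
    where
    identity : ∀ M u w q → 75 ⊛ suc M ⊕ (75 ⊛ (u ⊕ w) ⊕ q) ≡ 75 ⊛ (u ⊕ w) ⊕ (q ⊕ 36 ⊛ suc (suc M)) ⊕ (39 ⊛ M ⊕ 3)
    identity = solve-∀
  t = suc M ℕ.∸ (u ⊕ w)
  M≡ : suc M ≡ u ⊕ w ⊕ t
  M≡ = sym (ℕ.m+[n∸m]≡n u+w≤)
  w+t≤ : w ⊕ t ≤ 3 ⊛ y
  w+t≤ = linear 0 y≤ (trans (cong (3 ⊛ y ⊕_) (cong suc M≡)) (identity u w t y))
    where
    identity : ∀ u w t y → 3 ⊛ y ⊕ suc (u ⊕ w ⊕ t) ≡ w ⊕ t ⊕ (3 ⊛ y ⊕ u ⊕ 1) ⊕ 0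
    identity = solve-∀
  u+t≤ : u ⊕ t ≤ 3 ⊛ z
  u+t≤ = linear 0 z≤ (trans (cong (3 ⊛ z ⊕_) (cong suc M≡)) (identity u w t z))
    where
    identity : ∀ u w t z → 3 ⊛ z ⊕ suc (u ⊕ w ⊕ t) ≡ u ⊕ t ⊕ (3 ⊛ z ⊕ w ⊕ 1) ⊕ 0
    identity = solve-∀
  q≤72t : q ≤ 72 ⊛ t
  q≤72t = ℕ.*-cancelˡ-≤ 25 (linear 0 (50 ×≤ q≤ +≤ 24 ×≤ 75[u+w]≤q +≤ weaken 1800 large)
    (trans (identity t q u w) (cong (λ k → 25 ⊛ q ⊕ (50 ⊛ (36 ⊛ suc k) ⊕ 24 ⊛ q ⊕ q) ⊕ 0) (sym M≡))))
    where
    identity : ∀ t q u w → 25 ⊛ (72 ⊛ t) ⊕ (50 ⊛ q ⊕ 24 ⊛ (75 ⊛ (u ⊕ w)) ⊕ 1800) ≡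
                           25 ⊛ q ⊕ (50 ⊛ (36 ⊛ suc (u ⊕ w ⊕ t)) ⊕ 24 ⊛ q ⊕ q) ⊕ 0
    identity = solve-∀
  q≤37M : q ≤ 37 ⊛ suc M
  q≤37M = ℕ.*-cancelˡ-≤ 36 (linear 0 (37 ×≤ q≤ +≤ weaken 1332 large) (identity M q))
    where
    identity : ∀ M q → 36 ⊛ (37 ⊛ suc M) ⊕ (37 ⊛ q ⊕ 1332) ≡ 36 ⊛ q ⊕ (37 ⊛ (36 ⊛ suc (suc M)) ⊕ q) ⊕ 0
    identity = solve-∀
  q*q≤ : y ⊛ z ≤ 4 ⊛ q → q ⊛ q ≤ 95904 ⊛ q
  q*q≤ yz≤ = begin
    q ⊛ q                                 ≤⟨ ℕ.*-mono-≤ q≤72t q≤37M ⟩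
    72 ⊛ t ⊛ (37 ⊛ suc M)                 ≡⟨ trans (cong (λ k → 72 ⊛ t ⊛ (37 ⊛ k)) M≡) (identity₁ t u w) ⟩
    2664 ⊛ (t ⊛ (u ⊕ w ⊕ t))              ≤⟨ 2664 ×≤ ℕ.m≤m+n (t ⊛ (u ⊕ w ⊕ t)) (u ⊛ w) ⟩
    2664 ⊛ (t ⊛ (u ⊕ w ⊕ t) ⊕ u ⊛ w)      ≡⟨ cong (2664 ⊛_) (identity₂ t u w) ⟩
    2664 ⊛ ((w ⊕ t) ⊛ (u ⊕ t))            ≤⟨ 2664 ×≤ ℕ.*-mono-≤ w+t≤ u+t≤ ⟩
    2664 ⊛ (3 ⊛ y ⊛ (3 ⊛ z))              ≡⟨ identity₃ y z ⟩
    23976 ⊛ (y ⊛ z)                       ≤⟨ 23976 ×≤ yz≤ ⟩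
    23976 ⊛ (4 ⊛ q)                       ≡⟨ ℕ.*-assoc 23976 4 q ⟨
    95904 ⊛ q                             ∎
    where
    identity₁ : ∀ t u w → 72 ⊛ t ⊛ (37 ⊛ (u ⊕ w ⊕ t)) ≡ 2664 ⊛ (t ⊛ (u ⊕ w ⊕ t))
    identity₁ = solve-∀
    identity₂ : ∀ t u w → t ⊛ (u ⊕ w ⊕ t) ⊕ u ⊛ w ≡ (w ⊕ t) ⊛ (u ⊕ t)
    identity₂ = solve-∀
    identity₃ : ∀ y z → 2664 ⊛ (3 ⊛ y ⊛ (3 ⊛ z)) ≡ 23976 ⊛ (y ⊛ z)
    identity₃ = solve-∀
  too-large : 95904 ⊛ q < q ⊛ q
  too-large = ℕ.*-monoˡ-< q {{ℕ.>-nonZero (weaken 1 large)}} (weaken 95905 large)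

next²≢ : ∀ r → next² r ≢ r
next²≢ 0F ()
next²≢ 1F ()
next²≢ 2F ()

next²≢next : ∀ r → next² r ≢ next r
next²≢next r = next≢ (next r)

not-third : ∀ {l i} → l ≢ i → i ≡ next l ⊎ i ≡ next² l
not-third {l} {i} = from-yes (all? λ l → all? λ i → ¬? (l ≟ i) →-dec ((i ≟ next l) ⊎-dec (i ≟ next² l))) l i

maximum : ∀ (m : Fin 3 → ℕ) → ∃ λ i → ∀ r → m r ≤ m i
maximum m with ℕ.≤-total (m 0F) (m 1F) | ℕ.≤-total (m 1F) (m 2F) | ℕ.≤-total (m 0F) (m 2F)
... | inj₁ a | inj₁ b | _      = 2F , λ { 0F → ℕ.≤-trans a b ; 1F → b ; 2F → ℕ.≤-refl }
... | inj₁ a | inj₂ b | _      = 1F , λ { 0F → a ; 1F → ℕ.≤-refl ; 2F → b }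
... | inj₂ a | _      | inj₁ d = 2F , λ { 0F → d ; 1F → ℕ.≤-trans a d ; 2F → ℕ.≤-refl }
... | inj₂ a | _      | inj₂ d = 0F , λ { 0F → ℕ.≤-refl ; 1F → a ; 2F → d }

module LargeField {q n : ℕ} (D : FiniteDomain q) (q≡1+6n : q ≡ suc (6 ⊛ n)) (large : 100000 ≤ q) where
  open Characters {q} {n} D q≡1+6n public

  -- Each class has at most e elements, being a set of roots of `X^e - a`; three classes fill the
  -- `3 e` nonzero elements, so all bounds are attained.
  class-size : ∀ r → ∑ (c r) ≡ e
  class-size r = ℕ.≤-antisym (upper r) (lower r)
    where
    upper : ∀ r → ∑ (c r) ≤ e
    upper r with support (c r) (c-0or1 r) | e≡suc
    ... | g , g-inj , g-class | k , e≡ = subst (∑ (c r) ≤_) (sym e≡)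
      (power-bound {k} (root r) g g-inj (λ j → subst (λ m → g j ^ m ≡ root r) e≡ (c-sound (g-class j))))
    total : ∑₃ (λ r → ∑ (c r)) ≡ 3 ⊛ e
    total = ℕ.suc-injective (begin
      suc (∑₃ (λ r → ∑ (c r)))              ≡⟨ ℕ.+-comm 1 _ ⟩
      ∑₃ (λ r → ∑ (c r)) ⊕ 1                ≡⟨ cong₂ _⊕_ (sym (∑-∑₃ (λ x r → c r x))) (sym (trans (∑-single δ 0# (λ _ → δ-nonzero)) (δ-zero refl))) ⟩
      ∑ (λ x → ∑₃ (λ r → c r x)) ⊕ ∑ δ      ≡⟨ ∑-+ _ δ ⟨
      ∑ (λ x → ∑₃ (λ r → c r x) ⊕ δ x)      ≡⟨ ∑-cong c-total ⟩
      ∑ (λ _ → 1)                           ≡⟨ trans (∑-const 1) (ℕ.*-identityʳ q) ⟩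
      q                                     ≡⟨ q≡1+3e ⟩
      suc (3 ⊛ e)                           ∎)
      where open ≡-Reasoning
    rotate₁ : ∀ x y z → x ⊕ (y ⊕ z) ≡ x ⊕ y ⊕ z
    rotate₁ = solve-∀
    rotate₂ : ∀ x y z → y ⊕ (x ⊕ z) ≡ x ⊕ y ⊕ z
    rotate₂ = solve-∀
    rotate₃ : ∀ x y z → z ⊕ (x ⊕ y) ≡ x ⊕ y ⊕ z
    rotate₃ = solve-∀
    triple : ∀ e → 3 ⊛ e ≡ e ⊕ (e ⊕ e) ⊕ 0
    triple = solve-∀
    lower : ∀ r → e ≤ ∑ (c r)
    lower 0F = linear 0 (upper 1F +≤ upper 2F) (trans (rotate₁ (∑ (c 0F)) (∑ (c 1F)) (∑ (c 2F))) (trans total (triple e)))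
    lower 1F = linear 0 (upper 0F +≤ upper 2F) (trans (rotate₂ (∑ (c 0F)) (∑ (c 1F)) (∑ (c 2F))) (trans total (triple e)))
    lower 2F = linear 0 (upper 0F +≤ upper 1F) (trans (rotate₃ (∑ (c 0F)) (∑ (c 1F)) (∑ (c 2F))) (trans total (triple e)))

  x+y-y≡x : ∀ x y → (x + y) - y ≡ x
  x+y-y≡x x y = trans (+-assoc x y (- y)) (trans (cong (x +_) (x-x≡0 y)) (+-identityʳ x))

  ∑-shift : ∀ f u → ∑ (λ x → f (x - u)) ≡ ∑ f
  ∑-shift f u = sym (∑-reindex f (_- u) (_+ u) (λ x → x+y-y≡x x u) (λ x → x-y+y≡x u x))

  N-scale : ∀ i r {t} z → c 0F t ≡ 1 → N (c i) r (t * z) ≡ N (c i) r z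
  N-scale i r {t} z ct≡1 = begin
    ∑ (λ x → c i x ⊛ c r (x - t * z))
      ≡⟨ ∑-reindex _ (t *_) (proj₁ (inverse t≢0) *_) (*-inverse-cancel t≢0) (inverse-*-cancel t≢0) ⟩
    ∑ (λ x → c i (t * x) ⊛ c r (t * x - t * z))
      ≡⟨ ∑-cong (λ x → cong₂ _⊛_ (c-scale i x ct≡1) (trans (cong (c r) (sym (x[y-z]≈xy-xz t x z))) (c-scale r (x - z) ct≡1))) ⟩
    ∑ (λ x → c i x ⊛ c r (x - z)) ∎
    where
    open ≡-Reasoning
    t≢0 = c-nonzero ct≡1

  -- S (c i) is constant on the classes, so each of its values away from 0 is bounded by its average.
  S-class : ∀ i {z} → z ≢ 0# → S (c i) z ≤ 2 ⊛ q
  S-class i {z} z≢0 = cancel e≡suc (begin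
    e ⊛ S (c i) z                            ≡⟨ cong (_⊛ S (c i) z) (class-size 0F) ⟨
    ∑ (c 0F) ⊛ S (c i) z                     ≡⟨ ∑-*ʳ (S (c i) z) (c 0F) ⟨
    ∑ (λ t → c 0F t ⊛ S (c i) z)             ≤⟨ ∑-mono-≤ pointwise ⟩
    ∑ (λ t → S (c i) (t * z))                ≡⟨ ∑-cong (λ t → cong (S (c i)) (*-comm t z)) ⟩
    ∑ (λ t → S (c i) (z * t))                ≡⟨ ∑-reindex (S (c i)) (z *_) (proj₁ (inverse z≢0) *_) (*-inverse-cancel z≢0) (inverse-*-cancel z≢0) ⟨
    ∑ (S (c i))                              ≤⟨ variance (c i) (c-0or1 i) ⟩
    2 ⊛ ∑ (c i) ⊛ q                          ≡⟨ cong (λ k → 2 ⊛ k ⊛ q) (class-size i) ⟩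
    2 ⊛ e ⊛ q                                ≡⟨ swap e q ⟩
    e ⊛ (2 ⊛ q)                              ∎)
    where
    open ℕ.≤-Reasoning
    swap : ∀ e q → 2 ⊛ e ⊛ q ≡ e ⊛ (2 ⊛ q)
    swap = solve-∀
    cancel : ∀ {k l} → (∃ λ m → e ≡ suc m) → e ⊛ k ≤ e ⊛ l → k ≤ l
    cancel {k} {l} (m , e≡) le = ℕ.*-cancelˡ-≤ (suc m) (subst (λ e → e ⊛ k ≤ e ⊛ l) e≡ le)
    pointwise : ∀ t → c 0F t ⊛ S (c i) z ≤ S (c i) (t * z)
    pointwise t with c-0or1 0F t
    ... | inj₁ ct≡0 = ℕ.≤-trans (ℕ.≤-reflexive (cong (_⊛ S (c i) z) ct≡0)) z≤n
    ... | inj₂ ct≡1 = ℕ.≤-reflexive (trans (cong (_⊛ S (c i) z) ct≡1) (trans (ℕ.*-identityˡ _)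
      (sym (cong₂ (λ a (b , d) → spread a b d) (N-scale i 0F z ct≡1) (cong₂ _,_ (N-scale i 1F z ct≡1) (N-scale i 2F z ct≡1))))))

  -- After translation by u the sum is a cyclotomic number of order 3, the value of `N (c i) j` at
  -- `v - u`; its deviation is bounded pointwise by `S-class`. The surplus 10 is spent in
  -- `avoid-size`.
  cyclotomic : ∀ i j {u v} → u ≢ v → q ⊕ 10 ≤ 10 ⊛ ∑ (λ x → c i (x - u) ⊛ c j (x - v))
  cyclotomic i j {u} {v} u≢v = subst (λ k → q ⊕ 10 ≤ 10 ⊛ k) shifted
    (cyclotomic-estimate {N = N (c i) j z} {T (c i) z} {proj₁ dev} q≡1+3e large
      (ℕ.≤-trans (ℕ.≤-reflexive (sym (class-size i))) (T≥ (c i) z (c-0or1 i)))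
      (proj₁ (proj₂ dev))
      (ℕ.≤-trans (proj₂ (proj₂ dev)) (ℕ.≤-trans (2 ×≤ S-class i z≢0) (ℕ.≤-reflexive (sym (ℕ.*-assoc 2 2 q))))))
    where
    z = v - u
    z≢0 : z ≢ 0#
    z≢0 = x≢y⇒x-y≢0 (u≢v ∘ sym)
    dev = N-deviation (c i) j z
    telescope : ∀ x → (x - u) - (v - u) ≡ x - v
    telescope x = trans (cong (x - u +_) (-[x-y]≡y-x v u)) (trans (sym (+-assoc (x - u) u (- v))) (cong (_- v) (x-y+y≡x u x)))
    shifted : N (c i) j z ≡ ∑ (λ x → c i (x - u) ⊛ c j (x - v))
    shifted = trans (sym (∑-shift (λ x → c i x ⊛ c j (x - z)) u)) (∑-cong (λ x → cong (λ y → c i (x - u) ⊛ c j y) (telescope x)))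

  triangle-rotate : ∀ {x y z} → IsTriangle x y z → IsTriangle y z x
  triangle-rotate (p , q , r) = q , r , p

  triangle-swap : ∀ {x y z} → IsTriangle x y z → IsTriangle x z y
  triangle-swap {x} {y} {z} (p , q , r) =
    (λ eq → r (trans (minus-^e x y) (trans (sym eq) (minus-^e z y)))) ,
    (λ eq → q (trans (minus-^e z x) (trans (sym eq) (minus-^e y x)))) ,
    (λ eq → p (trans (minus-^e y z) (trans (sym eq) (minus-^e x z))))

  triangle : ∀ {i j k x y z} → c i (y - z) ≡ 1 → c j (z - x) ≡ 1 → c k (x - y) ≡ 1 → i ≢ j → j ≢ k → k ≢ i → IsTriangle x y z
  triangle ci cj ck i≢j j≢k k≢i =
    (λ eq → i≢j (root-injective (trans (sym (c-sound ci)) (trans eq (c-sound cj))))) ,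
    (λ eq → j≢k (root-injective (trans (sym (c-sound cj)) (trans eq (c-sound ck))))) ,
    (λ eq → k≢i (root-injective (trans (sym (c-sound ck)) (trans eq (c-sound ci)))))

  c-flip : ∀ {r x y} → c r (x - y) ≡ 1 → c r (y - x) ≡ 1
  c-flip {r} {x} {y} eq = trans (c-minus r y x) eq

  -- f and g restrict the two ways of coloring the sides from x of a triangle x, u, v, where u - v has class l.
  apex : (f g : Carrier → ℕ) → Fin 3 → Carrier → Carrier → ℕ
  apex f g l v x = f x ⊛ c (next² l) (x - v) ⊕ g x ⊛ c (next l) (x - v)

  apex-0or1 : ∀ {f g} l v → (∀ x → 0or1 (f x)) → (∀ x → 0or1 (g x)) → (∀ x → f x ⊛ g x ≡ 0) → ∀ x → 0or1 (apex f g l v x)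
  apex-0or1 {f} {g} l v f₁ g₁ fg≡0 x = 0or1-+ (0or1-* (f₁ x) (c-0or1 _ _)) (0or1-* (g₁ x) (c-0or1 _ _))
    (trans (*-interchange (f x) _ (g x) _) (cong (_⊛ (c (next² l) (x - v) ⊛ c (next l) (x - v))) (fg≡0 x)))

  apex-triangle : ∀ {f g l u v x} → (f x ≡ 1 → c (next l) (x - u) ≡ 1) → (g x ≡ 1 → c (next² l) (x - u) ≡ 1) →
                  c l (u - v) ≡ 1 → apex f g l v x ≡ 1 → IsTriangle x u v
  apex-triangle {f} {g} {l} {u} {v} {x} f-class g-class cl eq with +≡1 {f x ⊛ c (next² l) (x - v)} eq
  ... | inj₁ fx = let fx≡1 , cv = *≡1 {f x} fx in
    triangle cl (c-flip cv) (f-class fx≡1) (next²≢ l ∘ sym) (next²≢next l) (next≢ l)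
  ... | inj₂ gx = let gx≡1 , cv = *≡1 {g x} gx in
    triangle cl (c-flip cv) (g-class gx≡1) (next≢ l ∘ sym) (next²≢next l ∘ sym) (next²≢ l)

  pairSet : Fin 3 → Carrier → Carrier → Carrier → ℕ
  pairSet l u = apex (λ x → c (next l) (x - u)) (λ x → c (next² l) (x - u)) l

  pairSet-0or1 : ∀ l u v x → 0or1 (pairSet l u v x)
  pairSet-0or1 l u v = apex-0or1 l v (λ x → c-0or1 _ _) (λ x → c-0or1 _ _) (λ x → c-disjoint (x - u) (next²≢next l ∘ sym))

  pairSet-triangle : ∀ {l u v x} → c l (u - v) ≡ 1 → pairSet l u v x ≡ 1 → IsTriangle x u v
  pairSet-triangle {l} {u} = apex-triangle {λ x → c (next l) (x - u)} {λ x → c (next² l) (x - u)} (λ eq → eq) (λ eq → eq)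

  pairSet-size : ∀ l {u v} → u ≢ v → q ≤ 5 ⊛ ∑ (pairSet l u v)
  pairSet-size l {u} {v} u≢v = ℕ.*-cancelˡ-≤ 2 (linear 20 (cyclotomic (next l) (next² l) u≢v +≤ cyclotomic (next² l) (next l) u≢v)
    (trans (cong (λ k → 2 ⊛ (5 ⊛ k) ⊕ (q ⊕ 10 ⊕ (q ⊕ 10))) (∑-+ A B)) (identity (∑ A) (∑ B) q)))
    where
    A = λ x → c (next l) (x - u) ⊛ c (next² l) (x - v)
    B = λ x → c (next² l) (x - u) ⊛ c (next l) (x - v)
    identity : ∀ a b q → 2 ⊛ (5 ⊛ (a ⊕ b)) ⊕ (q ⊕ 10 ⊕ (q ⊕ 10)) ≡ 2 ⊛ q ⊕ (10 ⊛ a ⊕ 10 ⊛ b) ⊕ 20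
    identity = solve-∀

  module Cut (R : Carrier → ℕ) (R₁ : ∀ x → 0or1 (R x)) (a : Carrier) where
    part : Fin 3 → Carrier → ℕ
    part r x = R x ⊛ c r (x - a)

    part-0or1 : ∀ r x → 0or1 (part r x)
    part-0or1 r x = 0or1-* (R₁ x) (c-0or1 r (x - a))

    dominant : Fin 3
    dominant = proj₁ (maximum (λ r → ∑ (part r)))

    -- All three parts are included because the two that matter depend on the class of `d - a`,
    -- which is unknown until d has been chosen.
    weight : Carrier → ℕ
    weight d = ∑₃ (λ r → S (part r) d)

    weight-total : ∑ weight ≤ 2 ⊛ ∑ R ⊛ q
    weight-total = begin
      ∑ weight                            ≡⟨ ∑-∑₃ (λ d r → S (part r) d) ⟩
      ∑₃ (λ r → ∑ (S (part r)))           ≤⟨ var 0F +≤ var 1F +≤ var 2F ⟩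
      ∑₃ (λ r → 2 ⊛ ∑ (part r) ⊛ q)       ≡⟨ factor (∑ (part 0F)) (∑ (part 1F)) (∑ (part 2F)) q ⟩
      2 ⊛ T R a ⊛ q                       ≤⟨ ℕ.*-monoˡ-≤ q (2 ×≤ ℕ.≤-trans (ℕ.m≤m+n (T R a) (R a)) (ℕ.≤-reflexive (T-total R a))) ⟩
      2 ⊛ ∑ R ⊛ q                         ∎
      where
      open ℕ.≤-Reasoning
      var : ∀ r → ∑ (S (part r)) ≤ 2 ⊛ ∑ (part r) ⊛ q
      var r = variance (part r) (part-0or1 r)
      factor : ∀ x y z q → 2 ⊛ x ⊛ q ⊕ 2 ⊛ y ⊛ q ⊕ 2 ⊛ z ⊛ q ≡ 2 ⊛ (x ⊕ y ⊕ z) ⊛ q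
      factor = solve-∀

    candidates : Fin 3 → Carrier → Carrier → ℕ
    candidates l = apex (part (next l)) (part (next² l)) l

    candidates-0or1 : ∀ l d x → 0or1 (candidates l d x)
    candidates-0or1 l d = apex-0or1 l d (part-0or1 _) (part-0or1 _) λ x →
      trans (*-interchange (R x) (c (next l) (x - a)) (R x) (c (next² l) (x - a)))
        (trans (cong (R x ⊛ R x ⊛_) (c-disjoint (x - a) (next²≢next l ∘ sym))) (ℕ.*-zeroʳ (R x ⊛ R x)))

    candidates-⊆ : ∀ {l d x} → candidates l d x ≡ 1 → R x ≡ 1
    candidates-⊆ {l} {d} {x} eq with +≡1 {part (next l) x ⊛ c (next² l) (x - d)} eq
    ... | inj₁ eq₁ = proj₁ (*≡1 {R x} (proj₁ (*≡1 {part (next l) x} eq₁)))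
    ... | inj₂ eq₂ = proj₁ (*≡1 {R x} (proj₁ (*≡1 {part (next² l) x} eq₂)))

    candidates-triangle : ∀ {l d x} → c l (d - a) ≡ 1 → candidates l d x ≡ 1 → IsTriangle x a d
    candidates-triangle {l} {d} {x} cl = apex-triangle {part (next l)} {part (next² l)}
      (λ eq → proj₂ (*≡1 {R x} eq)) (λ eq → proj₂ (*≡1 {R x} eq)) (c-flip cl)

    -- The dominant part is one of the two parts outside l, so these hold at least half of R up to
    -- one point. Seen from d, about a third of each has the class that completes the triangle: in
    -- total a sixth of R, less the deviation that the weight controls.
    candidates-size : ∀ {l d} → l ≢ dominant → weight d ≤ 6 ⊛ q → q ≤ 5 ⊛ ∑ R → q ≤ 36 ⊛ ∑ (candidates l d)
    candidates-size {l} {d} l≢ weight≤ q≤ = subst (λ k → q ≤ 36 ⊛ k) (sym (∑-+ (λ x → f x ⊛ c (next² l) (x - d)) (λ x → g x ⊛ c (next l) (x - d))))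
      (candidates-estimate {X = N f (next² l) d ⊕ N g (next l) d} {u ⊕ w} large q≤ ρ≤ uw²)
      where
      open ℕ.≤-Reasoning
      f = part (next l)
      g = part (next² l)
      u = proj₁ (N-deviation f (next² l) d)
      w = proj₁ (N-deviation g (next l) d)
      Tf≤ = proj₁ (proj₂ (N-deviation f (next² l) d))
      Tg≤ = proj₁ (proj₂ (N-deviation g (next l) d))
      two-parts : ∀ (s : Fin 3 → ℕ) l → s (next l) ⊕ s (next² l) ⊕ s l ≡ ∑₃ s
      two-parts s 0F = rotate (s 0F) (s 1F) (s 2F)
        where
        rotate : ∀ x y z → y ⊕ z ⊕ x ≡ x ⊕ y ⊕ z
        rotate = solve-∀
      two-parts s 1F = rotate (s 0F) (s 1F) (s 2F)
        where
        rotate : ∀ x y z → z ⊕ x ⊕ y ≡ x ⊕ y ⊕ z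
        rotate = solve-∀
      two-parts s 2F = refl
      uw² : (u ⊕ w) ⊛ (u ⊕ w) ≤ 24 ⊛ q
      uw² = begin
        (u ⊕ w) ⊛ (u ⊕ w)            ≤⟨ square-sum u w ⟩
        2 ⊛ (u ⊛ u ⊕ w ⊛ w)          ≤⟨ 2 ×≤ (proj₂ (proj₂ (N-deviation f (next² l) d)) +≤ proj₂ (proj₂ (N-deviation g (next l) d))) ⟩
        2 ⊛ (2 ⊛ S f d ⊕ 2 ⊛ S g d)  ≡⟨ factor (S f d) (S g d) ⟩
        4 ⊛ (S f d ⊕ S g d)          ≤⟨ 4 ×≤ ℕ.m≤m+n (S f d ⊕ S g d) (S (part l) d) ⟩
        4 ⊛ (S f d ⊕ S g d ⊕ S (part l) d) ≡⟨ cong (4 ⊛_) (two-parts (λ r → S (part r) d) l) ⟩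
        4 ⊛ weight d                 ≤⟨ 4 ×≤ weight≤ ⟩
        4 ⊛ (6 ⊛ q)                  ≡⟨ ℕ.*-assoc 4 6 q ⟨
        24 ⊛ q                       ∎
        where
        factor : ∀ a b → 2 ⊛ (2 ⊛ a ⊕ 2 ⊛ b) ≡ 4 ⊛ (a ⊕ b)
        factor = solve-∀
      small : ∑ (part l) ≤ ∑ f ⊕ ∑ g
      small with not-third l≢
      ... | inj₁ eq = ℕ.≤-trans (subst (λ i → ∑ (part l) ≤ ∑ (part i)) eq (proj₂ (maximum (λ r → ∑ (part r))) l)) (ℕ.m≤m+n _ _)
      ... | inj₂ eq = ℕ.≤-trans (subst (λ i → ∑ (part l) ≤ ∑ (part i)) eq (proj₂ (maximum (λ r → ∑ (part r))) l)) (ℕ.m≤n+m _ _)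
      ∑R≤ : ∑ R ≤ ∑ f ⊕ ∑ g ⊕ ∑ (part l) ⊕ 1
      ∑R≤ = ℕ.≤-trans (T≥ R a R₁) (ℕ.≤-reflexive (cong (_⊕ 1) (sym (two-parts (λ r → ∑ (part r)) l))))
      ρ≤ : ∑ R ≤ 6 ⊛ (N f (next² l) d ⊕ N g (next l) d) ⊕ 2 ⊛ (u ⊕ w) ⊕ 5
      ρ≤ = linear 0 (∑R≤ +≤ small +≤ 2 ×≤ T≥ f d (part-0or1 _) +≤ 2 ×≤ T≥ g d (part-0or1 _) +≤ 2 ×≤ Tf≤ +≤ 2 ×≤ Tg≤)
        (identity (∑ R) (∑ f) (∑ g) (∑ (part l)) (T f d) (T g d) (N f (next² l) d) (N g (next l) d) u w)
        where
        identity : ∀ r f g p tf tg nf ng u w →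
          6 ⊛ (nf ⊕ ng) ⊕ 2 ⊛ (u ⊕ w) ⊕ 5 ⊕ (r ⊕ p ⊕ 2 ⊛ f ⊕ 2 ⊛ g ⊕ 2 ⊛ tf ⊕ 2 ⊛ tg) ≡
          r ⊕ (f ⊕ g ⊕ p ⊕ 1 ⊕ (f ⊕ g) ⊕ 2 ⊛ (tf ⊕ 1) ⊕ 2 ⊛ (tg ⊕ 1) ⊕ 2 ⊛ (3 ⊛ nf ⊕ u) ⊕ 2 ⊛ (3 ⊛ ng ⊕ w)) ⊕ 0
        identity = solve-∀

  ∑-positive : ∀ h → 1 ≤ ∑ h → ∃ λ y → 1 ≤ h y
  ∑-positive h 1≤ with exists? (λ y → 1 ℕ.≤? h y)
  ... | inj₁ found = found
  ... | inj₂ none  = contradiction (ℕ.≤-trans 1≤ (ℕ.≤-reflexive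
    (trans (∑-cong (λ y → ℕ.n<1⇒n≡0 (ℕ.≰⇒> (none y)))) (trans (∑-const 0) (ℕ.*-zeroʳ q))))) λ ()

  -- If no difference had class r, every z in g would have `N f r z ≡ 0`, and `T f z` would be all
  -- of `∑ f` by disjointness. Then `(∑ f)²` is at most twice the spread at each such z, and summing
  -- over g contradicts the variance bound as soon as `∑ f · ∑ g > 4 q`.
  mixing : ∀ (f g : Carrier → ℕ) → (∀ x → 0or1 (f x)) → (∀ x → 0or1 (g x)) → (∀ x → f x ⊛ g x ≡ 0) →
           4 ⊛ q < ∑ f ⊛ ∑ g → ∀ r → ∃ λ y → ∃ λ z → f y ≡ 1 × g z ≡ 1 × c r (y - z) ≡ 1
  mixing f g f₁ g₁ fg≡0 4q< r with exists? (λ z → (g z ℕ.≟ 1) ×-dec (1 ℕ.≤? N f r z))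
  ... | inj₁ (z , gz≡1 , 1≤N) = let y , 1≤ = ∑-positive (λ y → f y ⊛ c r (y - z)) 1≤N
                                    fy , cy = *≡1 {f y} (positive (0or1-* (f₁ y) (c-0or1 r (y - z))) 1≤)
                                in y , z , fy , gz≡1 , cy
    where
    positive : ∀ {k} → 0or1 k → 1 ≤ k → k ≡ 1
    positive (inj₁ refl) ()
    positive (inj₂ refl) _ = refl
  ... | inj₂ none = contradiction 4q< (ℕ.≤⇒≯ (cancel (∑ f) refl))
    where
    open ℕ.≤-Reasoning
    F = ∑ f
    G = ∑ g
    pointwise : ∀ z → g z ⊛ (F ⊛ F) ≤ 2 ⊛ S f z
    pointwise z with g₁ z
    ... | inj₁ gz≡0 = ℕ.≤-trans (ℕ.≤-reflexive (cong (_⊛ (F ⊛ F)) gz≡0)) z≤n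
    ... | inj₂ gz≡1 = begin
      g z ⊛ (F ⊛ F)   ≡⟨ trans (cong (_⊛ (F ⊛ F)) gz≡1) (ℕ.*-identityˡ (F ⊛ F)) ⟩
      F ⊛ F           ≤⟨ ℕ.*-mono-≤ F≤u F≤u ⟩
      u ⊛ u           ≤⟨ proj₂ (proj₂ (N-deviation f r z)) ⟩
      2 ⊛ S f z       ∎
      where
      u = proj₁ (N-deviation f r z)
      fz≡0 : f z ≡ 0
      fz≡0 = trans (sym (ℕ.*-identityʳ (f z))) (trans (cong (f z ⊛_) (sym gz≡1)) (fg≡0 z))
      N≡0 : N f r z ≡ 0
      N≡0 = ℕ.n<1⇒n≡0 (ℕ.≰⇒> λ 1≤N → none z (gz≡1 , 1≤N))
      F≤u : F ≤ u
      F≤u = begin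
        F                  ≡⟨ T-total f z ⟨
        T f z ⊕ f z        ≡⟨ trans (cong (T f z ⊕_) fz≡0) (ℕ.+-identityʳ (T f z)) ⟩
        T f z              ≤⟨ proj₁ (proj₂ (N-deviation f r z)) ⟩
        3 ⊛ N f r z ⊕ u    ≡⟨ cong (λ k → 3 ⊛ k ⊕ u) N≡0 ⟩
        u                  ∎
    F[FG]≤ : F ⊛ (F ⊛ G) ≤ F ⊛ (4 ⊛ q)
    F[FG]≤ = begin
      F ⊛ (F ⊛ G)                     ≡⟨ swap₁ F G ⟩
      G ⊛ (F ⊛ F)                     ≡⟨ ∑-*ʳ (F ⊛ F) g ⟨
      ∑ (λ z → g z ⊛ (F ⊛ F))         ≤⟨ ∑-mono-≤ pointwise ⟩
      ∑ (λ z → 2 ⊛ S f z)             ≡⟨ ∑-*ˡ 2 (S f) ⟩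
      2 ⊛ ∑ (S f)                     ≤⟨ 2 ×≤ variance f f₁ ⟩
      2 ⊛ (2 ⊛ F ⊛ q)                 ≡⟨ swap₂ F q ⟩
      F ⊛ (4 ⊛ q)                     ∎
      where
      swap₁ : ∀ F G → F ⊛ (F ⊛ G) ≡ G ⊛ (F ⊛ F)
      swap₁ = solve-∀
      swap₂ : ∀ F q → 2 ⊛ (2 ⊛ F ⊛ q) ≡ F ⊛ (4 ⊛ q)
      swap₂ = solve-∀
    cancel : ∀ k → k ≡ F → F ⊛ G ≤ 4 ⊛ q
    cancel zero    eq = ℕ.≤-trans (ℕ.≤-reflexive (cong (_⊛ G) (sym eq))) z≤n
    cancel (suc k) eq = ℕ.*-cancelˡ-≤ (suc k) (subst (λ j → j ⊛ (F ⊛ G) ≤ j ⊛ (4 ⊛ q)) (sym eq) F[FG]≤)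

  avoid : Fin 3 → Carrier → Carrier → ℕ
  avoid i a d = c (next i) (d - a) ⊕ c (next² i) (d - a)

  avoid-0or1 : ∀ i a d → 0or1 (avoid i a d)
  avoid-0or1 i a d = 0or1-+ (c-0or1 _ _) (c-0or1 _ _) (c-disjoint (d - a) (next²≢next i ∘ sym))

  avoid-class : ∀ {i a d} → avoid i a d ≡ 1 → ∃ λ l → l ≢ i × c l (d - a) ≡ 1
  avoid-class {i} {a} {d} eq with +≡1 {c (next i) (d - a)} eq
  ... | inj₁ eq₁ = next i , next≢ i , eq₁
  ... | inj₂ eq₂ = next² i , next²≢ i , eq₂

  avoid-complement : ∀ i a d → avoid i a d ⊕ (c i (d - a) ⊕ δ (d - a)) ≡ 1
  avoid-complement i a d = trans (rotate i (λ r → c r (d - a)) (δ (d - a))) (c-total (d - a))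
    where
    rotate₀ : ∀ x y z k → y ⊕ z ⊕ (x ⊕ k) ≡ x ⊕ y ⊕ z ⊕ k
    rotate₀ = solve-∀
    rotate₁ : ∀ x y z k → z ⊕ x ⊕ (y ⊕ k) ≡ x ⊕ y ⊕ z ⊕ k
    rotate₁ = solve-∀
    rotate₂ : ∀ x y z k → x ⊕ y ⊕ (z ⊕ k) ≡ x ⊕ y ⊕ z ⊕ k
    rotate₂ = solve-∀
    rotate : ∀ i (s : Fin 3 → ℕ) k → s (next i) ⊕ s (next² i) ⊕ (s i ⊕ k) ≡ ∑₃ s ⊕ k
    rotate 0F s k = rotate₀ (s 0F) (s 1F) (s 2F) k
    rotate 1F s k = rotate₁ (s 0F) (s 1F) (s 2F) k
    rotate 2F s k = rotate₂ (s 0F) (s 1F) (s 2F) k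

  -- Each factor excludes one class and the point itself, `e + 1` points, which makes `q + 2` in all
  -- and would leave nothing. The overlaps rescue the count: two of them, of at least
  -- `(q + 10) / 10` points each, give back `q / 5 + 2`.
  avoid-size : ∀ i j k {u v w} → u ≢ v → v ≢ w → q ≤ 5 ⊛ ∑ (λ d → avoid i u d ⊛ avoid j v d ⊛ avoid k w d)
  avoid-size i j k {u} {v} {w} u≢v v≢w = ℕ.*-cancelˡ-≤ 2
    (linear 0 (cyclotomic i j u≢v +≤ cyclotomic j k v≢w +≤ 10 ×≤ summed)
      (trans (identity ∑D q ∑₁₂ ∑₂₃) (cong (λ m → 2 ⊛ q ⊕ (10 ⊛ ∑₁₂ ⊕ 10 ⊛ ∑₂₃ ⊕ 10 ⊛ (∑D ⊕ m)) ⊕ 0) (trans (cong (_⊕ 2) q≡1+3e) (triple e)))))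
    where
    open ℕ.≤-Reasoning
    A : Fin 3 → Carrier → Carrier → ℕ
    A i a d = c i (d - a) ⊕ δ (d - a)
    ∑A : ∀ i a → ∑ (A i a) ≡ e ⊕ 1
    ∑A i a = trans (∑-+ _ _) (cong₂ _⊕_ (trans (∑-shift (c i) a) (class-size i))
      (trans (∑-shift δ a) (trans (∑-single δ 0# (λ _ → δ-nonzero)) (δ-zero refl))))
    D′ : Carrier → ℕ
    D′ d = avoid i u d ⊛ avoid j v d ⊛ avoid k w d
    ∑D = ∑ D′
    ∑₁₂ = ∑ (λ d → c i (d - u) ⊛ c j (d - v))
    ∑₂₃ = ∑ (λ d → c j (d - v) ⊛ c k (d - w))
    -- An inclusion-exclusion bound with the overlaps along the path 1 - 2 - 3 only: a point in j >
    -- 0 of the excluded sets lies in at most j - 1 of these overlaps.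
    bonferroni : ∀ {p₁ p₂ p₃ a₁ a₂ a₃} → 0or1 p₁ → 0or1 p₂ → 0or1 p₃ → p₁ ⊕ a₁ ≡ 1 → p₂ ⊕ a₂ ≡ 1 → p₃ ⊕ a₃ ≡ 1 →
                 1 ⊕ a₁ ⊛ a₂ ⊕ a₂ ⊛ a₃ ≤ p₁ ⊛ p₂ ⊛ p₃ ⊕ (a₁ ⊕ a₂ ⊕ a₃)
    bonferroni (inj₁ refl) (inj₁ refl) (inj₁ refl) refl refl refl = ℕ.≤-refl
    bonferroni (inj₁ refl) (inj₁ refl) (inj₂ refl) refl refl refl = ℕ.≤-refl
    bonferroni (inj₁ refl) (inj₂ refl) (inj₁ refl) refl refl refl = ℕ.n≤1+n 1
    bonferroni (inj₁ refl) (inj₂ refl) (inj₂ refl) refl refl refl = ℕ.≤-refl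
    bonferroni (inj₂ refl) (inj₁ refl) (inj₁ refl) refl refl refl = ℕ.≤-refl
    bonferroni (inj₂ refl) (inj₁ refl) (inj₂ refl) refl refl refl = ℕ.≤-refl
    bonferroni (inj₂ refl) (inj₂ refl) (inj₁ refl) refl refl refl = ℕ.≤-refl
    bonferroni (inj₂ refl) (inj₂ refl) (inj₂ refl) refl refl refl = ℕ.≤-refl
    c≤A : ∀ i a d → c i (d - a) ≤ A i a d
    c≤A i a d = ℕ.m≤m+n (c i (d - a)) (δ (d - a))
    pointwise : ∀ d → 1 ⊕ c i (d - u) ⊛ c j (d - v) ⊕ c j (d - v) ⊛ c k (d - w) ≤ D′ d ⊕ (A i u d ⊕ A j v d ⊕ A k w d)
    pointwise d = ℕ.≤-trans (ℕ.≤-refl {1} +≤ ℕ.*-mono-≤ (c≤A i u d) (c≤A j v d) +≤ ℕ.*-mono-≤ (c≤A j v d) (c≤A k w d))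
      (bonferroni (avoid-0or1 i u d) (avoid-0or1 j v d) (avoid-0or1 k w d) (avoid-complement i u d) (avoid-complement j v d) (avoid-complement k w d))
    summed : q ⊕ ∑₁₂ ⊕ ∑₂₃ ≤ ∑D ⊕ ((e ⊕ 1) ⊕ (e ⊕ 1) ⊕ (e ⊕ 1))
    summed = begin
      q ⊕ ∑₁₂ ⊕ ∑₂₃
        ≡⟨ cong (λ m → m ⊕ ∑₁₂ ⊕ ∑₂₃) (trans (∑-const 1) (ℕ.*-identityʳ q)) ⟨
      ∑ (λ _ → 1) ⊕ ∑₁₂ ⊕ ∑₂₃
        ≡⟨ trans (∑-+ _ (λ d → c j (d - v) ⊛ c k (d - w))) (cong (_⊕ ∑₂₃) (∑-+ (λ _ → 1) (λ d → c i (d - u) ⊛ c j (d - v)))) ⟨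
      ∑ (λ d → 1 ⊕ c i (d - u) ⊛ c j (d - v) ⊕ c j (d - v) ⊛ c k (d - w))
        ≤⟨ ∑-mono-≤ pointwise ⟩
      ∑ (λ d → D′ d ⊕ (A i u d ⊕ A j v d ⊕ A k w d))
        ≡⟨ trans (∑-+ D′ _) (cong (∑D ⊕_) (trans (∑-+ _ (A k w)) (cong (_⊕ ∑ (A k w)) (∑-+ (A i u) (A j v))))) ⟩
      ∑D ⊕ (∑ (A i u) ⊕ ∑ (A j v) ⊕ ∑ (A k w))
        ≡⟨ cong (∑D ⊕_) (cong₂ _⊕_ (cong₂ _⊕_ (∑A i u) (∑A j v)) (∑A k w)) ⟩
      ∑D ⊕ ((e ⊕ 1) ⊕ (e ⊕ 1) ⊕ (e ⊕ 1)) ∎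
    triple : ∀ e → suc (3 ⊛ e) ⊕ 2 ≡ (e ⊕ 1) ⊕ (e ⊕ 1) ⊕ (e ⊕ 1)
    triple = solve-∀
    identity : ∀ D q a b → 2 ⊛ (5 ⊛ D) ⊕ ((q ⊕ 10) ⊕ (q ⊕ 10) ⊕ 10 ⊛ (q ⊕ a ⊕ b)) ≡
                           2 ⊛ q ⊕ (10 ⊛ a ⊕ 10 ⊛ b ⊕ 10 ⊛ (D ⊕ (q ⊕ 2))) ⊕ 0
    identity = solve-∀

  trimmedPairSet : ∀ {u v} → u ≢ v → ∀ {ρ} → (∀ x → q ≤ 5 ⊛ x → ρ ≤ x) →
                   ∃ λ R → (∀ x → 0or1 (R x)) × (∀ x → R x ≡ 1 → IsTriangle x u v) × ∑ R ≡ ρ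
  trimmedPairSet {u} {v} u≢v least =
    let l , cl = c-class (x≢y⇒x-y≢0 u≢v)
        R , R₁ , R⊆ , ∑R = ∑-trim (pairSet l u v) (pairSet-0or1 l u v) _ (least _ (pairSet-size l u≢v))
    in R , R₁ , (λ x Rx → pairSet-triangle cl (R⊆ x Rx)) , ∑R

  0≢-1 : 0# ≢ - 1#
  0≢-1 eq = 0≢1 (trans (sym -0≡0) (trans (cong -_ eq) (-‿involutive 1#)))

  rainbowPlane : ∃ IsRainbow
  rainbowPlane = plane (ceiling 4 q) (ceiling 35 q)
    where
    -- Three points that are distinct because the characteristic is odd; nothing else about them is
    -- used.
    a₁ = 0#
    a₂ = 1#
    a₃ = - 1#
    plane : (∃ λ ρ → q ≤ 5 ⊛ ρ × (∀ x → q ≤ 5 ⊛ x → ρ ≤ x)) → (∃ λ m → q ≤ 36 ⊛ m × (∀ x → q ≤ 36 ⊛ x → m ≤ x)) → ∃ IsRainbow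
    plane (ρ , q≤5ρ , ρ-least) (m , q≤36m , m-least) = choose-d (trimmedPairSet (x≢-x (0≢1 ∘ sym)) ρ-least) (trimmedPairSet 0≢-1 ρ-least) (trimmedPairSet 0≢1 ρ-least)
      where
      PairSet : Carrier → Carrier → Set
      PairSet u v = ∃ λ R → (∀ x → 0or1 (R x)) × (∀ x → R x ≡ 1 → IsTriangle x u v) × ∑ R ≡ ρ
      positive : ∀ k {j} → q ≤ suc k ⊛ j → 1 ≤ j
      positive k {zero}  le = contradiction (ℕ.≤-trans (weaken 1 large) (ℕ.≤-trans le (ℕ.≤-reflexive (ℕ.*-zeroʳ k)))) λ ()
      positive k {suc j} le = s≤s z≤n

      CandidateSet : (u v a d : Carrier) → Set
      CandidateSet u v a d = ∃ λ X → (∀ x → 0or1 (X x)) × (∀ x → X x ≡ 1 → IsTriangle x u v × IsTriangle x a d) × ∑ X ≡ m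

      finish : ∀ {d} → CandidateSet a₂ a₃ a₁ d → CandidateSet a₁ a₃ a₂ d → CandidateSet a₁ a₂ a₃ d → ∃ IsRainbow
      finish {d} (X , X₁ , X△ , ∑X) (Y , Y₁ , Y△ , ∑Y) (Z , Z₁ , Z△ , ∑Z) = b , triangles⇒rainbow b lines
        where
        open ℕ.≤-Reasoning
        spread-total : ∑ (λ x → X x ⊛ (S Y x ⊕ S Z x)) ≤ m ⊛ (4 ⊛ q)
        spread-total = begin
          ∑ (λ x → X x ⊛ (S Y x ⊕ S Z x))   ≤⟨ ∑-mono-≤ (λ x → ℕ.*-monoˡ-≤ (S Y x ⊕ S Z x) (0or1-≤ (X₁ x))) ⟩
          ∑ (λ x → 1 ⊛ (S Y x ⊕ S Z x))     ≡⟨ trans (∑-*ˡ 1 _) (trans (ℕ.*-identityˡ _) (∑-+ (S Y) (S Z))) ⟩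
          ∑ (S Y) ⊕ ∑ (S Z)                 ≤⟨ variance Y Y₁ +≤ variance Z Z₁ ⟩
          2 ⊛ ∑ Y ⊛ q ⊕ 2 ⊛ ∑ Z ⊛ q         ≡⟨ cong₂ (λ j k → 2 ⊛ j ⊛ q ⊕ 2 ⊛ k ⊛ q) ∑Y ∑Z ⟩
          2 ⊛ m ⊛ q ⊕ 2 ⊛ m ⊛ q             ≡⟨ collect m q ⟩
          m ⊛ (4 ⊛ q)                       ∎
          where
          collect : ∀ m q → 2 ⊛ m ⊛ q ⊕ 2 ⊛ m ⊛ q ≡ m ⊛ (4 ⊛ q)
          collect = solve-∀
        -- Y and Z have the same size m as X, so averaging over X cancels m and leaves a point x
        -- from which the classes are well balanced on both Y and Z.
        chosen-x : ∃ λ x → X x ≡ 1 × S Y x ⊕ S Z x ≤ 4 ⊛ q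
        chosen-x = average X (λ x → S Y x ⊕ S Z x) X₁ (positive 35 q≤36m) (ℕ.≤-reflexive (sym ∑X)) spread-total
        x = proj₁ chosen-x
        f g : Carrier → ℕ
        f y = Y y ⊛ c 0F (y - x)
        g z = Z z ⊛ c 1F (z - x)
        u = proj₁ (N-deviation Y 0F x)
        w = proj₁ (N-deviation Z 1F x)
        above : ∀ W r → (∀ x → 0or1 (W x)) → ∑ W ≡ m → m ≤ 3 ⊛ N W r x ⊕ proj₁ (N-deviation W r x) ⊕ 1
        above W r W₁ ∑W = ℕ.≤-trans (ℕ.≤-reflexive (sym ∑W)) (ℕ.≤-trans (T≥ W x W₁) (ℕ.+-monoˡ-≤ 1 (proj₁ (proj₂ (N-deviation W r x)))))
        uw² : u ⊛ u ⊕ w ⊛ w ≤ 8 ⊛ q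
        uw² = begin
          u ⊛ u ⊕ w ⊛ w            ≤⟨ proj₂ (proj₂ (N-deviation Y 0F x)) +≤ proj₂ (proj₂ (N-deviation Z 1F x)) ⟩
          2 ⊛ S Y x ⊕ 2 ⊛ S Z x    ≡⟨ ℕ.*-distribˡ-+ 2 (S Y x) (S Z x) ⟨
          2 ⊛ (S Y x ⊕ S Z x)      ≤⟨ 2 ×≤ proj₂ (proj₂ chosen-x) ⟩
          2 ⊛ (4 ⊛ q)              ≡⟨ ℕ.*-assoc 2 4 q ⟨
          8 ⊛ q                    ∎
        -- Y and Z may overlap; `f` and `g` are disjoint because they ask for different classes from
        -- x.
        fg≡0 : ∀ y → f y ⊛ g y ≡ 0
        fg≡0 y = trans (*-interchange (Y y) (c 0F (y - x)) (Z y) (c 1F (y - x)))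
          (trans (cong (Y y ⊛ Z y ⊛_) (c-disjoint {0F} {1F} (y - x) λ ())) (ℕ.*-zeroʳ (Y y ⊛ Z y)))
        chosen-yz : ∃ λ y → ∃ λ z → f y ≡ 1 × g z ≡ 1 × c 2F (y - z) ≡ 1
        chosen-yz = mixing f g (λ y → 0or1-* (Y₁ y) (c-0or1 _ _)) (λ z → 0or1-* (Z₁ z) (c-0or1 _ _)) fg≡0
          (mixing-estimate {q} {m} {N Y 0F x} {N Z 1F x} {u} {w} large q≤36m (above Y 0F Y₁ ∑Y) (above Z 1F Z₁ ∑Z) uw²) 2F
        y = proj₁ chosen-yz
        z = proj₁ (proj₂ chosen-yz)
        fy = *≡1 {Y y} (proj₁ (proj₂ (proj₂ chosen-yz)))
        gz = *≡1 {Z z} (proj₁ (proj₂ (proj₂ (proj₂ chosen-yz))))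
        x△ = X△ x (proj₁ (proj₂ chosen-x))
        y△ = Y△ y (proj₁ fy)
        z△ = Z△ z (proj₁ gz)
        xyz△ : IsTriangle x y z
        xyz△ = triangle (proj₂ (proj₂ (proj₂ (proj₂ chosen-yz)))) (proj₂ gz) (c-flip (proj₂ fy)) (λ ()) (λ ()) (λ ())
        b : Fin 7 → Carrier
        b 0F = x
        b 1F = y
        b 2F = a₁
        b 3F = z
        b 4F = a₃
        b 5F = a₂
        b 6F = d
        lines : ∀ c → IsTriangle (b (onLine c 0F)) (b (onLine c 1F)) (b (onLine c 2F))
        lines 0F = xyz△
        lines 1F = proj₁ y△
        lines 2F = triangle-rotate (triangle-rotate (triangle-swap (proj₁ z△)))
        lines 3F = proj₂ z△
        lines 4F = triangle-rotate (triangle-swap (proj₁ x△))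
        lines 5F = triangle-rotate (proj₂ y△)
        lines 6F = triangle-rotate (triangle-rotate (proj₂ x△))

      choose-d : PairSet a₂ a₃ → PairSet a₁ a₃ → PairSet a₁ a₂ → ∃ IsRainbow
      choose-d (R , R₁ , R△ , ∑R) (R′ , R′₁ , R′△ , ∑R′) (R″ , R″₁ , R″△ , ∑R″) =
        finish (X.set R△ ∑R l₁ weight₁) (Y.set R′△ ∑R′ l₂ weight₂) (Z.set R″△ ∑R″ l₃ weight₃)
        where
        open ℕ.≤-Reasoning
        module Candidates (R : Carrier → ℕ) (R₁ : ∀ x → 0or1 (R x)) (a : Carrier) where
          open Cut R R₁ a public
          set : ∀ {u v d} → (∀ x → R x ≡ 1 → IsTriangle x u v) → ∑ R ≡ ρ →
                (∃ λ l → l ≢ dominant × c l (d - a) ≡ 1) → weight d ≤ 6 ⊛ q → CandidateSet u v a d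
          set {d = d} R△ ∑R (l , l≢ , cl) weight≤ =
            let X , X₁ , X⊆ , ∑X = ∑-trim (candidates l d) (candidates-0or1 l d) m
                  (m-least _ (candidates-size l≢ weight≤ (subst (λ k → q ≤ 5 ⊛ k) (sym ∑R) q≤5ρ)))
            in X , X₁ , (λ x Xx → R△ x (candidates-⊆ {l} {d} (X⊆ x Xx)) , candidates-triangle cl (X⊆ x Xx)) , ∑X
        module X = Candidates R R₁ a₁
        module Y = Candidates R′ R′₁ a₂
        module Z = Candidates R″ R″₁ a₃
        allowed : Carrier → ℕ
        allowed d = avoid X.dominant a₁ d ⊛ avoid Y.dominant a₂ d ⊛ avoid Z.dominant a₃ d
        allowed-0or1 : ∀ d → 0or1 (allowed d)
        allowed-0or1 d = 0or1-* (0or1-* (avoid-0or1 _ _ d) (avoid-0or1 _ _ d)) (avoid-0or1 _ _ d)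
        total : Carrier → ℕ
        total d = X.weight d ⊕ Y.weight d ⊕ Z.weight d
        weight-bound : ∑ (λ d → allowed d ⊛ total d) ≤ ρ ⊛ (6 ⊛ q)
        weight-bound = begin
          ∑ (λ d → allowed d ⊛ total d)              ≤⟨ ∑-mono-≤ (λ d → ℕ.*-monoˡ-≤ (total d) (0or1-≤ (allowed-0or1 d))) ⟩
          ∑ (λ d → 1 ⊛ total d)                      ≡⟨ trans (∑-*ˡ 1 total) (ℕ.*-identityˡ _) ⟩
          ∑ total                                    ≡⟨ trans (∑-+ _ Z.weight) (cong (_⊕ ∑ Z.weight) (∑-+ X.weight Y.weight)) ⟩
          ∑ X.weight ⊕ ∑ Y.weight ⊕ ∑ Z.weight       ≤⟨ X.weight-total +≤ Y.weight-total +≤ Z.weight-total ⟩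
          2 ⊛ ∑ R ⊛ q ⊕ 2 ⊛ ∑ R′ ⊛ q ⊕ 2 ⊛ ∑ R″ ⊛ q
            ≡⟨ cong₂ (λ i j → 2 ⊛ i ⊛ q ⊕ 2 ⊛ j ⊛ q ⊕ 2 ⊛ ∑ R″ ⊛ q) ∑R ∑R′ ⟩
          2 ⊛ ρ ⊛ q ⊕ 2 ⊛ ρ ⊛ q ⊕ 2 ⊛ ∑ R″ ⊛ q       ≡⟨ cong (λ k → 2 ⊛ ρ ⊛ q ⊕ 2 ⊛ ρ ⊛ q ⊕ 2 ⊛ k ⊛ q) ∑R″ ⟩
          2 ⊛ ρ ⊛ q ⊕ 2 ⊛ ρ ⊛ q ⊕ 2 ⊛ ρ ⊛ q          ≡⟨ collect ρ q ⟩
          ρ ⊛ (6 ⊛ q)                                ∎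
          where
          collect : ∀ ρ q → 2 ⊛ ρ ⊛ q ⊕ 2 ⊛ ρ ⊛ q ⊕ 2 ⊛ ρ ⊛ q ≡ ρ ⊛ (6 ⊛ q)
          collect = solve-∀
        -- Three sets of size ρ contribute `2 ρ q` each to the total weight, and at least ρ points
        -- are allowed; so some allowed point has weight at most `6 q` for the three sets together.
        chosen-d : ∃ λ d → allowed d ≡ 1 × total d ≤ 6 ⊛ q
        chosen-d = average allowed total allowed-0or1 (positive 4 q≤5ρ)
          (ρ-least _ (avoid-size X.dominant Y.dominant Z.dominant 0≢1 (x≢-x (0≢1 ∘ sym)))) weight-bound
        d = proj₁ chosen-d
        allowed₁₂ = *≡1 {avoid X.dominant a₁ d ⊛ avoid Y.dominant a₂ d} (proj₁ (proj₂ chosen-d))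
        allowed₁ = *≡1 {avoid X.dominant a₁ d} (proj₁ allowed₁₂)
        l₁ = avoid-class {X.dominant} {a₁} {d} (proj₁ allowed₁)
        l₂ = avoid-class {Y.dominant} {a₂} {d} (proj₂ allowed₁)
        l₃ = avoid-class {Z.dominant} {a₃} {d} (proj₂ allowed₁₂)
        weight₁ : X.weight d ≤ 6 ⊛ q
        weight₁ = ℕ.≤-trans (ℕ.≤-trans (ℕ.m≤m+n _ _) (ℕ.m≤m+n _ _)) (proj₂ (proj₂ chosen-d))
        weight₂ : Y.weight d ≤ 6 ⊛ q
        weight₂ = ℕ.≤-trans (ℕ.≤-trans (ℕ.m≤n+m (Y.weight d) (X.weight d)) (ℕ.m≤m+n _ _)) (proj₂ (proj₂ chosen-d))
        weight₃ : Z.weight d ≤ 6 ⊛ q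
        weight₃ = ℕ.≤-trans (ℕ.m≤n+m (Z.weight d) (X.weight d ⊕ Y.weight d)) (proj₂ (proj₂ chosen-d))

-- Fields of order p and p²

isCommutativeRing≡ : ∀ {A : Set} {_+_ _*_ : Op₂ A} {neg : Op₁ A} {0# 1# : A} →
  (∀ x y z → (x + y) + z ≡ x + (y + z)) → (∀ x y → x + y ≡ y + x) → (∀ x → 0# + x ≡ x) → (∀ x → neg x + x ≡ 0#) →
  (∀ x y z → (x * y) * z ≡ x * (y * z)) → (∀ x y → x * y ≡ y * x) → (∀ x → 1# * x ≡ x) →
  (∀ x y z → x * (y + z) ≡ (x * y) + (x * z)) → IsCommutativeRing _≡_ _+_ _*_ neg 0# 1#
isCommutativeRing≡ {_+_ = _+_} {_*_} {neg} +-assoc +-comm +-identityˡ -‿inverseˡ *-assoc *-comm *-identityˡ distribˡ = record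
  { isRing = record
    { +-isAbelianGroup = record
      { isGroup = record
        { isMonoid = record
          { isSemigroup = record
            { isMagma = record { isEquivalence = isEquivalence ; ∙-cong = cong₂ _+_ }
            ; assoc = +-assoc }
          ; identity = +-identityˡ , λ x → trans (+-comm x _) (+-identityˡ x) }
        ; inverse = -‿inverseˡ , λ x → trans (+-comm x _) (-‿inverseˡ x)
        ; ⁻¹-cong = cong neg }
      ; comm = +-comm }
    ; *-cong = cong₂ _*_
    ; *-assoc = *-assoc
    ; *-identity = *-identityˡ , λ x → trans (*-comm x _) (*-identityˡ x)
    ; distrib = distribˡ , λ x y z → trans (*-comm _ x) (trans (distribˡ x y z) (cong₂ _+_ (*-comm x y) (*-comm x z))) }
  ; *-comm = *-comm }

-- The bound is irrelevant, so that computing with residues only evaluates natural numbers.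
record ℤ/ (p : ℕ) : Set where
  constructor residue
  field
    val    : ℕ
    .val<p : val ℕ.< p
open ℤ/

val-injective : ∀ {p} {x y : ℤ/ p} → val x ≡ val y → x ≡ y
val-injective refl = refl

module Residues (p : ℕ) .{{_ : NonZero p}} where
  [_] : ℕ → ℤ/ p
  [ k ] = residue (k % p) (m%n<n k p)

  _+_ _*_ : Op₂ (ℤ/ p)
  x + y = [ val x ℕ.+ val y ]
  x * y = [ val x ℕ.* val y ]
  -_ : Op₁ (ℤ/ p)
  - x = [ p ℕ.∸ val x ]

  []-val : ∀ x → [ val x ] ≡ x
  []-val (residue k k<p) = val-injective (m<n⇒m%n≡m (recompute (k ℕ.<? p) k<p))

  []-+ : ∀ j k → [ j ] + [ k ] ≡ [ j ℕ.+ k ]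
  []-+ j k = val-injective (sym (%-distribˡ-+ j k p))

  []-* : ∀ j k → [ j ] * [ k ] ≡ [ j ℕ.* k ]
  []-* j k = val-injective (sym (%-distribˡ-* j k p))

  +-[] : ∀ x k → x + [ k ] ≡ [ val x ℕ.+ k ]
  +-[] x k = trans (cong (_+ [ k ]) (sym ([]-val x))) ([]-+ (val x) k)

  *-[] : ∀ x k → x * [ k ] ≡ [ val x ℕ.* k ]
  *-[] x k = trans (cong (_* [ k ]) (sym ([]-val x))) ([]-* (val x) k)

  +-comm′ : ∀ x y → x + y ≡ y + x
  +-comm′ x y = cong [_] (ℕ.+-comm (val x) (val y))

  *-comm′ : ∀ x y → x * y ≡ y * x
  *-comm′ x y = cong [_] (ℕ.*-comm (val x) (val y))

  isCommutativeRing : IsCommutativeRing _≡_ _+_ _*_ -_ [ 0 ] [ 1 ]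
  isCommutativeRing = isCommutativeRing≡
    (λ x y z → trans (+-comm′ (x + y) z) (trans (+-[] z _) (trans (cong [_] (trans (ℕ.+-comm (val z) _) (ℕ.+-assoc (val x) (val y) (val z)))) (sym (+-[] x _)))))
    +-comm′
    (λ x → trans (+-comm′ [ 0 ] x) (trans (+-[] x 0) (trans (cong [_] (ℕ.+-identityʳ (val x))) ([]-val x))))
    (λ x → trans (+-comm′ (- x) x) (trans (+-[] x _) (trans (cong [_] (ℕ.m+[n∸m]≡n (bound x))) (val-injective (trans (n%n≡0 p) (sym (m<n⇒m%n≡m (ℕ.n≢0⇒n>0 (ℕ.≢-nonZero⁻¹ p)))))))))
    (λ x y z → trans (*-comm′ (x * y) z) (trans (*-[] z _) (trans (cong [_] (trans (ℕ.*-comm (val z) _) (ℕ.*-assoc (val x) (val y) (val z)))) (sym (*-[] x _)))))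
    *-comm′
    (λ x → trans (*-comm′ [ 1 ] x) (trans (*-[] x 1) (trans (cong [_] (ℕ.*-identityʳ (val x))) ([]-val x))))
    (λ x y z → trans (*-[] x _) (trans (cong [_] (ℕ.*-distribˡ-+ (val x) (val y) (val z))) (sym ([]-+ _ _))))
    where
    bound : ∀ x → val x ℕ.≤ p
    bound (residue k k<p) = ℕ.<⇒≤ (recompute (k ℕ.<? p) k<p)

  enumResidues : ℤ/ p ↔ Fin p
  enumResidues = mk↔ₛ′ (λ { (residue k k<p) → fromℕ< k<p }) (λ i → residue (toℕ i) (toℕ<n i))
    (λ i → fromℕ<-toℕ i (toℕ<n i)) (λ { (residue k k<p) → val-injective (toℕ-fromℕ< k<p) })

primeField : ∀ {p} → Prime p → FiniteDomain p
primeField {p} p-prime = record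
  { Carrier = ℤ/ p
  ; enum = enumResidues
  ; _+_ = _+_ ; _*_ = _*_ ; -_ = -_ ; 0# = [ 0 ] ; 1# = [ 1 ]
  ; isCommutativeRing = isCommutativeRing
  ; 0≢1 = λ eq → contradiction (trans (sym (m<n⇒m%n≡m 1<p)) (trans (sym (cong val eq)) (m<n⇒m%n≡m 0<p))) λ ()
  ; integral = λ x y xy≡0 → ⊎.map (vanish x) (vanish y)
      (euclidsLemma (val x) (val y) p-prime (m%n≡0⇒n∣m _ p (trans (cong val xy≡0) (m<n⇒m%n≡m 0<p))))
  }
  where
  instance
    p≢0 : NonZero p
    p≢0 = prime⇒nonZero p-prime
  open Residues p
  1<p : 1 ℕ.< p
  1<p = ℕ.nonTrivial⇒n>1 p {{prime⇒nonTrivial p-prime}}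
  0<p : 0 ℕ.< p
  0<p = ℕ.<-trans ℕ.z<s 1<p
  vanish : ∀ x → p ∣ val x → x ≡ [ 0 ]
  vanish x p∣x = trans (sym ([]-val x)) (val-injective (trans (n∣m⇒m%n≡0 (val x) p p∣x) (sym (m<n⇒m%n≡m 0<p))))

module QuadraticOperations {A : Set} (_+_ _*_ : Op₂ A) (neg : Op₁ A) (s t : A) where
  _+²_ _*²_ : Op₂ (A × A)
  (a , b) +² (c , d) = (a + c) , (b + d)
  (a , b) *² (c , d) = ((a * c) + (t * (b * d))) , (((a * d) + (b * c)) + (s * (b * d)))
  neg² : Op₁ (A × A)
  neg² (a , b) = neg a , neg b

-- K[X]/(X² - sX - t)
module QuadraticExtension {q : ℕ} (K : FiniteDomain q) (s t : FiniteDomain.Carrier K) where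
  open FiniteDomain K
  open CommutativeRing commutativeRing using (commutativeSemiring; +-assoc; +-comm; +-identityˡ; -‿inverseˡ; -‿inverseʳ; zeroʳ)
  open import Algebra.Solver.Ring.NaturalCoefficients.Default commutativeSemiring
  open QuadraticOperations _+_ _*_ -_ s t public

  0² 1² : Carrier × Carrier
  0² = 0# , 0#
  1² = 1# , 0#

  *²-assoc : ∀ x y z → (x *² y) *² z ≡ x *² (y *² z)
  *²-assoc (a , b) (c , d) (e , f) = cong₂ _,_
    (solve 8 (λ a b c d e f s t →
      (a :* c :+ t :* (b :* d)) :* e :+ t :* ((a :* d :+ b :* c :+ s :* (b :* d)) :* f) :=
      a :* (c :* e :+ t :* (d :* f)) :+ t :* (b :* (c :* f :+ d :* e :+ s :* (d :* f)))) refl a b c d e f s t)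
    (solve 8 (λ a b c d e f s t →
      (a :* c :+ t :* (b :* d)) :* f :+ (a :* d :+ b :* c :+ s :* (b :* d)) :* e :+ s :* ((a :* d :+ b :* c :+ s :* (b :* d)) :* f) :=
      a :* (c :* f :+ d :* e :+ s :* (d :* f)) :+ b :* (c :* e :+ t :* (d :* f)) :+ s :* (b :* (c :* f :+ d :* e :+ s :* (d :* f)))) refl a b c d e f s t)

  isCommutativeRing² : IsCommutativeRing _≡_ _+²_ _*²_ neg² 0² 1²
  isCommutativeRing² = isCommutativeRing≡
    (λ x y z → cong₂ _,_ (+-assoc _ _ _) (+-assoc _ _ _))
    (λ x y → cong₂ _,_ (+-comm _ _) (+-comm _ _))
    (λ x → cong₂ _,_ (+-identityˡ _) (+-identityˡ _))
    (λ x → cong₂ _,_ (-‿inverseˡ _) (-‿inverseˡ _))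
    *²-assoc
    (λ { (a , b) (c , d) → cong₂ _,_
      (solve 5 (λ a b c d t → a :* c :+ t :* (b :* d) := c :* a :+ t :* (d :* b)) refl a b c d t)
      (solve 5 (λ a b c d s → a :* d :+ b :* c :+ s :* (b :* d) := c :* b :+ d :* a :+ s :* (d :* b)) refl a b c d s) })
    (λ { (a , b) → cong₂ _,_
      (solve 3 (λ a b t → con 1 :* a :+ t :* (con 0 :* b) := a) refl a b t)
      (solve 3 (λ a b s → con 1 :* b :+ con 0 :* a :+ s :* (con 0 :* b) := b) refl a b s) })
    (λ { (a , b) (c , d) (e , f) → cong₂ _,_
      (solve 7 (λ a b c d e f t → a :* (c :+ e) :+ t :* (b :* (d :+ f)) := (a :* c :+ t :* (b :* d)) :+ (a :* e :+ t :* (b :* f))) refl a b c d e f t)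
      (solve 7 (λ a b c d e f s → a :* (d :+ f) :+ b :* (c :+ e) :+ s :* (b :* (d :+ f)) :=
        (a :* d :+ b :* c :+ s :* (b :* d)) :+ (a :* f :+ b :* e :+ s :* (b :* f))) refl a b c d e f s) })

  enum² : (Carrier × Carrier) ↔ Fin (q ℕ.* q)
  enum² = ↔-sym *↔× ↔-∘ (enum ×-↔ enum)

  quadraticDomain : (∀ x y → x *² y ≡ 0² → x ≡ 0² ⊎ y ≡ 0²) → FiniteDomain (q ℕ.* q)
  quadraticDomain integral² = record
    { Carrier = Carrier × Carrier
    ; enum = enum²
    ; _+_ = _+²_ ; _*_ = _*²_ ; -_ = neg² ; 0# = 0² ; 1# = 1²
    ; isCommutativeRing = isCommutativeRing²
    ; 0≢1 = λ eq → 0≢1 (,-injectiveˡ eq)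
    ; integral = integral²
    }

  -- The product of `a + b X` with its conjugate: the other root of the polynomial is `s - X`, so
  -- the conjugate is `(a + s b) - b X`.
  norm : Carrier → Carrier → Carrier
  norm a b = (a * (a + s * b)) + (t * (b * (- b)))

  conjugate-* : ∀ a b → (a , b) *² (a + s * b , - b) ≡ (norm a b , 0#)
  conjugate-* a b = cong (norm a b ,_) (trans
    (solve 4 (λ a b c s → a :* c :+ b :* (a :+ s :* b) :+ s :* (b :* c) := (a :+ s :* b) :* (b :+ c)) refl a b (- b) s)
    (trans (cong ((a + s * b) *_) (-‿inverseʳ b)) (zeroʳ _)))

  scalar-* : ∀ k c d → (k , 0#) *² (c , d) ≡ (k * c , k * d)
  scalar-* k c d = cong₂ _,_
    (solve 4 (λ k c d t → k :* c :+ t :* (con 0 :* d) := k :* c) refl k c d t)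
    (solve 4 (λ k c d s → k :* d :+ con 0 :* c :+ s :* (con 0 :* d) := k :* d) refl k c d s)

  -- Multiplying `x y ≡ 0` by the conjugate of x leaves a scalar multiple of y, so the question
  -- descends to K.
  anisotropic⇒integral : (∀ a b → norm a b ≡ 0# → a ≡ 0# × b ≡ 0#) → ∀ x y → x *² y ≡ 0² → x ≡ 0² ⊎ y ≡ 0²
  anisotropic⇒integral anisotropic x@(a , b) y@(c , d) xy≡0 = conclude (integral k c (,-injectiveˡ ky≡0)) (integral k d (,-injectiveʳ ky≡0))
    where
    open IsCommutativeRing isCommutativeRing² using () renaming (*-assoc to assoc²; *-comm to comm²; zeroʳ to zeroʳ²)
    k = norm a b
    x̄ = (a + s * b , - b)
    ky≡0 : (k * c , k * d) ≡ (0# , 0#)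
    ky≡0 = trans (sym (scalar-* k c d)) (trans (cong (_*² y) (trans (sym (conjugate-* a b)) (comm² x x̄)))
      (trans (assoc² x̄ x y) (trans (cong (x̄ *²_) xy≡0) (zeroʳ² x̄))))
    conclude : k ≡ 0# ⊎ c ≡ 0# → k ≡ 0# ⊎ d ≡ 0# → x ≡ 0² ⊎ y ≡ 0²
    conclude (inj₂ c≡0) (inj₂ d≡0) = inj₂ (cong₂ _,_ c≡0 d≡0)
    conclude (inj₁ k≡0) _          = let a≡0 , b≡0 = anisotropic a b k≡0 in inj₁ (cong₂ _,_ a≡0 b≡0)
    conclude (inj₂ _)   (inj₁ k≡0) = let a≡0 , b≡0 = anisotropic a b k≡0 in inj₁ (cong₂ _,_ a≡0 b≡0)

-- Adjoins a root of `X² + X + 1`. For p ≡ 5 (mod 6) there is no primitive cube root of unity modulo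
-- p, since 3 does not divide p - 1; this is proved in the form that `a² - a b + b²` is anisotropic.
module Eisenstein {p j : ℕ} (K : FiniteDomain p) (p≡6j+5 : p ≡ suc (6 ℕ.* j ℕ.+ 4)) where
  open DomainProperties {p} {6 ℕ.* j ℕ.+ 4} K p≡6j+5
  open CommutativeRing commutativeRing using (commutativeSemiring)
  open import Algebra.Solver.Ring.NaturalCoefficients.Default commutativeSemiring
  open QuadraticExtension K (- 1#) (- 1#) public

  private
    norm-expand : ∀ {a b} → norm a b ≡ 0# → a * a + b * b ≡ a * b
    norm-expand {a} {b} N≡0 = begin
      a * a + b * b                        ≡⟨ +-identityʳ _ ⟨
      a * a + b * b + 0#                   ≡⟨ cong (a * a + b * b +_) (trans (cong (a *_) (-‿inverseˡ b)) (zeroʳ a)) ⟨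
      a * a + b * b + a * (- b + b)        ≡⟨ regroup a b (- b) ⟩
      (a * (a + - b) + b * b) + a * b      ≡⟨ cong (_+ a * b) (cong₂ (λ u v → a * (a + u) + v) (neg b) bb) ⟨
      norm a b + a * b                     ≡⟨ cong (_+ a * b) N≡0 ⟩
      0# + a * b                           ≡⟨ +-identityˡ _ ⟩
      a * b                                ∎
      where
      open ≡-Reasoning
      regroup : ∀ a b c → a * a + b * b + a * (c + b) ≡ (a * (a + c) + b * b) + a * b
      regroup = solve 3 (λ a b c → a :* a :+ b :* b :+ a :* (c :+ b) := (a :* (a :+ c) :+ b :* b) :+ a :* b) refl
      neg : ∀ x → - 1# * x ≡ - x
      neg x = trans (sym (-‿distribˡ-* 1# x)) (cong -_ (*-identityˡ x))
      bb : - 1# * (b * - b) ≡ b * b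
      bb = trans (neg (b * - b)) (trans (cong -_ (sym (-‿distribʳ-* b b))) (-‿involutive (b * b)))

    -- `a³ + b³` has the factor `a² - a b + b²`, so `a³` and `b³` are opposite.
    sixth : ∀ {a b} → a * a + b * b ≡ a * b → a ^ 6 ≡ b ^ 6
    sixth {a} {b} eq = begin
      a ^ 6          ≡⟨ solve 1 (λ a → a :^ 6 := (a :* (a :* a)) :* (a :* (a :* a))) refl a ⟩
      a³ * a³        ≡⟨ cong₂ _*_ a³≡-b³ a³≡-b³ ⟩
      - b³ * - b³    ≡⟨ trans (sym (-‿distribˡ-* b³ (- b³))) (trans (cong -_ (sym (-‿distribʳ-* b³ b³))) (-‿involutive _)) ⟩
      b³ * b³        ≡⟨ solve 1 (λ a → a :^ 6 := (a :* (a :* a)) :* (a :* (a :* a))) refl b ⟨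
      b ^ 6          ∎
      where
      open ≡-Reasoning
      a³ = a * (a * a)
      b³ = b * (b * b)
      a³+b³≡0 : a³ + b³ ≡ 0#
      a³+b³≡0 = +-cancelʳ (a * b * (a + b)) _ _ (begin
        a³ + b³ + a * b * (a + b)    ≡⟨ solve 2 (λ a b → a :* (a :* a) :+ b :* (b :* b) :+ a :* b :* (a :+ b) := (a :* a :+ b :* b) :* (a :+ b)) refl a b ⟩
        (a * a + b * b) * (a + b)    ≡⟨ cong (_* (a + b)) eq ⟩
        a * b * (a + b)              ≡⟨ +-identityˡ _ ⟨
        0# + a * b * (a + b)         ∎)
      a³≡-b³ : a³ ≡ - b³
      a³≡-b³ = +-cancelʳ b³ _ _ (trans a³+b³≡0 (sym (-‿inverseˡ b³)))

    -- Since `a^6` and `b^6` agree and the exponent in Fermat's theorem is `6 j + 4`, also `a^4` and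
    -- `b^4` agree, and then `a²` and `b²`. With `c = a²` the equation says `a b = 2 c`; squaring
    -- gives `c² = 4 c²`, that is `3 c² = 0`.
    nonzero-case : 1# + 1# + 1# ≢ 0# → ∀ {a b} → a ≢ 0# → b ≢ 0# → a * a + b * b ≢ a * b
    nonzero-case 3≢0 {a} {b} a≢0 b≢0 eq = *-nonzero 3≢0 (*-nonzero (*-nonzero a≢0 a≢0) (*-nonzero a≢0 a≢0)) 3cc≡0
      where
      open ≡-Reasoning
      split : ∀ {x} → x ≢ 0# → (x ^ 6) ^ j * x ^ 4 ≡ 1#
      split {x} x≢0 = trans (cong (_* x ^ 4) (^-assocʳ x 6 j)) (trans (sym (^-homo-* x (6 ℕ.* j) 4)) (fermat x≢0))
      a⁴≡b⁴ : a ^ 4 ≡ b ^ 4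
      a⁴≡b⁴ = *-cancelˡ (^-nonzero j (^-nonzero 6 a≢0)) (trans (split a≢0) (trans (sym (split b≢0)) (cong (λ z → z ^ j * b ^ 4) (sym (sixth eq)))))
      a²≡b² : a * a ≡ b * b
      a²≡b² = *-cancelˡ (^-nonzero 4 a≢0) (begin
        a ^ 4 * (a * a)  ≡⟨ solve 1 (λ a → a :^ 4 :* (a :* a) := a :^ 6) refl a ⟩
        a ^ 6            ≡⟨ sixth eq ⟩
        b ^ 6            ≡⟨ solve 1 (λ a → a :^ 4 :* (a :* a) := a :^ 6) refl b ⟨
        b ^ 4 * (b * b)  ≡⟨ cong (_* (b * b)) a⁴≡b⁴ ⟨
        a ^ 4 * (b * b)  ∎)
      c = a * a
      3cc≡0 : (1# + 1# + 1#) * (c * c) ≡ 0#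
      3cc≡0 = +-cancelʳ (c * c) _ _ (begin
        (1# + 1# + 1#) * (c * c) + c * c  ≡⟨ solve 1 (λ c → (con 1 :+ con 1 :+ con 1) :* (c :* c) :+ c :* c := (c :+ c) :* (c :+ c)) refl c ⟩
        (c + c) * (c + c)                 ≡⟨ cong (λ z → z * z) (trans (cong (c +_) a²≡b²) eq) ⟩
        a * b * (a * b)                   ≡⟨ solve 2 (λ a b → a :* b :* (a :* b) := a :* a :* (b :* b)) refl a b ⟩
        a * a * (b * b)                   ≡⟨ cong (a * a *_) a²≡b² ⟨
        c * c                             ≡⟨ +-identityˡ _ ⟨
        0# + c * c                        ∎)

    square-zero : ∀ {x} → x * x ≡ 0# → x ≡ 0#
    square-zero eq = [ (λ z → z) , (λ z → z) ]′ (integral _ _ eq)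

  anisotropic : 1# + 1# + 1# ≢ 0# → ∀ a b → norm a b ≡ 0# → a ≡ 0# × b ≡ 0#
  anisotropic 3≢0 a b N≡0 with a ≟ᶜ 0# | b ≟ᶜ 0#
  ... | yes refl | _ = refl , square-zero (trans (sym (+-identityˡ _)) (trans (cong (_+ b * b) (sym (zeroˡ 0#))) (trans (norm-expand N≡0) (zeroˡ b))))
  ... | no _ | yes refl = square-zero (trans (sym (+-identityʳ _)) (trans (cong (a * a +_) (sym (zeroˡ 0#))) (trans (norm-expand N≡0) (zeroʳ a)))) , refl
  ... | no a≢0 | no b≢0 = contradiction (norm-expand N≡0) (nonzero-case 3≢0 a≢0 b≢0)

  eisensteinDomain : 1# + 1# + 1# ≢ 0# → FiniteDomain (p ℕ.* p)
  eisensteinDomain 3≢0 = quadraticDomain (anisotropic⇒integral (anisotropic 3≢0))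

-- A Boolean test for rainbow planes

module FastPower {A : Set} (_*_ : Op₂ A) (1# : A) where
  -- The fuel only bounds the number of squarings; the value is x ^ k whatever the fuel.
  fastPower : ℕ → A → ℕ → A
  fastPower fuel       x zero      = 1#
  fastPower zero       x (suc k)   = x * fastPower zero x k
  fastPower (suc fuel) x k@(suc _) with k % 2
  ... | zero  = fastPower fuel (x * x) (k / 2)
  ... | suc _ = x * fastPower fuel (x * x) (k / 2)

module RainbowTest {A : Set} (_+_ _*_ : Op₂ A) (neg : Op₁ A) (1# : A) (_==_ : A → A → Bool) (e : ℕ) where
  open FastPower _*_ 1# public

  distinct : A → A → A → Bool
  distinct a b c = not (a == b) ∧ (not (b == c) ∧ not (c == a))

  isTriangle : A → A → A → Bool
  isTriangle x y z = distinct (power (y + neg z)) (power (z + neg x)) (power (x + neg y))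
    where
    power : A → A
    power x = fastPower 20 x e

  isRainbow : (Fin 7 → A) → Bool
  isRainbow b = lineTest 0F ∧ (lineTest 1F ∧ (lineTest 2F ∧ (lineTest 3F ∧ (lineTest 4F ∧ (lineTest 5F ∧ lineTest 6F)))))
    where
    lineTest : Fin 7 → Bool
    lineTest c = isTriangle (b (onLine c 0F)) (b (onLine c 1F)) (b (onLine c 2F))

∧-true : ∀ {a b} → a ∧ b ≡ true → a ≡ true × b ≡ true
∧-true {true} eq = refl , eq

module RainbowTestSound {q n : ℕ} (D : FiniteDomain q) (q≡1+6n : q ≡ suc (6 ℕ.* n))
  (_==_ : FiniteDomain.Carrier D → FiniteDomain.Carrier D → Bool) (==-refl : ∀ x → (x == x) ≡ true) where
  open RainbowPlanes {q} {n} D q≡1+6n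
  open RainbowTest _+_ _*_ -_ 1# _==_ e

  fastPower-correct : ∀ fuel x k → fastPower fuel x k ≡ x ^ k
  fastPower-half : ∀ fuel x k → fastPower fuel (x * x) k ≡ x ^ (k ℕ.* 2)
  fastPower-half fuel x k = trans (fastPower-correct fuel (x * x) k) (trans
    (cong (λ y → (x * y) ^ k) (sym (*-identityʳ x))) (trans (^-assocʳ x 2 k) (cong (x ^_) (ℕ.*-comm 2 k))))
  fastPower-correct fuel       x zero      = refl
  fastPower-correct zero       x (suc k)   = cong (x *_) (fastPower-correct zero x k)
  fastPower-correct (suc fuel) x k@(suc _) with k % 2 | m%n<n k 2 | m≡m%n+[m/n]*n k 2
  ... | zero        | _ | k≡ = trans (fastPower-half fuel x (k / 2)) (cong (x ^_) (sym k≡))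
  ... | suc zero    | _ | k≡ = trans (cong (x *_) (fastPower-half fuel x (k / 2))) (cong (x ^_) (sym k≡))
  ... | suc (suc _) | s≤s (s≤s ()) | _

  ==-sound : ∀ {x y} → not (x == y) ≡ true → x ≢ y
  ==-sound {x} eq refl with x == x | ==-refl x
  ==-sound () refl | true | _

  isTriangle-sound : ∀ {x y z} → isTriangle x y z ≡ true → IsTriangle x y z
  isTriangle-sound {x} {y} {z} eq = let p , eq′ = ∧-true eq ; q , r = ∧-true eq′ in lift p , lift q , lift r
    where
    lift : ∀ {u v} → not (fastPower 20 u e == fastPower 20 v e) ≡ true → u ^ e ≢ v ^ e
    lift {u} {v} neq eq = ==-sound neq (trans (fastPower-correct 20 u e) (trans eq (sym (fastPower-correct 20 v e))))

  isRainbow-sound : ∀ b → isRainbow b ≡ true → IsRainbow b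
  isRainbow-sound b eq = triangles⇒rainbow b lines
    where
    t₀ = ∧-true eq
    t₁ = ∧-true (proj₂ t₀)
    t₂ = ∧-true (proj₂ t₁)
    t₃ = ∧-true (proj₂ t₂)
    t₄ = ∧-true (proj₂ t₃)
    t₅ = ∧-true (proj₂ t₄)
    lines : ∀ i → IsTriangle (b (onLine i 0F)) (b (onLine i 1F)) (b (onLine i 2F))
    lines 0F = isTriangle-sound (proj₁ t₀)
    lines 1F = isTriangle-sound (proj₁ t₁)
    lines 2F = isTriangle-sound (proj₁ t₂)
    lines 3F = isTriangle-sound (proj₁ t₃)
    lines 4F = isTriangle-sound (proj₁ t₄)
    lines 5F = isTriangle-sound (proj₁ t₅)
    lines 6F = isTriangle-sound (proj₂ t₅)

  test⇒baseFamily : ∀ b → isRainbow b ≡ true → BaseFamily q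
  test⇒baseFamily b eq = rainbow⇒baseFamily b (isRainbow-sound b eq)

-- Rainbow planes in small fields

≡ᵇ-refl : ∀ k → (k ≡ᵇ k) ≡ true
≡ᵇ-refl zero    = refl
≡ᵇ-refl (suc k) = ≡ᵇ-refl k

_==_ : ∀ {p} → ℤ/ p → ℤ/ p → Bool
x == y = val x ≡ᵇ val y

_==²_ : ∀ {p} → ℤ/ p × ℤ/ p → ℤ/ p × ℤ/ p → Bool
(a , b) ==² (c , d) = (a == c) ∧ (b == d)

-- The planes of the tables contain 0 and 1; their other points are given by the digits of a number.
digits : (B : ℕ) .{{_ : NonZero B}} → ℕ → Fin 7 → ℕ
digits B w 0F = 0
digits B w 1F = 1
digits B w 6F = w % B
digits B w 5F = w / B % B
digits B w 4F = w / B / B % B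
digits B w 2F = w / B / B / B % B
digits B w 3F = w / B / B / B / B

module PrimeTest (p : ℕ) .{{_ : NonZero p}} where
  open Residues p
  open RainbowTest _+_ _*_ -_ [ 1 ] _==_ (2 ℕ.* (p / 6))

  -- Tries the bases g, g + 1, ... until one is not a cube. The result carries no proof: a plane is
  -- certified only by `isRainbow`, which would reject one built from a wrong root.
  cubeRootOfUnity : ℕ → ℕ → ℤ/ p
  cubeRootOfUnity zero       g = [ 1 ]
  cubeRootOfUnity (suc fuel) g = if r == [ 1 ] then cubeRootOfUnity fuel (suc g) else r
    where r = fastPower 20 [ g ] (2 ℕ.* (p / 6))

  -- Multiplication by ω acts on this plane as i ↦ 2i on its labels, so there are only three kinds of lines.
  symmetricPlane : ℤ/ p → ℕ → Fin 7 → ℤ/ p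
  symmetricPlane ω β 0F = [ 0 ]
  symmetricPlane ω β 1F = [ 1 ]
  symmetricPlane ω β 2F = ω
  symmetricPlane ω β 4F = ω * ω
  symmetricPlane ω β 3F = [ β ]
  symmetricPlane ω β 6F = [ β ] * ω
  symmetricPlane ω β 5F = [ β ] * (ω * ω)

  -- An even number 2β encodes a symmetric plane, an odd number 2w + 1 the plane with digits w.
  primePlane : ℕ → Fin 7 → ℤ/ p
  primePlane w with w % 2
  ... | zero  = symmetricPlane (cubeRootOfUnity 100 2) (w / 2)
  ... | suc _ = λ i → [ digits 128 (w / 2) i ]

  -- Failure returns 0, the code of the degenerate plane with β = 0. That plane fails the test, and
  -- so `allCovered` turns to the table.
  searchSymmetric : ℤ/ p → ℕ → ℕ → ℕ
  searchSymmetric ω zero       β = 0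
  searchSymmetric ω (suc fuel) β = if isRainbow (symmetricPlane ω β) then 2 ℕ.* β else searchSymmetric ω fuel (suc β)

primeTest : ℕ → ℕ → Bool
primeTest zero      w = false
primeTest p@(suc _) w = isRainbow (primePlane w)
  where
  open Residues p
  open PrimeTest p
  open RainbowTest _+_ _*_ -_ [ 1 ] _==_ (2 ℕ.* (p / 6))

-- If p ≡ 1 (mod 9) then ω is a cube and the line {1, ω, ω²} is never rainbow.
symmetricCandidate : ℕ → ℕ
symmetricCandidate zero      = 0
symmetricCandidate p@(suc _) = if p % 9 ≡ᵇ 1 then 0 else searchSymmetric (cubeRootOfUnity 100 2) 500 2
  where open PrimeTest p

-- The digit a + 16 b stands for the point a + bω.
eisensteinPlane : ∀ p .{{_ : NonZero p}} → ℕ → Fin 7 → ℤ/ p × ℤ/ p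
eisensteinPlane p w i = [ digits 256 w i % 16 ] , [ digits 256 w i / 16 ]
  where open Residues p

eisensteinTest : ℕ → ℕ → Bool
eisensteinTest zero      w = false
eisensteinTest p@(suc _) w = isRainbow (eisensteinPlane p w)
  where
  open Residues p
  open QuadraticOperations _+_ _*_ -_ (- [ 1 ]) (- [ 1 ])
  open RainbowTest _+²_ _*²_ neg² ([ 1 ] , [ 0 ]) _==²_ (2 ℕ.* (p ℕ.* p / 6))

-- Called with the divisor 5 on numbers prime to 6, so odd divisors from 5 on suffice. Two hundred
-- steps go beyond 316, the integer part of the root of 100000. Only the answer `true` has to be
-- sound: a composite number that escaped would merely have to pass the test.
hasDivisor : ℕ → ℕ → ℕ → Bool
hasDivisor zero    d         n = false
hasDivisor (suc k) zero      n = false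
hasDivisor (suc k) d@(suc _) n = if n <ᵇ d ℕ.* d then false else (if n % d ≡ᵇ 0 then true else hasDivisor k (2 ℕ.+ d) n)

-- A number without small divisors consumes the first entry, unless its guess already passes the test.
allCovered : (ℕ → ℕ → Bool) → (ℕ → ℕ) → ℕ → ℕ → List ℕ → Bool
allCovered test guess zero    n ws = true
allCovered test guess (suc k) n ws with hasDivisor 200 5 n
... | true  = allCovered test guess k (6 ℕ.+ n) ws
... | false with test n (guess n)
...   | true  = allCovered test guess k (6 ℕ.+ n) ws
allCovered test guess (suc k) n []       | false | false = false
allCovered test guess (suc k) n (w ∷ ws) | false | false = test n w ∧ allCovered test guess k (6 ℕ.+ n) ws

-- A divisor is accepted only after its square was found to be at most n, hence it is proper; the
-- form `2 + d` makes it at least 2.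
hasDivisor-sound : ∀ k d {n} → hasDivisor k (2 ℕ.+ d) n ≡ true → Composite n
hasDivisor-sound (suc k) d {n} eq with n <ᵇ (2 ℕ.+ d) ℕ.* (2 ℕ.+ d) in lt
... | false with n % (2 ℕ.+ d) ≡ᵇ 0 in rem
...   | true  = composite-≢ (2 ℕ.+ d) {{_}} {{ℕ.>-nonZero (ℕ.<-≤-trans ℕ.z<s dd≤n)}} (λ { refl → ℕ.<⇒≱ (ℕ.m<m*n (2 ℕ.+ d) (2 ℕ.+ d) (s≤s (s≤s z≤n))) dd≤n })
                  (m%n≡0⇒n∣m n (2 ℕ.+ d) (ℕ.≡ᵇ⇒≡ _ 0 (subst Bool.T (sym rem) _)))
  where
  dd≤n : (2 ℕ.+ d) ℕ.* (2 ℕ.+ d) ℕ.≤ n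
  dd≤n = ℕ.≮⇒≥ λ n< → subst Bool.T lt (ℕ.<⇒<ᵇ n<)
...   | false = hasDivisor-sound k (2 ℕ.+ d) eq

later : ∀ test guess k n ws → allCovered test guess k (6 ℕ.+ n) ws ≡ true → ∀ i → i ℕ.< k →
        Composite (suc i ℕ.* 6 ℕ.+ n) ⊎ ∃ λ w → test (suc i ℕ.* 6 ℕ.+ n) w ≡ true
allCovered-sound : ∀ test guess k n ws → allCovered test guess k n ws ≡ true → ∀ i → i ℕ.< k →
                   Composite (i ℕ.* 6 ℕ.+ n) ⊎ ∃ λ w → test (i ℕ.* 6 ℕ.+ n) w ≡ true
allCovered-sound test guess (suc k) n ws eq i i<k with hasDivisor 200 5 n in div
allCovered-sound test guess (suc k) n ws eq zero    i<k       | true = inj₁ (hasDivisor-sound 200 3 div)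
allCovered-sound test guess (suc k) n ws eq (suc i) (s≤s i<k) | true = later test guess k n ws eq i i<k
allCovered-sound test guess (suc k) n ws eq i i<k | false with test n (guess n) in guessed
allCovered-sound test guess (suc k) n ws       eq zero    i<k       | false | true  = inj₂ (guess n , guessed)
allCovered-sound test guess (suc k) n ws       eq (suc i) (s≤s i<k) | false | true  = later test guess k n ws eq i i<k
allCovered-sound test guess (suc k) n (w ∷ ws) eq zero    i<k       | false | false = inj₂ (w , proj₁ (∧-true eq))
allCovered-sound test guess (suc k) n (w ∷ ws) eq (suc i) (s≤s i<k) | false | false = later test guess k n ws (proj₂ (∧-true eq)) i i<k
later test guess k n ws eq i i<k = subst (λ m → Composite m ⊎ ∃ λ w → test m w ≡ true) (shift i n)
  (allCovered-sound test guess k (6 ℕ.+ n) ws eq i i<k)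
  where
  shift : ∀ i n → i ℕ.* 6 ℕ.+ (6 ℕ.+ n) ≡ suc i ℕ.* 6 ℕ.+ n
  shift = solve-∀

-- One entry, in increasing order, for each prime p ≡ 1 (mod 6) from 19 up to 100000 at which the
-- symmetric guess fails. These include all p ≡ 1 (mod 9), where the guess is the degenerate plane.
primeTable : List ℕ
primeTable =
  2156038929 ∷ 1619136269 ∷ 3229848345 ∷ 5377462573 ∷ 6472569367 ∷ 6480628255 ∷ 6992037397 ∷ 2160758051 ∷
  3234337061 ∷ 8086984493 ∷ 1627883029 ∷ 3267957537 ∷ 5385753127 ∷ 7529105679 ∷ 2735312419 ∷ 1619133709 ∷
  3771141153 ∷ 6996365071 ∷ 1631913509 ∷ 9702083387 ∷ 10221719085 ∷ 3234236453 ∷ 2189857313 ∷ 2156104209 ∷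
  5914498349 ∷ 1619133709 ∷ 2693140765 ∷ 2693142315 ∷ 2156041489 ∷ 16127953199 ∷ 2156104209 ∷ 1619133709 ∷
  2709915927 ∷ 1632012815 ∷ 7009541671 ∷ 16124185639 ∷ 6464442405 ∷ 10755481615 ∷ 2160365093 ∷ 2693337365 ∷
  6505961279 ∷ 1619133709 ∷ 1619529997 ∷ 2693368087 ∷ 3229879575 ∷ 2156988687 ∷ 5381956153 ∷ 7529106215 ∷
  2156367139 ∷ 3771140631 ∷ 3230010647 ∷ 1636371483 ∷ 8066435643 ∷ 8062174525 ∷ 2693205781 ∷ 7530755387 ∷
  5914367555 ∷ 3771076105 ∷ 2190449461 ∷ 2169440295 ∷ 2160757273 ∷ 1619133709 ∷ 2169014553 ∷ 2156040235 ∷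
  6996428583 ∷ 12369529103 ∷ 8611335197 ∷ 3767111225 ∷ 3783527709 ∷ 9685305679 ∷ 10759677479 ∷ 6996561679 ∷
  5914365229 ∷ 1619133709 ∷ 3234403105 ∷ 3234239265 ∷ 5914366737 ∷ 3234236431 ∷ 16123370283 ∷ 1619133709 ∷
  9160790821 ∷ 1619133709 ∷ 2156040465 ∷ 6992037397 ∷ 2156106513 ∷ 2160367641 ∷ 2156236585 ∷ 1627883029 ∷
  6489382703 ∷ 5914498349 ∷ 5922887465 ∷ 9676461329 ∷ 5394373927 ∷ 3783724305 ∷ 5927083831 ∷ 2156595729 ∷
  5973415723 ∷ 1632078351 ∷ 2172916015 ∷ 3230175279 ∷ 3775139367 ∷ 2156595729 ∷ 6463687471 ∷ 2156041489 ∷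
  1619395855 ∷ 5948282405 ∷ 2692944149 ∷ 3229846809 ∷ 1619133709 ∷ 1632078351 ∷ 6452786481 ∷ 5914367277 ∷
  12370131049 ∷ 5377461545 ∷ 3234469167 ∷ 5377462057 ∷ 3229879575 ∷ 5948282405 ∷ 1619133709 ∷ 3276346145 ∷
  6996659757 ∷ 1619494159 ∷ 5914461703 ∷ 2156238119 ∷ 8602945573 ∷ 1631818771 ∷ 1619133709 ∷ 3770946857 ∷
  2697432329 ∷ 3792278571 ∷ 3771171867 ∷ 3771141153 ∷ 5931210553 ∷ 2156595729 ∷ 2172914477 ∷ 8061718813 ∷
  3234305837 ∷ 3766881565 ∷ 1619395855 ∷ 2185695511 ∷ 5377725471 ∷ 5407448127 ∷ 6480628255 ∷ 1631913509 ∷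
  2709752603 ∷ 1619133709 ∷ 5914498349 ∷ 2169115937 ∷ 5381688875 ∷ 1627787789 ∷ 5914365229 ∷ 1636371483 ∷
  2156562971 ∷ 2172947505 ∷ 2156106513 ∷ 3792278571 ∷ 2692944149 ∷ 3234075429 ∷ 8078560039 ∷ 6480992027 ∷
  9676751895 ∷ 6992037397 ∷ 5377462569 ∷ 1632045583 ∷ 7530490445 ∷ 5419671095 ∷ 7546704429 ∷ 2697432329 ∷
  2693303569 ∷ 9723681611 ∷ 3783527709 ∷ 5398732071 ∷ 5394636075 ∷ 8066078501 ∷ 2709752603 ∷ 6992037397 ∷
  3242593039 ∷ 12365402899 ∷ 2156595729 ∷ 3234403105 ∷ 1619563277 ∷ 2172881959 ∷ 8062178575 ∷ 7546246165 ∷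
  6459498031 ∷ 2189857825 ∷ 8074758169 ∷ 1632011809 ∷ 3766912285 ∷ 1627591193 ∷ 7533464615 ∷ 1632175655 ∷
  1627787789 ∷ 3263696153 ∷ 5403087663 ∷ 3242562065 ∷ 5377560359 ∷ 5394337575 ∷ 6459428623 ∷ 2156235281 ∷
  2156039189 ∷ 3263697177 ∷ 12395618931 ∷ 3251278105 ∷ 2173340689 ∷ 7529740117 ∷ 5377461545 ∷ 1619133709 ∷
  2726760741 ∷ 3767075879 ∷ 1619596059 ∷ 5385985333 ∷ 6451599921 ∷ 5914365229 ∷ 6996463909 ∷ 1628150797 ∷
  8611500813 ∷ 7529105679 ∷ 8078496795 ∷ 2156040465 ∷ 2160367641 ∷ 12928094019 ∷ 5914367789 ∷ 1619133709 ∷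
  3775138599 ∷ 3767241501 ∷ 2160760629 ∷ 1619133709 ∷ 2186185493 ∷ 13967920191 ∷ 2701401641 ∷ 5390311187 ∷
  7529106215 ∷ 10776449861 ∷ 20948300827 ∷ 3783822615 ∷ 3230145087 ∷ 3238399255 ∷ 7525077009 ∷ 5922854717 ∷
  2168948777 ∷ 3771076105 ∷ 2156041751 ∷ 16652571517 ∷ 1619395855 ∷ 3263697177 ∷ 2168948777 ∷ 1619136013 ∷
  1619133709 ∷ 18812056639 ∷ 5922853181 ∷ 1619133709 ∷ 1619133709 ∷ 2693205781 ∷ 2156044049 ∷ 6996592409 ∷
  5377724445 ∷ 2156039189 ∷ 16165410103 ∷ 1619395855 ∷ 2692943125 ∷ 1632012815 ∷ 5394337575 ∷ 2692943125 ∷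
  10218578979 ∷ 7525078329 ∷ 2710347581 ∷ 6996463909 ∷ 2709915927 ∷ 3775468831 ∷ 3771273517 ∷ 18275311439 ∷
  3230042393 ∷ 3783529257 ∷ 1619136781 ∷ 3783658783 ∷ 11829189159 ∷ 1632012815 ∷ 12910565939 ∷ 2693336341 ∷
  2173340689 ∷ 1636175123 ∷ 2156104209 ∷ 2156104209 ∷ 2156235281 ∷ 1619133709 ∷ 2739441437 ∷ 2172915519 ∷
  6468341781 ∷ 2697432329 ∷ 2172947491 ∷ 3817443365 ∷ 5914365229 ∷ 3229848085 ∷ 5914498349 ∷ 1627788813 ∷
  27944528975 ∷ 6996757293 ∷ 1619395855 ∷ 2168720937 ∷ 2701693481 ∷ 3238629397 ∷ 7525934439 ∷ 8061718813 ∷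
  7537764159 ∷ 2160561689 ∷ 5947921709 ∷ 6992037397 ∷ 1619596059 ∷ 2156104209 ∷ 1632011809 ∷ 3234236431 ∷
  6455166497 ∷ 3784018455 ∷ 3234239265 ∷ 1619136013 ∷ 2726760741 ∷ 2156040465 ∷ 5931472683 ∷ 2156041757 ∷
  5377786897 ∷ 12362126423 ∷ 1636175123 ∷ 1619494159 ∷ 3783527709 ∷ 6988108591 ∷ 1640304429 ∷ 3230142233 ∷
  8061584903 ∷ 6992037397 ∷ 2718339877 ∷ 3792115239 ∷ 3230109731 ∷ 2156040465 ∷ 12365370429 ∷ 6455530285 ∷
  10238790685 ∷ 2697432091 ∷ 9135953423 ∷ 1619133709 ∷ 5386343719 ∷ 1636502803 ∷ 8062178575 ∷ 2156402985 ∷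
  3775138599 ∷ 9673084729 ∷ 25247489397 ∷ 5394337575 ∷ 5390307859 ∷ 6455166497 ∷ 1619494159 ∷ 3234075941 ∷
  3796471339 ∷ 10784118305 ∷ 3779662611 ∷ 1619133709 ∷ 1619133709 ∷ 2735314211 ∷ 9744033137 ∷ 1619133709 ∷
  1619133709 ∷ 3234337061 ∷ 6996592409 ∷ 3817377831 ∷ 10209595725 ∷ 7567848775 ∷ 3783724305 ∷ 2709852445 ∷
  6468341781 ∷ 2168984873 ∷ 9136178207 ∷ 10217883931 ∷ 1619494159 ∷ 1619133709 ∷ 3234204193 ∷ 10751121443 ∷
  12361077017 ∷ 2692947511 ∷ 3242593039 ∷ 3229847321 ∷ 6455166497 ∷ 2156104209 ∷ 5940123183 ∷ 8598949131 ∷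
  6455166497 ∷ 5939762749 ∷ 2156073753 ∷ 3766750759 ∷ 6464047651 ∷ 16655910699 ∷ 2156104209 ∷ 3234073371 ∷
  5403022123 ∷ 3259469099 ∷ 22629066079 ∷ 2169014331 ∷ 1628148499 ∷ 3234239265 ∷ 2173342255 ∷ 2692943125 ∷
  7000656401 ∷ 7525078329 ∷ 3766881565 ∷ 3230304543 ∷ 3284668709 ∷ 3766750493 ∷ 7526334265 ∷ 1619133709 ∷
  1619430925 ∷ 3242593039 ∷ 3771273517 ∷ 1619494159 ∷ 3259469099 ∷ 2173340689 ∷ 2156562971 ∷ 3255340839 ∷
  2701661971 ∷ 10217590543 ∷ 3775402277 ∷ 5918428711 ∷ 5385753119 ∷ 3230010647 ∷ 9676393747 ∷ 3230010647 ∷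
  3238301747 ∷ 5935238183 ∷ 5939762749 ∷ 2156104209 ∷ 6460449347 ∷ 5377724713 ∷ 6472569367 ∷ 3766847773 ∷
  2177404691 ∷ 5377726249 ∷ 1619133709 ∷ 16132687735 ∷ 3775532581 ∷ 3234236453 ∷ 5390670631 ∷ 1619133709 ∷
  3230177051 ∷ 8602949157 ∷ 2169014553 ∷ 2156595729 ∷ 8078499113 ∷ 11841479717 ∷ 7005480755 ∷ 2692944149 ∷
  1619133709 ∷ 5377462569 ∷ 7530100053 ∷ 2692944149 ∷ 6523035439 ∷ 2168720955 ∷ 3766748701 ∷ 7525078329 ∷
  2156562971 ∷ 2169014553 ∷ 1627591449 ∷ 1627754527 ∷ 2693205781 ∷ 1627754527 ∷ 5914365229 ∷ 1640304427 ∷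
  1632078351 ∷ 7533464615 ∷ 6992037397 ∷ 3771175705 ∷ 1619133709 ∷ 5390799635 ∷ 5432613951 ∷ 1648954395 ∷
  2156039445 ∷ 13998109337 ∷ 2156039189 ∷ 3234269987 ∷ 7564309875 ∷ 1632078351 ∷ 5914366253 ∷ 6455166497 ∷
  2169014315 ∷ 6993980469 ∷ 5382313277 ∷ 5927280163 ∷ 6988175991 ∷ 3229846567 ∷ 3766881565 ∷ 1631818271 ∷
  3271987239 ∷ 3230306319 ∷ 9139521053 ∷ 5927800899 ∷ 5964831547 ∷ 1619133709 ∷ 3766750493 ∷ 7529736277 ∷
  2156038929 ∷ 2709852707 ∷ 3263697177 ∷ 3771271723 ∷ 12369529371 ∷ 8065844245 ∷ 8074695483 ∷ 3783822615 ∷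
  3779531539 ∷ 1619133709 ∷ 9135788873 ∷ 3796536351 ∷ 1632078351 ∷ 1619133709 ∷ 2173342235 ∷ 9139686431 ∷
  3230175263 ∷ 3234465845 ∷ 5407118103 ∷ 7533464615 ∷ 2160363321 ∷ 12365074967 ∷ 5956638495 ∷ 2189858589 ∷
  10222046489 ∷ 16664694053 ∷ 1619133709 ∷ 1632012815 ∷ 1631818259 ∷ 2172947489 ∷ 5914365229 ∷ 15586691885 ∷
  5394634803 ∷ 7530088277 ∷ 1619133709 ∷ 12424160331 ∷ 12370020937 ∷ 3783527709 ∷ 11820344179 ∷ 11857894727 ∷
  5927083831 ∷ 1619133709 ∷ 7529105679 ∷ 2692944149 ∷ 5977809463 ∷ 3251047447 ∷ 2156564759 ∷ 14035569801 ∷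
  6997393237 ∷ 2160561689 ∷ 3771076135 ∷ 1619133709 ∷ 3234075429 ∷ 14014860415 ∷ 2156269611 ∷ 2172947513 ∷
  10217883931 ∷ 1619494159 ∷ 1636175123 ∷ 2156104209 ∷ 2160593435 ∷ 3229849365 ∷ 2194348593 ∷ 6451269425 ∷
  3767075879 ∷ 1632012815 ∷ 7537529619 ∷ 2693336341 ∷ 7525868345 ∷ 3771171867 ∷ 3821706815 ∷ 1619133709 ∷
  7537529619 ∷ 1619135757 ∷ 1640304427 ∷ 6459428623 ∷ 1632012815 ∷ 2156104735 ∷ 6455233057 ∷ 5931734581 ∷
  2156595729 ∷ 3229847321 ∷ 1619136269 ∷ 1627948569 ∷ 3771171867 ∷ 3230109731 ∷ 10230761533 ∷ 2160593435 ∷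
  12940676931 ∷ 3234236431 ∷ 7052377207 ∷ 5390536219 ∷ 3766847773 ∷ 2161056283 ∷ 2156595729 ∷ 10763179847 ∷
  3234236453 ∷ 6480628255 ∷ 8083313709 ∷ 2156140073 ∷ 2156235281 ∷ 3817345317 ∷ 3230142233 ∷ 1619133709 ∷
  2156039445 ∷ 10227433263 ∷ 6459428623 ∷ 3242593039 ∷ 8095535909 ∷ 15595114289 ∷ 1619133709 ∷ 5956638495 ∷
  5377462573 ∷ 1619395855 ∷ 3229846809 ∷ 3230306319 ∷ 3771107877 ∷ 3242593039 ∷ 2160563225 ∷ 2172947489 ∷
  3263696153 ∷ 2701494567 ∷ 2701494567 ∷ 2156860943 ∷ 2186185493 ∷ 1619133709 ∷ 7529306683 ∷ 5940123183 ∷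
  11832658743 ∷ 3767243549 ∷ 3771076135 ∷ 6992498443 ∷ 5377560359 ∷ 3229846809 ∷ 1632078351 ∷ 15578835839 ∷
  2739441703 ∷ 3238496555 ∷ 2156104209 ∷ 2156039441 ∷ 2692944149 ∷ 1619133709 ∷ 20964610933 ∷ 5377460265 ∷
  7529738837 ∷ 3771171867 ∷ 2697432091 ∷ 6996592409 ∷ 1619133709 ∷ 3766850589 ∷ 6992498443 ∷ 16661325181 ∷
  2692944149 ∷ 9672695679 ∷ 2172914477 ∷ 1627754527 ∷ 6451269425 ∷ 3783724305 ∷ 7533536829 ∷ 7009539121 ∷
  1636371731 ∷ 2177404463 ∷ 10217590543 ∷ 9702218315 ∷ 2156039189 ∷ 2169183801 ∷ 1619494159 ∷ 3288896039 ∷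
  10217656077 ∷ 5407576903 ∷ 1619133709 ∷ 5402825519 ∷ 5914692907 ∷ 9676456981 ∷ 22578935193 ∷ 9135621397 ∷
  3766881565 ∷ 1619494159 ∷ 1632078351 ∷ 2693205781 ∷ 10217523741 ∷ 8065844245 ∷ 1627754527 ∷ 6463883819 ∷
  6459428623 ∷ 3238300445 ∷ 2156104735 ∷ 1619133709 ∷ 3230010647 ∷ 3230010647 ∷ 5377462573 ∷ 5382312509 ∷
  5914365229 ∷ 7064167989 ∷ 1632012815 ∷ 1632078351 ∷ 6468241183 ∷ 6459428623 ∷ 3766748701 ∷ 19877532273 ∷
  9676751895 ∷ 2156104209 ∷ 2156235281 ∷ 2160363321 ∷ 6996669501 ∷ 1619494159 ∷ 6459428623 ∷ 7529896799 ∷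
  1619133709 ∷ 3767080731 ∷ 9778143055 ∷ 2177404463 ∷ 1636371731 ∷ 1619136013 ∷ 6480628255 ∷ 3234403105 ∷
  2156038929 ∷ 1632078351 ∷ 3775337227 ∷ 1627591195 ∷ 2693368853 ∷ 8074759183 ∷ 2714178323 ∷ 3230010647 ∷
  1619133709 ∷ 2693368087 ∷ 28484507513 ∷ 5394537767 ∷ 13967920191 ∷ 24709705595 ∷ 2156104209 ∷ 2156235281 ∷
  3783822615 ∷ 7005477415 ∷ 1619133709 ∷ 2156039441 ∷ 9731450747 ∷ 9136182799 ∷ 1640304429 ∷ 2156038929 ∷
  5927444813 ∷ 1619430925 ∷ 3779531539 ∷ 1619133709 ∷ 1619133709 ∷ 1636240659 ∷ 3817345317 ∷ 7546246165 ∷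
  8078560039 ∷ 7550640683 ∷ 6988372557 ∷ 16664826907 ∷ 1632175655 ∷ 10747230567 ∷ 3234073371 ∷ 6459988511 ∷
  2156039445 ∷ 3234073371 ∷ 16116461419 ∷ 2160363321 ∷ 3230306319 ∷ 2156104209 ∷ 1636371483 ∷ 1619494159 ∷
  3779695659 ∷ 5377462057 ∷ 5377560359 ∷ 9676461329 ∷ 5394337575 ∷ 3255636507 ∷ 6451862819 ∷ 8074628115 ∷
  6459494923 ∷ 2693205781 ∷ 7558894373 ∷ 3238496555 ∷ 1619395855 ∷ 5382576449 ∷ 15594887999 ∷ 2173340689 ∷
  2718897437 ∷ 5441002279 ∷ 1619136781 ∷ 1619136269 ∷ 11840784937 ∷ 8061584903 ∷ 1627591193 ∷ 9681444111 ∷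
  1619133709 ∷ 1627883029 ∷ 6467850261 ∷ 9676392971 ∷ 6992561709 ∷ 1632078351 ∷ 2156104209 ∷ 2189857313 ∷
  9169244975 ∷ 2156595729 ∷ 1632011809 ∷ 12910565939 ∷ 2693303569 ∷ 1619133709 ∷ 1619133709 ∷ 5914498349 ∷
  1619395855 ∷ 2156104209 ∷ 3234236453 ∷ 3234403105 ∷ 3766748701 ∷ 1631819295 ∷ 2156041511 ∷ 5964831547 ∷
  2168952105 ∷ 10776454695 ∷ 5927307809 ∷ 2697697567 ∷ 1619133709 ∷ 3234240037 ∷ 10755482437 ∷ 2169014315 ∷
  3267923503 ∷ 8074695483 ∷ 1632078351 ∷ 1619133709 ∷ 16120034647 ∷ 5923446331 ∷ 2156106513 ∷ 1627719229 ∷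
  5914498349 ∷ 3783724305 ∷ 6996561679 ∷ 2156235281 ∷ 1632078351 ∷ 3276346145 ∷ 2156595729 ∷ 3796800557 ∷
  3229846809 ∷ 2156235281 ∷ 9676393747 ∷ 3775403027 ∷ 1631819295 ∷ 12398861637 ∷ 2156368143 ∷ 2156039189 ∷
  2701660947 ∷ 2160363321 ∷ 7000656401 ∷ 5407090461 ∷ 1636307749 ∷ 12357251165 ∷ 3784018455 ∷ 2156104735 ∷
  15586691885 ∷ 3766881565 ∷ 1619133709 ∷ 21010388593 ∷ 1619136269 ∷ 2157060907 ∷ 6451269425 ∷ 2160761625 ∷
  6481219631 ∷ 3796536351 ∷ 5931671855 ∷ 3255241507 ∷ 1619395855 ∷ 1619494159 ∷ 9672696191 ∷ 2693337387 ∷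
  3766748701 ∷ 3234403105 ∷ 3242593039 ∷ 9139817231 ∷ 9702675515 ∷ 7009539121 ∷ 3783920955 ∷ 2701660947 ∷
  3775402763 ∷ 3775468831 ∷ 5377464105 ∷ 7525571861 ∷ 6455166497 ∷ 8602715429 ∷ 1631913509 ∷ 6451898175 ∷
  3238300951 ∷ 2168984873 ∷ 3771174443 ∷ 5377462573 ∷ 10755188515 ∷ 1619133709 ∷ 3770946857 ∷ 2156040465 ∷
  10217523741 ∷ 9676456981 ∷ 3263696153 ∷ 2156367139 ∷ 20951404603 ∷ 1648954403 ∷ 3234204193 ∷ 1619395855 ∷
  1632012815 ∷ 1640433947 ∷ 6455166497 ∷ 3817377831 ∷ 1619494159 ∷ 1619133709 ∷ 6992103969 ∷ 2156271403 ∷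
  3771012411 ∷ 10217883931 ∷ 6996659757 ∷ 2156104209 ∷ 1627951897 ∷ 2693303569 ∷ 8066078245 ∷ 3234073371 ∷
  8074758169 ∷ 5432647227 ∷ 2156038929 ∷ 1619136269 ∷ 3792212767 ∷ 3230109731 ∷ 6996428583 ∷ 3238300951 ∷
  2173340727 ∷ 3238300951 ∷ 7538490719 ∷ 3229782549 ∷ 3229879575 ∷ 5973780031 ∷ 3230338083 ∷ 3766654503 ∷
  6472569367 ∷ 18822153589 ∷ 8078660677 ∷ 3263696153 ∷ 9139521053 ∷ 5407118103 ∷ 2169014315 ∷ 3766748701 ∷
  16127759895 ∷ 2156038929 ∷ 2156595729 ∷ 6505964869 ∷ 7546512969 ∷ 3766748701 ∷ 1619133709 ∷ 10217656077 ∷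
  5914461703 ∷ 6472766263 ∷ 1632175655 ∷ 7534393415 ∷ 3263696153 ∷ 3766748701 ∷ 1636307749 ∷ 1619135757 ∷
  2156104209 ∷ 2173340689 ∷ 6996561679 ∷ 3771273517 ∷ 5386180391 ∷ 3242593039 ∷ 3775402277 ∷ 1636371731 ∷
  2156860943 ∷ 1619133709 ∷ 1632045583 ∷ 11296247349 ∷ 2156238119 ∷ 3796536351 ∷ 1640599589 ∷ 5914365229 ∷
  2160758051 ∷ 5377462569 ∷ 3234073371 ∷ 3234831653 ∷ 2701401631 ∷ 1619596059 ∷ 6996596491 ∷ 2692944149 ∷
  6476435261 ∷ 2714178323 ∷ 3766748701 ∷ 11841479717 ∷ 2156042005 ∷ 1619133709 ∷ 15579069049 ∷ 18809540501 ∷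
  18824638805 ∷ 2156039189 ∷ 1619133709 ∷ 1619136815 ∷ 9673286775 ∷ 3783724305 ∷ 2173342223 ∷ 10751585141 ∷
  5377463081 ∷ 9680785165 ∷ 1632012815 ∷ 5440738091 ∷ 12897819943 ∷ 12366059559 ∷ 7525077009 ∷ 2701660947 ∷
  5407087693 ∷ 18272040227 ∷ 6996365071 ∷ 15578675833 ∷ 10209430549 ∷ 2156039189 ∷ 3255241507 ∷ 1619133709 ∷
  2156039189 ∷ 1619133709 ∷ 5386442061 ∷ 3766750493 ∷ 5377463081 ∷ 16127759895 ∷ 2701693481 ∷ 5381988105 ∷
  5394337575 ∷ 7529105679 ∷ 2160561689 ∷ 2697432329 ∷ 1619395855 ∷ 2156595729 ∷ 3766748701 ∷ 5918693947 ∷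
  6480628255 ∷ 6501868611 ∷ 7533332267 ∷ 2714735165 ∷ 3771141153 ∷ 18284318053 ∷ 5935896101 ∷ 3800436263 ∷
  1627951897 ∷ 2709950511 ∷ 8074695483 ∷ 9156431643 ∷ 9672852799 ∷ 6451269425 ∷ 2156595729 ∷ 10780351823 ∷
  3234204193 ∷ 3771107877 ∷ 2693303569 ∷ 3766748701 ∷ 8066110485 ∷ 3230010647 ∷ 1627754527 ∷ 2156040977 ∷
  15594887999 ∷ 9702641729 ∷ 1632078351 ∷ 1619133709 ∷ 1619133709 ∷ 33836523155 ∷ 1632011809 ∷ 2693337365 ∷
  5381985085 ∷ 8074763545 ∷ 1619494159 ∷ 12363253177 ∷ 1619430925 ∷ 2185729073 ∷ 2156271403 ∷ 3229846809 ∷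
  2169014553 ∷ 10746504551 ∷ 32767347303 ∷ 3271987239 ∷ 16131885895 ∷ 6459428623 ∷ 3766748701 ∷ 6472569367 ∷
  3783724305 ∷ 1619133709 ∷ 2156040465 ∷ 2156104209 ∷ 3259665213 ∷ 1627591449 ∷ 2709856029 ∷ 2156235281 ∷
  3783527709 ∷ 8065844245 ∷ 2156140329 ∷ 6480958497 ∷ 2172947489 ∷ 8602719013 ∷ 2697697567 ∷ 3766752029 ∷
  1619133709 ∷ 2693241627 ∷ 2156595729 ∷ 3229879575 ∷ 1619133709 ∷ 1619133709 ∷ 5377725471 ∷ 3817443365 ∷
  16656172341 ∷ 5377727565 ∷ 8074758169 ∷ 1636240659 ∷ 3779698219 ∷ 1632078351 ∷ 3242562065 ∷ 1619494159 ∷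
  1619133709 ∷ 6480628255 ∷ 13990043711 ∷ 2173275193 ∷ 6996566069 ∷ 1619133709 ∷ 22583759787 ∷ 1632078351 ∷
  3783724305 ∷ 2189857825 ∷ 2156663067 ∷ 1619135757 ∷ 2693205781 ∷ 1619133709 ∷ 3783527709 ∷ 1619133709 ∷
  1619133709 ∷ 8061584903 ∷ 3783527709 ∷ 3242791697 ∷ 5377465871 ∷ 8065844245 ∷ 1627948569 ∷ 7529731105 ∷
  5377725471 ∷ 2177403923 ∷ 1619133709 ∷ 6996463909 ∷ 2173341503 ∷ 2156235281 ∷ 2173341489 ∷ 2701661993 ∷
  16115542393 ∷ 1631946781 ∷ 12898206985 ∷ 10221947423 ∷ 1636307765 ∷ 2693205781 ∷ 16656373557 ∷ 7000497715 ∷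
  1619494159 ∷ 3766980157 ∷ 7546870363 ∷ 1619133709 ∷ 5931411263 ∷ 6459494923 ∷ 3234403105 ∷ 3766750493 ∷
  8070533647 ∷ 3234236431 ∷ 1619133709 ∷ 10751917901 ∷ 1640304433 ∷ 1619135757 ∷ 3783724305 ∷ 2701494567 ∷
  2156041511 ∷ 1619133709 ∷ 36044399865 ∷ 5919019075 ∷ 3817443365 ∷ 3229846567 ∷ 3238629411 ∷ 2156039445 ∷
  1619430925 ∷ 16689859621 ∷ 10762852119 ∷ 3243054397 ∷ 1619133709 ∷ 7009307437 ∷ 3766748701 ∷ 2194279969 ∷
  1619430925 ∷ 6459428623 ∷ 15582371649 ∷ 5377560359 ∷ 6996592409 ∷ 3771076105 ∷ 2168720937 ∷ 2693303569 ∷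
  8078560039 ∷ 6468341781 ∷ 8602719013 ∷ 3229846809 ∷ 1632306719 ∷ 9676461329 ∷ 9676751895 ∷ 2156038929 ∷
  3771171867 ∷ 2156238119 ∷ 5389946407 ∷ 6473268331 ∷ 1619133709 ∷ 10217590543 ∷ 1632078351 ∷ 3242791697 ∷
  5918428711 ∷ 2710511411 ∷ 1619395855 ∷ 7542413647 ∷ 2693205781 ∷ 1619133709 ∷ 16652447101 ∷ 6996992301 ∷
  8078499135 ∷ 3238300445 ∷ 5956900399 ∷ 7529313621 ∷ 2156367139 ∷ 2156040977 ∷ 18279441711 ∷ 9701824047 ∷
  2156104209 ∷ 1619133709 ∷ 3229879575 ∷ 5914461703 ∷ 10213330467 ∷ 1640433947 ∷ 11833684597 ∷ 7005480755 ∷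
  2693337365 ∷ 3771076105 ∷ 1627754527 ∷ 6523264817 ∷ 5922887465 ∷ 10747263615 ∷ 9139852333 ∷ 3230239767 ∷
  5398797877 ∷ 3229847321 ∷ 2156104209 ∷ 5923046941 ∷ 1619133709 ∷ 5440738091 ∷ 2160363317 ∷ 1619133709 ∷
  1619430925 ∷ 7529734433 ∷ 3234073371 ∷ 1619133709 ∷ 11825232703 ∷ 1619133709 ∷ 8070563855 ∷ 1619133709 ∷
  3817345317 ∷ 2156104735 ∷ 1627788813 ∷ 5914957359 ∷ 3238563861 ∷ 2156042257 ∷ 2168720937 ∷ 3771076105 ∷
  1632078351 ∷ 5394337575 ∷ 3783724305 ∷ 1619133709 ∷ 3775138599 ∷ 3229847321 ∷ 5382312509 ∷ 6996757293 ∷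
  5420031271 ∷ 1627591193 ∷ 3234237221 ∷ 3242658595 ∷ 6451269425 ∷ 2160363321 ∷ 8061847341 ∷ 3767177751 ∷
  3271987239 ∷ 12365704889 ∷ 3229846809 ∷ 5914366737 ∷ 6480958503 ∷ 3230175263 ∷ 2692944149 ∷ 6455760703 ∷
  5914365229 ∷ 6468145957 ∷ 3230042393 ∷ 2714672933 ∷ 3779400485 ∷ 13994664309 ∷ 16653401631 ∷ 1619430925 ∷
  10751905613 ∷ 5407118103 ∷ 1636242981 ∷ 1632078351 ∷ 3766881565 ∷ 2160561689 ∷ 5918922029 ∷ 3783724305 ∷
  2156104209 ∷ 2156040465 ∷ 2173342235 ∷ 3766750493 ∷ 2709915927 ∷ 2693205781 ∷ 1632078351 ∷ 6455166497 ∷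
  1619133709 ∷ 1632078351 ∷ 9676461329 ∷ 3238269743 ∷ 1619133709 ∷ 7551231849 ∷ 12374151185 ∷ 2693205781 ∷
  2172947491 ∷ 6988965685 ∷ 6498099273 ∷ 1619135757 ∷ 9720280153 ∷ 1619133709 ∷ 5377462569 ∷ 8079218491 ∷
  6510517031 ∷ 1619133709 ∷ 3771140631 ∷ 2206733609 ∷ 10217590543 ∷ 2693205781 ∷ 9676456981 ∷ 10746601295 ∷
  2169473065 ∷ 3796471339 ∷ 16673019191 ∷ 18267442215 ∷ 2697432329 ∷ 9676393747 ∷ 1619133709 ∷ 3230042393 ∷
  22579131003 ∷ 10217883931 ∷ 2693241627 ∷ 6996592409 ∷ 6451601229 ∷ 2172883473 ∷ 2173340727 ∷ 1619133709 ∷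
  7529727829 ∷ 1632012815 ∷ 16664631845 ∷ 6468145957 ∷ 3234403105 ∷ 1627984659 ∷ 6459428623 ∷ 6996365071 ∷
  1619494159 ∷ 12369862171 ∷ 15624639521 ∷ 8078498089 ∷ 5947921709 ∷ 3234236431 ∷ 3775337227 ∷ 1619133709 ∷
  3792114455 ∷ 5377528875 ∷ 6455530285 ∷ 1619133709 ∷ 5407118103 ∷ 2156564759 ∷ 3766847773 ∷ 2156041511 ∷
  9676751895 ∷ 1619494159 ∷ 1631913509 ∷ 3234465821 ∷ 3234237221 ∷ 1619133709 ∷ 6455233057 ∷ 6996661565 ∷
  2692943125 ∷ 3234236453 ∷ 3766654503 ∷ 2693303569 ∷ 1619133709 ∷ 5973452381 ∷ 2168948777 ∷ 2177574431 ∷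
  17210385487 ∷ 3229847591 ∷ 5415243301 ∷ 6996365071 ∷ 3766748701 ∷ 6455859009 ∷ 7529301265 ∷ 1619133709 ∷
  1644695833 ∷ 5931145023 ∷ 1632078351 ∷ 2156104735 ∷ 2169014315 ∷ 3230142233 ∷ 1619133709 ∷ 1619133709 ∷
  3242658595 ∷ 2692944149 ∷ 3230109731 ∷ 3242593039 ∷ 5377560359 ∷ 9152630305 ∷ 10209595725 ∷ 1640304429 ∷
  2156104209 ∷ 5390536219 ∷ 1619430925 ∷ 2156044049 ∷ 5914990201 ∷ 5923046693 ∷ 7525086819 ∷ 5914367277 ∷
  8061818153 ∷ 10221947423 ∷ 5914398513 ∷ 2697432091 ∷ 2156106513 ∷ 5914498349 ∷ 2156038929 ∷ 3783724305 ∷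
  2723125817 ∷ 3234073371 ∷ 2156236585 ∷ 3783527709 ∷ 1619133709 ∷ 2156238119 ∷ 6463883819 ∷ 2714178323 ∷
  8074763545 ∷ 3766850589 ∷ 2156041511 ∷ 5923411523 ∷ 1619133709 ∷ 5390536219 ∷ 11820547929 ∷ 5914367277 ∷
  5381986093 ∷ 1619133709 ∷ 2160825369 ∷ 15578641269 ∷ 1627788051 ∷ 6451598641 ∷ 2156041511 ∷ 2172914477 ∷
  2160758051 ∷ 9143846431 ∷ 2156628497 ∷ 1640336677 ∷ 7525077009 ∷ 3255373609 ∷ 3771175705 ∷ 2156040465 ∷
  3783658783 ∷ 3817443365 ∷ 5415243301 ∷ 16653858941 ∷ 1619133709 ∷ 5914461703 ∷ 9139521053 ∷ 6988271373 ∷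
  1619133709 ∷ 5381988105 ∷ 2177572401 ∷ 6992569679 ∷ 5914463565 ∷ 1627754527 ∷ 1627591195 ∷ 3783527709 ∷
  3259665709 ∷ 1619133709 ∷ 8074758169 ∷ 3251047447 ∷ 2156038929 ∷ 2172883473 ∷ 5939762749 ∷ 2156238119 ∷
  3242593039 ∷ 3259469099 ∷ 2697859103 ∷ 2714178323 ∷ 3767177763 ∷ 5407056441 ∷ 2156140073 ∷ 10217887037 ∷
  8598490385 ∷ 2726760741 ∷ 2160363321 ∷ 2697694509 ∷ 6996365071 ∷ 6451269425 ∷ 3775368765 ∷ 1619133709 ∷
  9701824047 ∷ 3238300445 ∷ 2156567337 ∷ 3771141153 ∷ 5390799635 ∷ 9203424815 ∷ 5377463081 ∷ 1619133709 ∷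
  1619133709 ∷ 6489215023 ∷ 9680785165 ∷ 11820315481 ∷ 8070563855 ∷ 3771178797 ∷ 8086984493 ∷ 9144048189 ∷
  1648954403 ∷ 3234236453 ∷ 1619136781 ∷ 1619133709 ∷ 5931243305 ∷ 7541790505 ∷ 7529105679 ∷ 3263697177 ∷
  1619133709 ∷ 2156104735 ∷ 1627787789 ∷ 6996365071 ∷ 3238300951 ∷ 5377462569 ∷ 1619133709 ∷ 1632078351 ∷
  3771473709 ∷ 3238300445 ∷ 3234075941 ∷ 1619135757 ∷ 8065844245 ∷ 3242561575 ∷ 10259993119 ∷ 3259665709 ∷
  1619133709 ∷ 3229848345 ∷ 3767175455 ∷ 2156595729 ∷ 30624027517 ∷ 5415243301 ∷ 16124459899 ∷ 2206733609 ∷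
  3242593039 ∷ 2156566289 ∷ 18821750319 ∷ 9152630305 ∷ 1632078351 ∷ 5927083831 ∷ 2156038929 ∷ 1619133709 ∷
  7534394421 ∷ 2701889563 ∷ 3238563861 ∷ 3288896039 ∷ 2177602069 ∷ 3242593039 ∷ 1619133709 ∷ 7571345443 ∷
  8062174525 ∷ 8602715429 ∷ 1619133709 ∷ 2693336341 ∷ 6480992027 ∷ 2168948777 ∷ 5914367277 ∷ 7525306169 ∷
  3783923483 ∷ 1619395855 ∷ 9140050703 ∷ 1619133709 ∷ 3783529257 ∷ 2156235281 ∷ 6451861807 ∷ 5390799635 ∷
  5382310973 ∷ 5377725483 ∷ 8071789659 ∷ 2169014315 ∷ 1636371483 ∷ 2181597981 ∷ 2693303569 ∷ 5931667791 ∷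
  12910565939 ∷ 8078560039 ∷ 2160757273 ∷ 5999106885 ∷ 2692944149 ∷ 3771141153 ∷ 1619133709 ∷ 11828960799 ∷ []

abstract
  -- The 16664 numbers `19 + 6 i` end at 99997, the last number below 100000 that is 1 modulo 6.
  primeTable-covers : allCovered primeTest symmetricCandidate 16664 19 primeTable ≡ true
  primeTable-covers = refl

-- The constant guess 0 always fails, all points but one being 0, so every prime has its own entry.
eisensteinTable : List ℕ
eisensteinTable =
  69257535747 ∷ 69256491315 ∷ 86437410129 ∷ 69258654003 ∷ 69004829202 ∷ 69004829202 ∷ 69005877552 ∷ 215287600722 ∷
  69006787361 ∷ 357293889111 ∷ 69004829202 ∷ 215303394130 ∷ 69256491315 ∷ 215023503201 ∷ 69004829202 ∷ 69257535747 ∷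
  69256556851 ∷ 69256491315 ∷ 69004829202 ∷ 69005878064 ∷ 90736705588 ∷ 69005878064 ∷ 490438989655 ∷ 69258654003 ∷
  214800167252 ∷ 69004829202 ∷ 357093611365 ∷ 69258654003 ∷ 69256491315 ∷ 215290549557 ∷ 69004829202 ∷ 69004829202 ∷
  69005877552 ∷ []

abstract
  -- The 52 numbers `5 + 6 i` end at 311; the next one, 317, has the square 100489.
  eisensteinTable-covers : allCovered eisensteinTest (λ _ → 0) 52 5 eisensteinTable ≡ true
  eisensteinTable-covers = refl

-- Fields of order 169 and 2197

module CubicOperations {A : Set} (_+_ _*_ : Op₂ A) (neg : Op₁ A) (t : A) where
  _+³_ _*³_ : Op₂ (A × A × A)
  (a , b , c) +³ (d , e , f) = (a + d) , (b + e) , (c + f)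
  (a , b , c) *³ (d , e , f) =
    ((a * d) + (t * ((b * f) + (c * e)))) , (((a * e) + (b * d)) + (t * (c * f))) , (((a * f) + (b * e)) + (c * d))
  neg³ : Op₁ (A × A × A)
  neg³ (a , b , c) = neg a , neg b , neg c

-- K[X]/(X³ - t)
module CubicExtension {q : ℕ} (K : FiniteDomain q) (t : FiniteDomain.Carrier K) where
  open FiniteDomain K
  open CommutativeRing commutativeRing using (commutativeSemiring; +-assoc; +-comm; +-identityˡ; -‿inverseˡ)
  open import Algebra.Solver.Ring.NaturalCoefficients.Default commutativeSemiring
  open CubicOperations _+_ _*_ -_ t public

  0³ 1³ : Carrier × Carrier × Carrier
  0³ = 0# , 0# , 0#
  1³ = 1# , 0# , 0#

  cong₃ : ∀ {a a′ b b′ c c′ : Carrier} → a ≡ a′ → b ≡ b′ → c ≡ c′ → (a , b , c) ≡ (a′ , b′ , c′)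
  cong₃ refl refl refl = refl

  *³-assoc : ∀ x y z → (x *³ y) *³ z ≡ x *³ (y *³ z)
  *³-assoc (a , b , c) (d , e , f) (g , h , i) = cong₃
    (solve 10 (λ a b c d e f g h i t →
      (a :* d :+ t :* (b :* f :+ c :* e)) :* g :+ t :* ((a :* e :+ b :* d :+ t :* (c :* f)) :* i :+ (a :* f :+ b :* e :+ c :* d) :* h) :=
      a :* (d :* g :+ t :* (e :* i :+ f :* h)) :+ t :* (b :* (d :* i :+ e :* h :+ f :* g) :+ c :* (d :* h :+ e :* g :+ t :* (f :* i)))) refl a b c d e f g h i t)
    (solve 10 (λ a b c d e f g h i t →
      (a :* d :+ t :* (b :* f :+ c :* e)) :* h :+ (a :* e :+ b :* d :+ t :* (c :* f)) :* g :+ t :* ((a :* f :+ b :* e :+ c :* d) :* i) :=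
      a :* (d :* h :+ e :* g :+ t :* (f :* i)) :+ b :* (d :* g :+ t :* (e :* i :+ f :* h)) :+ t :* (c :* (d :* i :+ e :* h :+ f :* g))) refl a b c d e f g h i t)
    (solve 10 (λ a b c d e f g h i t →
      (a :* d :+ t :* (b :* f :+ c :* e)) :* i :+ (a :* e :+ b :* d :+ t :* (c :* f)) :* h :+ (a :* f :+ b :* e :+ c :* d) :* g :=
      a :* (d :* i :+ e :* h :+ f :* g) :+ b :* (d :* h :+ e :* g :+ t :* (f :* i)) :+ c :* (d :* g :+ t :* (e :* i :+ f :* h))) refl a b c d e f g h i t)

  isCommutativeRing³ : IsCommutativeRing _≡_ _+³_ _*³_ neg³ 0³ 1³
  isCommutativeRing³ = isCommutativeRing≡
    (λ x y z → cong₃ (+-assoc _ _ _) (+-assoc _ _ _) (+-assoc _ _ _))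
    (λ x y → cong₃ (+-comm _ _) (+-comm _ _) (+-comm _ _))
    (λ x → cong₃ (+-identityˡ _) (+-identityˡ _) (+-identityˡ _))
    (λ x → cong₃ (-‿inverseˡ _) (-‿inverseˡ _) (-‿inverseˡ _))
    *³-assoc
    (λ { (a , b , c) (d , e , f) → cong₃
      (solve 7 (λ a b c d e f t → a :* d :+ t :* (b :* f :+ c :* e) := d :* a :+ t :* (e :* c :+ f :* b)) refl a b c d e f t)
      (solve 7 (λ a b c d e f t → a :* e :+ b :* d :+ t :* (c :* f) := d :* b :+ e :* a :+ t :* (f :* c)) refl a b c d e f t)
      (solve 6 (λ a b c d e f → a :* f :+ b :* e :+ c :* d := d :* c :+ e :* b :+ f :* a) refl a b c d e f) })
    (λ { (a , b , c) → cong₃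
      (solve 4 (λ a b c t → con 1 :* a :+ t :* (con 0 :* c :+ con 0 :* b) := a) refl a b c t)
      (solve 4 (λ a b c t → con 1 :* b :+ con 0 :* a :+ t :* (con 0 :* c) := b) refl a b c t)
      (solve 3 (λ a b c → con 1 :* c :+ con 0 :* b :+ con 0 :* a := c) refl a b c) })
    (λ { (a , b , c) (d , e , f) (g , h , i) → cong₃
      (solve 10 (λ a b c d e f g h i t → a :* (d :+ g) :+ t :* (b :* (f :+ i) :+ c :* (e :+ h)) :=
        (a :* d :+ t :* (b :* f :+ c :* e)) :+ (a :* g :+ t :* (b :* i :+ c :* h))) refl a b c d e f g h i t)
      (solve 10 (λ a b c d e f g h i t → a :* (e :+ h) :+ b :* (d :+ g) :+ t :* (c :* (f :+ i)) :=
        (a :* e :+ b :* d :+ t :* (c :* f)) :+ (a :* h :+ b :* g :+ t :* (c :* i))) refl a b c d e f g h i t)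
      (solve 9 (λ a b c d e f g h i → a :* (f :+ i) :+ b :* (e :+ h) :+ c :* (d :+ g) :=
        (a :* f :+ b :* e :+ c :* d) :+ (a :* i :+ b :* h :+ c :* g)) refl a b c d e f g h i) })

  cubicDomain : (∀ x y → x *³ y ≡ 0³ → x ≡ 0³ ⊎ y ≡ 0³) → FiniteDomain (q ℕ.* (q ℕ.* q))
  cubicDomain integral³ = record
    { Carrier = Carrier × Carrier × Carrier
    ; enum = ↔-sym *↔× ↔-∘ (enum ×-↔ (↔-sym *↔× ↔-∘ (enum ×-↔ enum)))
    ; _+_ = _+³_ ; _*_ = _*³_ ; -_ = neg³ ; 0# = 0³ ; 1# = 1³
    ; isCommutativeRing = isCommutativeRing³
    ; 0≢1 = λ eq → 0≢1 (,-injectiveˡ eq)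
    ; integral = integral³
    }

inverses⇒integral : ∀ {A : Set} {_+_ _*_ : Op₂ A} {neg : Op₁ A} {0# 1# : A} → IsCommutativeRing _≡_ _+_ _*_ neg 0# 1# →
  (∀ x → x ≡ 0# ⊎ ∃ λ y → x * y ≡ 1#) → ∀ x y → x * y ≡ 0# → x ≡ 0# ⊎ y ≡ 0#
inverses⇒integral {_*_ = _*_} isRing inverse x y xy≡0 with inverse x
... | inj₁ x≡0 = inj₁ x≡0
... | inj₂ (z , xz≡1) = inj₂ (trans (sym (*-identityˡ y)) (trans (cong (_* y) (trans (sym xz≡1) (*-comm x z)))
  (trans (*-assoc z x y) (trans (cong (z *_) xy≡0) (zeroʳ z)))))
  where open IsCommutativeRing isRing using (*-identityˡ; *-comm; *-assoc; zeroʳ)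

allBelow : ℕ → (ℕ → Bool) → Bool
allBelow zero    f = true
allBelow (suc k) f = f k ∧ allBelow k f

allBelow-sound : ∀ k f → allBelow k f ≡ true → ∀ {i} → i ℕ.< k → f i ≡ true
allBelow-sound (suc k) f eq {i} (s≤s i≤k) with ℕ.m≤n⇒m<n∨m≡n i≤k
... | inj₁ i<k  = allBelow-sound k f (proj₂ (∧-true {f k} eq)) i<k
... | inj₂ refl = proj₁ (∧-true eq)

∨-true : ∀ {a b} → a ∨ b ≡ true → a ≡ true ⊎ b ≡ true
∨-true {true}  eq = inj₁ eq
∨-true {false} eq = inj₂ eq

==-sound : ∀ {p} {x y : ℤ/ p} → (x == y) ≡ true → x ≡ y
==-sound {x = x} {y} eq = val-injective (ℕ.≡ᵇ⇒≡ (val x) (val y) (subst Bool.T (sym eq) _))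

==²-sound : ∀ {p} {x y : ℤ/ p × ℤ/ p} → (x ==² y) ≡ true → x ≡ y
==²-sound {x = a , b} {c , d} eq = cong₂ _,_ (==-sound (proj₁ (∧-true {a == c} eq))) (==-sound (proj₂ (∧-true {a == c} eq)))

_==³_ : ∀ {p} → ℤ/ p × ℤ/ p × ℤ/ p → ℤ/ p × ℤ/ p × ℤ/ p → Bool
(a , x) ==³ (b , y) = (a == b) ∧ (x ==² y)

==³-sound : ∀ {p} {x y : ℤ/ p × ℤ/ p × ℤ/ p} → (x ==³ y) ≡ true → x ≡ y
==³-sound {x = a , _} {b , _} eq = cong₂ _,_ (==-sound (proj₁ (∧-true {a == b} eq))) (==²-sound (proj₂ (∧-true {a == b} eq)))

==²-refl : ∀ {p} (x : ℤ/ p × ℤ/ p) → (x ==² x) ≡ true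
==²-refl (a , b) = cong₂ _∧_ (≡ᵇ-refl (val a)) (≡ᵇ-refl (val b))

==³-refl : ∀ {p} (x : ℤ/ p × ℤ/ p × ℤ/ p) → (x ==³ x) ≡ true
==³-refl (a , x) = cong₂ _∧_ (≡ᵇ-refl (val a)) (==²-refl x)

module Thirteen where
  open Residues 13

  val<13 : ∀ (x : ℤ/ 13) → val x ℕ.< 13
  val<13 (residue k k<13) = recompute (k ℕ.<? 13) k<13

  F₁₃ : FiniteDomain 13
  F₁₃ = primeField (from-yes (prime? 13))

  open QuadraticExtension F₁₃ [ 0 ] [ 2 ] using (_+²_; _*²_; neg²; 0²; 1²; isCommutativeRing²; quadraticDomain)
  open CubicExtension F₁₃ [ 2 ] using (_+³_; _*³_; neg³; 0³; 1³; isCommutativeRing³; cubicDomain)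

  module Power² = FastPower _*²_ 1²
  module Power³ = FastPower _*³_ 1³

  abstract
    -- In a field of order q the inverse of x is `x^(q - 2)`, and `167 = 169 - 2`,
    -- `2195 = 2197 - 2`. The check succeeds because 2 is neither a square nor a cube modulo 13, so
    -- that `X² - 2` and `X³ - 2` are irreducible.
    invertible² : ℤ/ 13 × ℤ/ 13 → Bool
    invertible² x = (x ==² 0²) ∨ ((x *² Power².fastPower 8 x 167) ==² 1²)

    invertible³ : ℤ/ 13 × ℤ/ 13 × ℤ/ 13 → Bool
    invertible³ x = (x ==³ 0³) ∨ ((x *³ Power³.fastPower 12 x 2195) ==³ 1³)

    invertible²-sound : ∀ x → invertible² x ≡ true → x ≡ 0² ⊎ ∃ λ y → x *² y ≡ 1²
    invertible²-sound x eq = ⊎.map ==²-sound (λ eq → Power².fastPower 8 x 167 , ==²-sound eq)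
      (∨-true {x ==² 0²} {(x *² Power².fastPower 8 x 167) ==² 1²} eq)

    invertible³-sound : ∀ x → invertible³ x ≡ true → x ≡ 0³ ⊎ ∃ λ y → x *³ y ≡ 1³
    invertible³-sound x eq = ⊎.map ==³-sound (λ eq → Power³.fastPower 12 x 2195 , ==³-sound eq)
      (∨-true {x ==³ 0³} {(x *³ Power³.fastPower 12 x 2195) ==³ 1³} eq)

    all-invertible² : allBelow 13 (λ a → allBelow 13 λ b → invertible² ([ a ] , [ b ])) ≡ true
    all-invertible² = refl

    all-invertible³ : allBelow 13 (λ a → allBelow 13 λ b → allBelow 13 λ c → invertible³ ([ a ] , [ b ] , [ c ])) ≡ true
    all-invertible³ = refl

  inverse² : ∀ x → x ≡ 0² ⊎ ∃ λ y → x *² y ≡ 1²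
  inverse² x@(a , b) = invertible²-sound x (subst₂ (λ a b → invertible² (a , b) ≡ true) ([]-val a) ([]-val b)
    (allBelow-sound 13 (λ b → invertible² ([ val a ] , [ b ]))
      (allBelow-sound 13 (λ a → allBelow 13 λ b → invertible² ([ a ] , [ b ])) all-invertible² (val<13 a)) (val<13 b)))

  inverse³ : ∀ x → x ≡ 0³ ⊎ ∃ λ y → x *³ y ≡ 1³
  inverse³ x@(a , b , c) = invertible³-sound x
    (subst (λ a → invertible³ (a , b , c) ≡ true) ([]-val a) (subst₂ (λ b c → invertible³ ([ val a ] , b , c) ≡ true) ([]-val b) ([]-val c)
      (allBelow-sound 13 (λ c → invertible³ ([ val a ] , [ val b ] , [ c ]))
        (allBelow-sound 13 (λ b → allBelow 13 λ c → invertible³ ([ val a ] , [ b ] , [ c ]))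
          (allBelow-sound 13 (λ a → allBelow 13 λ b → allBelow 13 λ c → invertible³ ([ a ] , [ b ] , [ c ])) all-invertible³ (val<13 a)) (val<13 b)) (val<13 c))))

  F₁₆₉ : FiniteDomain (13 ℕ.* 13)
  F₁₆₉ = quadraticDomain (inverses⇒integral isCommutativeRing² inverse²)

  F₂₁₉₇ : FiniteDomain (13 ℕ.* (13 ℕ.* 13))
  F₂₁₉₇ = cubicDomain (inverses⇒integral isCommutativeRing³ inverse³)

  plane₁₆₉ : Fin 7 → ℤ/ 13 × ℤ/ 13
  plane₁₆₉ 0F = [ 0 ]  , [ 0 ]
  plane₁₆₉ 1F = [ 1 ]  , [ 0 ]
  plane₁₆₉ 2F = [ 2 ]  , [ 0 ]
  plane₁₆₉ 3F = [ 4 ]  , [ 0 ]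
  plane₁₆₉ 4F = [ 5 ]  , [ 0 ]
  plane₁₆₉ 5F = [ 10 ] , [ 1 ]
  plane₁₆₉ 6F = [ 8 ]  , [ 6 ]

  baseFamily₁₆₉ : BaseFamily (13 ℕ.* 13)
  baseFamily₁₆₉ = test⇒baseFamily plane₁₆₉ refl
    where open RainbowTestSound {n = 28} F₁₆₉ refl _==²_ ==²-refl

  plane₂₁₉₇ : Fin 7 → ℤ/ 13 × ℤ/ 13 × ℤ/ 13
  plane₂₁₉₇ 0F = [ 0 ] , [ 0 ] , [ 0 ]
  plane₂₁₉₇ 1F = [ 1 ] , [ 0 ] , [ 0 ]
  plane₂₁₉₇ 2F = [ 2 ] , [ 0 ] , [ 0 ]
  plane₂₁₉₇ 3F = [ 1 ] , [ 2 ] , [ 0 ]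
  plane₂₁₉₇ 4F = [ 2 ] , [ 2 ] , [ 0 ]
  plane₂₁₉₇ 5F = [ 2 ] , [ 1 ] , [ 2 ]
  plane₂₁₉₇ 6F = [ 2 ] , [ 1 ] , [ 1 ]

  baseFamily₂₁₉₇ : BaseFamily (13 ℕ.* (13 ℕ.* 13))
  baseFamily₂₁₉₇ = test⇒baseFamily plane₂₁₉₇ refl
    where open RainbowTestSound {n = 366} F₂₁₉₇ refl _==³_ ==³-refl

-- Orders all of whose maximal prime power factors are admissible

large⇒baseFamily : ∀ {q n} → FiniteDomain q → q ≡ suc (6 ℕ.* n) → 100000 ℕ.≤ q → BaseFamily q
large⇒baseFamily {q} {n} D q≡ large = let b , rainbow = rainbowPlane in rainbow⇒baseFamily b rainbow
  where open LargeField {q} {n} D q≡ large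

quotient-remainder : ∀ {k} r → k % 6 ≡ r → k ≡ r ℕ.+ 6 ℕ.* (k / 6)
quotient-remainder {k} r eq = trans (m≡m%n+[m/n]*n k 6) (cong₂ ℕ._+_ eq (ℕ.*-comm (k / 6) 6))

primeTest⇒baseFamily : ∀ {p w} → Prime p → p % 6 ≡ 1 → primeTest p w ≡ true → BaseFamily p
primeTest⇒baseFamily {p@(suc _)} {w} p-prime p%6≡1 = test⇒baseFamily (PrimeTest.primePlane p w)
  where open RainbowTestSound {n = p / 6} (primeField p-prime) (quotient-remainder 1 p%6≡1) _==_ (≡ᵇ-refl ∘ val)

prime⇒baseFamily : ∀ {p} → Prime p → p % 6 ≡ 1 → p ≢ 13 → BaseFamily p
prime⇒baseFamily {p} p-prime p%6≡1 p≢13 with 100000 ℕ.≤? p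
... | yes large = large⇒baseFamily {n = p / 6} (primeField p-prime) (quotient-remainder 1 p%6≡1) large
... | no  small = findPlane (p / 6) (quotient-remainder 1 p%6≡1)
  where
  findPlane : ∀ n → p ≡ suc (6 ℕ.* n) → BaseFamily p
  findPlane 0 refl = contradiction (prime⇒nonTrivial p-prime) λ ()
  -- For p = 7 the plane fills the field; 6 is the code of the symmetric plane with β = 3.
  findPlane 1 refl = primeTest⇒baseFamily {w = 6} p-prime p%6≡1 refl
  findPlane 2 refl = contradiction refl p≢13
  findPlane (suc (suc (suc i))) p≡ =
    [ (λ composite → contradiction (subst Composite (sym p≡i6+19) composite) (prime⇒¬composite p-prime))
    , (λ { (w , test) → primeTest⇒baseFamily {w = w} p-prime p%6≡1 (subst (λ m → primeTest m w ≡ true) (sym p≡i6+19) test) }) ]′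
    (allCovered-sound primeTest symmetricCandidate 16664 19 primeTable primeTable-covers i i<)
    where
    reorder : ∀ i → suc (6 ℕ.* (3 ℕ.+ i)) ≡ i ℕ.* 6 ℕ.+ 19
    reorder = solve-∀
    p≡i6+19 : p ≡ i ℕ.* 6 ℕ.+ 19
    p≡i6+19 = trans p≡ (reorder i)
    i< : i ℕ.< 16664
    i< = ℕ.≰⇒> λ le → small (subst (100000 ℕ.≤_) (sym p≡i6+19)
      (ℕ.≤-trans (ℕ.m≤m+n 100000 3) (ℕ.+-monoˡ-≤ 19 (ℕ.*-monoˡ-≤ 6 le))))

eisensteinField : ∀ {p} → Prime p → p % 6 ≡ 5 → FiniteDomain (p ℕ.* p)
eisensteinField {p} p-prime p%6≡5 = eisensteinDomain 3≢0
  where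
  instance
    p≢0 : NonZero p
    p≢0 = prime⇒nonZero p-prime
  p≡ : p ≡ 5 ℕ.+ 6 ℕ.* (p / 6)
  p≡ = quotient-remainder 5 p%6≡5
  open Residues p
  open Eisenstein {j = p / 6} (primeField p-prime) (trans p≡ (cong suc (ℕ.+-comm 4 (6 ℕ.* (p / 6)))))
  small : ∀ k → k ℕ.< 5 → k % p ≡ k
  small k k<5 = m<n⇒m%n≡m (ℕ.<-≤-trans k<5 (ℕ.≤-trans (ℕ.m≤m+n 5 _) (ℕ.≤-reflexive (sym p≡))))
  3≢0 : ([ 1 ] + [ 1 ]) + [ 1 ] ≢ [ 0 ]
  3≢0 eq = contradiction (begin
    3                                  ≡⟨ small 3 (s≤s (s≤s (s≤s (s≤s z≤n)))) ⟨
    val [ 3 ]                          ≡⟨ cong val (trans (cong (_+ [ 1 ]) ([]-+ 1 1)) ([]-+ 2 1)) ⟨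
    val (([ 1 ] + [ 1 ]) + [ 1 ])      ≡⟨ cong val eq ⟩
    val [ 0 ]                          ≡⟨ small 0 (s≤s z≤n) ⟩
    0                                  ∎) λ ()
    where open ≡-Reasoning

square%6≡1 : ∀ {p} → p % 6 ≡ 5 → p ℕ.* p % 6 ≡ 1
square%6≡1 {p} p%6≡5 = trans (%-distribˡ-* p p 6) (cong (λ r → r ℕ.* r % 6) p%6≡5)

eisensteinTest⇒baseFamily : ∀ {p w} → Prime p → p % 6 ≡ 5 → eisensteinTest p w ≡ true → BaseFamily (p ℕ.* p)
eisensteinTest⇒baseFamily {p@(suc _)} {w} p-prime p%6≡5 = test⇒baseFamily (eisensteinPlane p w)
  where open RainbowTestSound {n = p ℕ.* p / 6} (eisensteinField p-prime p%6≡5) (quotient-remainder 1 (square%6≡1 {p} p%6≡5)) _==²_ ==²-refl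

primeSquare⇒baseFamily : ∀ {p} → Prime p → p % 6 ≡ 5 → BaseFamily (p ℕ.* p)
primeSquare⇒baseFamily {p} p-prime p%6≡5 with 100000 ℕ.≤? p ℕ.* p
... | yes large = large⇒baseFamily {n = p ℕ.* p / 6} (eisensteinField p-prime p%6≡5) (quotient-remainder 1 (square%6≡1 {p} p%6≡5)) large
... | no  small = [ (λ composite → contradiction (subst Composite (sym p≡) composite) (prime⇒¬composite p-prime))
                  , (λ { (w , test) → eisensteinTest⇒baseFamily {w = w} p-prime p%6≡5 (subst (λ m → eisensteinTest m w ≡ true) (sym p≡) test) }) ]′
                  (allCovered-sound eisensteinTest (λ _ → 0) 52 5 eisensteinTable eisensteinTable-covers j j<)
  where
  j = p / 6
  p≡ : p ≡ j ℕ.* 6 ℕ.+ 5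
  p≡ = trans (quotient-remainder 5 p%6≡5) (trans (ℕ.+-comm 5 (6 ℕ.* j)) (cong (ℕ._+ 5) (ℕ.*-comm 6 j)))
  j< : j ℕ.< 52
  j< = ℕ.≰⇒> λ le → small (ℕ.≤-trans (ℕ.m≤m+n 100000 489) (ℕ.*-mono-≤ (317≤p le) (317≤p le)))
    where
    317≤p : 52 ℕ.≤ j → 317 ℕ.≤ p
    317≤p le = subst (317 ℕ.≤_) (sym p≡) (ℕ.+-monoˡ-≤ 5 (ℕ.*-monoˡ-≤ 6 le))

powerBaseFamily : ∀ {v} → BaseFamily v → ∀ k → BaseFamily (v ℕ.^ k)
powerBaseFamily B zero    = trivialBaseFamily
powerBaseFamily B (suc k) = productBaseFamily B (powerBaseFamily B k)

-- Every exponent above 1 is 2 or 3 plus a multiple of 2.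
thirteenBaseFamily : ∀ a → BaseFamily (13 ℕ.^ (2 ℕ.+ a))
thirteenBaseFamily 0 = Thirteen.baseFamily₁₆₉
thirteenBaseFamily 1 = Thirteen.baseFamily₂₁₉₇
thirteenBaseFamily (suc (suc a)) = subst BaseFamily (ℕ.*-assoc 13 13 (13 ℕ.^ (2 ℕ.+ a)))
  (productBaseFamily Thirteen.baseFamily₁₆₉ (thirteenBaseFamily a))

parity : ∀ a → ∃ λ k → a ≡ 2 ℕ.* k ⊎ a ≡ suc (2 ℕ.* k)
parity zero = 0 , inj₁ refl
parity (suc a) with parity a
... | k , inj₁ a≡ = k , inj₂ (cong suc a≡)
... | k , inj₂ a≡ = suc k , inj₁ (trans (cong suc a≡) (sym (ℕ.*-suc 2 k)))

even-power : ∀ p k → p ℕ.^ (2 ℕ.* k) ≡ (p ℕ.* p) ℕ.^ k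
even-power p k = trans (sym (ℕ.^-*-assoc p 2 k)) (cong (λ x → (p ℕ.* x) ℕ.^ k) (ℕ.*-identityʳ p))

power%6≡1 : ∀ {x} → x % 6 ≡ 1 → ∀ k → x ℕ.^ k % 6 ≡ 1
power%6≡1     x%6≡1 zero    = refl
power%6≡1 {x} x%6≡1 (suc k) = trans (%-distribˡ-* x (x ℕ.^ k) 6) (cong₂ (λ r s → r ℕ.* s % 6) x%6≡1 (power%6≡1 x%6≡1 k))

divisor-of-6 : ∀ {d p} a → d ∣ 6 → d ∣ p → 1 ℕ.≤ a → p ℕ.^ a % 6 ≡ 1 → d ∣ 1
divisor-of-6 {d} {p} (suc a) d∣6 d∣p _ eq =
  ∣m+n∣m⇒∣n (subst (d ∣_) (trans (quotient-remainder 1 eq) (ℕ.+-comm 1 _)) (∣m⇒∣m*n (p ℕ.^ a) d∣p)) (∣m⇒∣m*n (p ℕ.^ suc a / 6) d∣6)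

-- As `p^a` is prime to 6, p is 1 or 5 modulo 6. In the first case a product of a copies of the
-- family of order p serves, except for p = 13. In the second an odd power would be 5 modulo 6, so a
-- is even and copies of the family of order p² are multiplied.
primePower⇒baseFamily : ∀ {p} a → Prime p → 1 ℕ.≤ a → p ℕ.^ a % 6 ≡ 1 → p ℕ.^ a ≢ 13 → BaseFamily (p ℕ.^ a)
primePower⇒baseFamily {p} a p-prime 1≤a pᵃ%6≡1 pᵃ≢13 = byResidue (p % 6) (m%n<n p 6) refl
  where
  p≡ : ∀ {r} → p % 6 ≡ r → p ≡ r ℕ.+ 6 ℕ.* (p / 6)
  p≡ = quotient-remainder _
  even : ∀ r → p % 6 ≡ r → 2 ∣ r → BaseFamily (p ℕ.^ a)
  even r eq 2∣r = contradiction (∣1⇒≡1 (divisor-of-6 a (divides 3 refl)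
    (subst (2 ∣_) (sym (p≡ eq)) (∣m∣n⇒∣m+n 2∣r (∣m⇒∣m*n (p / 6) (divides 3 refl)))) 1≤a pᵃ%6≡1)) λ ()
  byResidue : ∀ r → r ℕ.< 6 → p % 6 ≡ r → BaseFamily (p ℕ.^ a)
  byResidue 0 _ eq = even 0 eq (divides 0 refl)
  byResidue 2 _ eq = even 2 eq (divides 1 refl)
  byResidue 4 _ eq = even 4 eq (divides 2 refl)
  byResidue 3 _ eq = contradiction (∣1⇒≡1 (divisor-of-6 a (divides 2 refl)
    (subst (3 ∣_) (sym (p≡ eq)) (∣m∣n⇒∣m+n (divides 1 refl) (∣m⇒∣m*n (p / 6) (divides 2 refl)))) 1≤a pᵃ%6≡1)) λ ()
  byResidue 1 _ eq with p ℕ.≟ 13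
  ... | no p≢13 = powerBaseFamily (prime⇒baseFamily p-prime eq p≢13) a
  ... | yes refl = thirteen a 1≤a pᵃ≢13
    where
    thirteen : ∀ a → 1 ℕ.≤ a → 13 ℕ.^ a ≢ 13 → BaseFamily (13 ℕ.^ a)
    thirteen 1             _ ≢13 = contradiction refl ≢13
    thirteen (suc (suc a)) _ _   = thirteenBaseFamily a
  byResidue 5 _ eq with parity a
  ... | k , inj₁ a≡ = subst BaseFamily (trans (sym (even-power p k)) (cong (p ℕ.^_) (sym a≡)))
                        (powerBaseFamily (primeSquare⇒baseFamily p-prime eq) k)
  ... | k , inj₂ a≡ = contradiction (trans (sym (odd k)) (trans (cong (λ a → p ℕ.^ a % 6) (sym a≡)) pᵃ%6≡1)) λ ()
    where
    odd : ∀ k → p ℕ.^ suc (2 ℕ.* k) % 6 ≡ 5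
    odd k = trans (%-distribˡ-* p (p ℕ.^ (2 ℕ.* k)) 6) (cong₂ (λ r s → r ℕ.* s % 6) eq
      (trans (cong (_% 6) (even-power p k)) (power%6≡1 (square%6≡1 {p} eq) k)))
  byResidue (suc (suc (suc (suc (suc (suc _)))))) (s≤s (s≤s (s≤s (s≤s (s≤s (s≤s ())))))) _

-- Splitting off maximal prime power factors

prime-divisor : ∀ v → 1 ℕ.< v → ∃ λ p → Prime p × p ∣ v
prime-divisor v 1<v with factorise v {{ℕ.>-nonZero (ℕ.<-trans ℕ.z<s 1<v)}}
... | record { factors = [] ; isFactorisation = v≡1 } = contradiction 1<v (ℕ.<-irrefl (sym v≡1))
... | record { factors = p ∷ ps ; isFactorisation = v≡ ; factorsPrime = p-prime ∷ _ } = p , p-prime , subst (p ∣_) (sym v≡) (m∣m*n _)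

exactPower : ∀ {p} → Prime p → ∀ v → 1 ℕ.≤ v → Acc ℕ._<_ v → ∃ λ a → ∃ λ w → v ≡ p ℕ.^ a ℕ.* w × ¬ p ∣ w
exactPower {p} p-prime v 1≤v (acc rec) with p ∣? v
... | no  p∤v = 0 , v , sym (ℕ.*-identityˡ v) , p∤v
... | yes (divides zero    refl) = contradiction 1≤v λ ()
... | yes (divides (suc u) refl) =
  let a , w , eq , p∤w = exactPower p-prime (suc u) (s≤s z≤n) (rec (ℕ.m<m*n (suc u) p (ℕ.nonTrivial⇒n>1 p {{prime⇒nonTrivial p-prime}})))
  in suc a , w , trans (ℕ.*-comm (suc u) p) (trans (cong (p ℕ.*_) eq) (sym (ℕ.*-assoc p _ w))) , p∤w

-- Euclid's lemma places one factor r in m; dividing it out of both sides lowers k.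
cancel-prime : ∀ {p r} → Prime p → Prime r → r ≢ p → ∀ k {m} → r ℕ.^ k ∣ p ℕ.* m → r ℕ.^ k ∣ m
cancel-prime p-prime r-prime r≢p zero    _ = 1∣ _
cancel-prime {p} {r} p-prime r-prime r≢p (suc k) {m} rᵏ∣pm with euclidsLemma p m r-prime (∣-trans (m∣m*n (r ℕ.^ k)) rᵏ∣pm)
... | inj₁ r∣p with prime⇒irreducible p-prime r∣p
...   | inj₁ refl = contradiction (prime⇒nonTrivial r-prime) λ ()
...   | inj₂ r≡p  = contradiction r≡p r≢p
cancel-prime {p} {r} p-prime r-prime r≢p (suc k) rᵏ∣pm | inj₂ (divides m refl) =
  subst (r ℕ.^ suc k ∣_) (ℕ.*-comm r m) (*-monoʳ-∣ r (cancel-prime p-prime r-prime r≢p k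
    (*-cancelˡ-∣ r {{prime⇒nonZero r-prime}} (subst (r ℕ.^ suc k ∣_) (trans (cong (p ℕ.*_) (ℕ.*-comm m r))
      (trans (sym (ℕ.*-assoc p r m)) (trans (cong (ℕ._* m) (ℕ.*-comm p r)) (ℕ.*-assoc r p m)))) rᵏ∣pm))))

cancel-primePower : ∀ {p r} → Prime p → Prime r → r ≢ p → ∀ k a {m} → r ℕ.^ k ∣ p ℕ.^ a ℕ.* m → r ℕ.^ k ∣ m
cancel-primePower {r = r} p-prime r-prime r≢p k zero    {m} div = subst (r ℕ.^ k ∣_) (ℕ.*-identityˡ m) div
cancel-primePower {p} {r} p-prime r-prime r≢p k (suc a) {m} div = cancel-primePower p-prime r-prime r≢p k a
  (cancel-prime p-prime r-prime r≢p k (subst (r ℕ.^ k ∣_) (ℕ.*-assoc p (p ℕ.^ a) m) div))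

goodOrder⇒baseFamily : ∀ v → 1 ℕ.≤ v → GoodOrder v → Acc ℕ._<_ v → BaseFamily v
goodOrder⇒baseFamily v 1≤v good (acc rec) with 1 ℕ.<? v
... | no  v≤1 = subst BaseFamily (ℕ.≤-antisym 1≤v (ℕ.≮⇒≥ v≤1)) trivialBaseFamily
... | yes 1<v with prime-divisor v 1<v
... | p , p-prime , p∣v with exactPower p-prime v 1≤v (<-wellFounded v)
... | zero , w , v≡ , p∤w = contradiction (subst (p ∣_) (trans v≡ (ℕ.*-identityˡ w)) p∣v) p∤w
... | a@(suc a-1) , w , refl , p∤w = productBaseFamily
  (let pᵃ%6≡1 , pᵃ≢13 = good p a p-prime (s≤s z≤n) (m∣m*n w) exact in primePower⇒baseFamily a p-prime (s≤s z≤n) pᵃ%6≡1 pᵃ≢13)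
  (goodOrder⇒baseFamily w 1≤w good-w (rec w<v))
  where
  instance
    p≢0 : NonZero p
    p≢0 = prime⇒nonZero p-prime
    pᵃ≢0 : NonZero (p ℕ.^ a)
    pᵃ≢0 = ℕ.m^n≢0 p a
  exact : ¬ (p ℕ.^ (a ℕ.+ 1)) ∣ p ℕ.^ a ℕ.* w
  exact div = p∤w (*-cancelˡ-∣ (p ℕ.^ a) (subst (_∣ p ℕ.^ a ℕ.* w) (trans (ℕ.^-distribˡ-+-* p a 1) (cong (p ℕ.^ a ℕ.*_) (ℕ.*-identityʳ p))) div))
  1≤w : 1 ℕ.≤ w
  1≤w = ℕ.n≢0⇒n>0 λ { refl → p∤w (p ∣0) }
  w<v : w ℕ.< p ℕ.^ a ℕ.* w
  w<v = subst (w ℕ.<_) (ℕ.*-comm w (p ℕ.^ a)) (ℕ.m<m*n w (p ℕ.^ a) {{ℕ.>-nonZero 1≤w}}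
    (ℕ.<-≤-trans (ℕ.nonTrivial⇒n>1 p {{prime⇒nonTrivial p-prime}}) (ℕ.m≤m*n p (p ℕ.^ a-1) {{ℕ.m^n≢0 p a-1}})))
  -- A maximal prime power factor of w is one of v: its prime differs from p, which does not divide
  -- w, and powers of other primes dividing `p^a w` already divide w.
  good-w : GoodOrder w
  good-w r b r-prime 1≤b rᵇ∣w rᵇ⁺¹∤w with r ℕ.≟ p
  ... | yes refl = contradiction (∣-trans (divides-power b 1≤b) rᵇ∣w) p∤w
    where
    divides-power : ∀ b → 1 ℕ.≤ b → p ∣ p ℕ.^ b
    divides-power (suc b) _ = m∣m*n (p ℕ.^ b)
  ... | no  r≢p  = good r b r-prime 1≤b (∣n⇒∣m*n (p ℕ.^ a) rᵇ∣w) λ div → rᵇ⁺¹∤w (cancel-primePower p-prime r-prime r≢p (b ℕ.+ 1) a div)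

theorem16 : (v : ℕ) → 1 ≤ v → GoodOrder v → RegularFK v
theorem16 v 1≤v good = baseFamily⇒regularFK (goodOrder⇒baseFamily v 1≤v good (<-wellFounded v))
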